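{- Let $r,t$ be positive integers. There is a constant $\beta=\beta(r,t)$ such that the following holds. Let $G$ be an $n$-vertex graph with $e(G)\geq \beta n^{\frac{4t}{2t+1}+\frac{1}{r}}$ edges, where $n^{(2t+1)/r}>12t\ln(r^2 n)$ and $n>t!$. Then $G$ contains a subgraph $G^*$ with $d(G^*)\geq 2t+1$, $\mathrm{rad}(G^*)\leq r+1$ and $n(G^*)\leq r(4t^2+2t)$.
   Context: $n(H)$, $e(H)$, $d(H)=2e(H)/n(H)$ and $\mathrm{rad}(H)$ denote the number of vertices, number of edges, average degree and radius of a graph $H$. -}

module Defs where

open import Data.Nat using (ℕ; zero; suc; _+_; _*_; _∸_; _^_; _≤_; _<_; _<ᵇ_)
open import Data.Nat.Combinatorics using (_P_)
open import Data.Nat.Base using (_!)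
open import Data.Bool using (Bool; true; false; if_then_else_; _∧_)
open import Data.Fin using (Fin; toℕ)
open import Data.List using (List; map; upTo; allFin)
open import Data.Nat.ListAction using (sum)
open import Data.Product using (Σ; ∃; _×_; _,_)
open import Relation.Binary.PropositionalEquality using (_≡_)
open import Function.Definitions using (Injective)

record Graph (n : ℕ) : Set where
  field
    adj    : Fin n → Fin n → Bool
    sym    : ∀ i j → adj i j ≡ adj j i
    irrefl : ∀ i → adj i i ≡ false
open Graph public

count : ∀ {n} → (Fin n → Bool) → ℕ
count {n} p = sum (map (λ i → if p i then 1 else 0) (allFin n))

edges : ∀ {n} → Graph n → ℕ
edges {n} G = sum (map (λ i → count (λ j → (toℕ i <ᵇ toℕ j) ∧ adj G i j)) (allFin n))

record Subgraph {n : ℕ} (G : Graph n) : Set where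
  field
    m        : ℕ
    H        : Graph m
    emb      : Fin m → Fin n
    emb-inj  : Injective _≡_ _≡_ emb
    edge-pres : ∀ i j → adj H i j ≡ true → adj G (emb i) (emb j) ≡ true
open Subgraph public

data WalkWithin {m : ℕ} (H : Graph m) : ℕ → Fin m → Fin m → Set where
  here : ∀ {k v} → WalkWithin H k v v
  step : ∀ {k v w u} → WalkWithin H k v w → adj H w u ≡ true → WalkWithin H (suc k) v u

RadiusAtMost : ∀ {m} → Graph m → ℕ → Set
RadiusAtMost {m} H k = Σ (Fin m) λ v → ∀ u → WalkWithin H k v u

-- Scaled K-th Taylor partial sum of exp(p/q):
--   q^K * K! * Σ_{k=0}^{K} (p/q)^k / k!  =  Σ_{k=0}^{K} p^k q^(K-k) K!/k!
-- with K!/k! = K P (K - k).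
expPartialScaled : ℕ → ℕ → ℕ → ℕ
expPartialScaled p q K =
  sum (map (λ k → p ^ k * q ^ (K ∸ k) * (K P (K ∸ k))) (upTo (suc K)))

-- The real inequality  n^((2t+1)/r) > 12 t ln(r^2 n), expressed without reals:
-- there is a rational b = p/q (q ≥ 1) with 12 t b < n^((2t+1)/r)
-- (i.e. (12 t p)^r < q^r n^(2t+1)) and exp(b) > r^2 n
-- (witnessed by a Taylor partial sum: r^2 n q^K K! < expPartialScaled p q K).
LogCondition : ℕ → ℕ → ℕ → Set
LogCondition r t n =
  Σ ℕ λ p → Σ ℕ λ q → Σ ℕ λ K →
    (1 ≤ q) ×
    ((12 * t * p) ^ r < q ^ r * n ^ (2 * t + 1)) ×
    (r * r * n * q ^ K * K ! < expPartialScaled p q K)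

-- e(G) ≥ β n^(4t/(2t+1) + 1/r), with exponent (4tr+2t+1)/(r(2t+1)),
-- raised to the power r(2t+1):  β^(r(2t+1)) n^(4tr+2t+1) ≤ e(G)^(r(2t+1)).
EdgeCondition : ℕ → ℕ → ℕ → (n : ℕ) → Graph n → Set
EdgeCondition r t β n G =
  β ^ (r * (2 * t + 1)) * n ^ (4 * t * r + 2 * t + 1) ≤ edges G ^ (r * (2 * t + 1))

-- A K_{t+1,M} with M = (2t+1)(t+1) already has average degree 2t+1, so any t+1 vertices may be assumed to have
-- fewer than M common neighbours.  A state is a pair of disjoint t-sets A, B, and a cell over it is an edge xy with x
-- joined to all of A and y to all of B: adding one or two new vertices of a cell to a vertex set containing A and B never
-- brings the density, measured against the deficit of the 2t starting vertices, below 2t+1.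
--
-- Suppose a family of good states is such that every good state has a block of cells which avoids any prescribed small
-- set of vertices and whose vertices contain another good state.  Growing the states from a start in breadth-first
-- fashion, with the states of one level disjoint, either multiplies the number of states by γ at each level, which is
-- impossible for depth(r) levels as γ^depth(r) > n, or some vertex lies in cells over 2t+3 disjoint states of one level.
-- The union of 2t+2 of their histories with this vertex and one of its mates then has average degree at least 2t+1.
--
-- Good states come from a robust family of copies of a template graph, one in which each cell of each copy can be replaced
-- in many ways; it is obtained from the set of all copies by deleting small fibres, which succeeds when the copies
-- sufficiently outnumber the copies with one cell removed.  For t = 1 the template is the hexagon, with states its pairs
-- of opposite vertices.  For t ≥ 2 it consists of two t-matchings every edge of one of which forms a 4-cycle with every
-- edge of the other (the cube when t = 2); here vertices of large degree are removed first, so that degenerate copies are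
-- rare.

module Submission where

open import Defs hiding (sym)
open import Data.Bool using (Bool; true; false; if_then_else_; _∧_; T)
import Data.Bool.Properties as Bool
open import Data.Fin using (Fin; toℕ)
import Data.Fin.Properties as Fin
import Data.List
import Data.Fin
import Data.Vec
import Data.Vec.Properties as Vec
open import Data.List using (List; []; _∷_; _++_; map; filter; length; allFin; concatMap; cartesianProductWith; cartesianProduct; take)
import Data.List.Properties as List
open import Data.List.Membership.Propositional using (_∈_; _∉_)
open import Data.List.Membership.Propositional.Properties using (∈-++⁺ˡ; ∈-++⁺ʳ; ∈-++⁻; ∈-allFin; ∈-filter⁺; ∈-filter⁻; ∈-map⁻; ∈-lookup; ∈-cartesianProductWith⁺; ∈-cartesianProductWith⁻; ∈-cartesianProduct⁺; ∈-cartesianProduct⁻; ∈-∃++)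
open import Data.List.Relation.Binary.Disjoint.Propositional using (Disjoint)
open import Data.List.Relation.Binary.Subset.Propositional using (_⊆_)
open import Data.List.Relation.Unary.All as All using (All; []; _∷_)
import Data.List.Relation.Unary.All.Properties as All
open import Data.List.Relation.Unary.AllPairs as AllPairs using (AllPairs; []; _∷_)
import Data.List.Relation.Unary.AllPairs.Properties as AllPairs
open import Data.List.Relation.Unary.Any as Any using (Any; here; there)
open import Data.List.Relation.Unary.Any.Properties using (lookup-index)
open import Data.List.Relation.Unary.Unique.Propositional using (Unique)
import Data.List.Relation.Unary.Unique.Propositional.Properties as Unique
open import Data.Nat using (ℕ; zero; suc; _+_; _*_; _∸_; _^_; _≤_; _<_; _<ᵇ_; _/_; _%_; z≤n; s≤s; NonZero; >-nonZero; _≤?_; _<?_)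
open import Data.Nat.Base using (_!)
open import Data.Nat.DivMod using (m/n*n≤m; m≡m%n+[m/n]*n; m%n<n)
open import Data.Nat.ListAction using (sum)
open import Data.Nat.Properties
open import Data.Nat.Tactic.RingSolver using (solve-∀)
open import Data.Product using (Σ; ∃; _×_; _,_; proj₁; proj₂)
import Data.Product.Properties as Product
open import Data.Sum using (_⊎_; inj₁; inj₂)
open import Data.Unit using (tt)
open import Data.Vec using (Vec; []; _∷_; lookup; removeAt; insertAt; toList)
open import Function using (_∘_; id)
open import Relation.Binary.PropositionalEquality using (_≡_; _≢_; refl; sym; trans; cong; cong₂; subst)
open import Relation.Nullary using (¬_; Dec; yes; no; does; contradiction)
open import Relation.Nullary.Decidable using (¬?; _×-dec_; _⊎-dec_; dec-true)

open ≤-Reasoning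

-- Let E be twice the number of edges. At edge density E/n² a typical state has about
-- E^(2t+1)/n^(4t) cells over it: n² pairs, each requiring 2t+1 edges. The growth rate `γ` is a
-- constant fraction of this number, and the edge hypothesis says that γ^r > n^(2t+1) once the
-- constants are absorbed in β. As 2t+1 ≥ 3, about r/3 levels already exceed n. This saving pays for
-- keeping 2t+2 whole histories: three units of r allow 12t²+6t vertices, while one level of 2t+2
-- histories costs at most 8t²+8t.
--
-- The template must be abundant at the exponent 4t/(2t+1). Two 1-matchings joined as for t ≥ 2
-- would form a 4-cycle, and a graph may have about n^(3/2) edges and no 4-cycle; so t = 1 requires
-- the hexagon, whose Turán exponent is 4/3. For t = 2 the exponent 8/5 is the classical bound for
-- the cube. The removal of large degrees also depends on t ≥ 2, as it rests on (5t+1)(2t+1) ≤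
-- 4t(3t+1).

-- Finite sums over lists.

∑ : {A : Set} → List A → (A → ℕ) → ℕ
∑ [] f = 0
∑ (x ∷ xs) f = f x + ∑ xs f

sum-map : {A : Set} (xs : List A) (f : A → ℕ) → sum (map f xs) ≡ ∑ xs f
sum-map [] f = refl
sum-map (x ∷ xs) f = cong (f x +_) (sum-map xs f)

𝟙 : Bool → ℕ
𝟙 b = if b then 1 else 0

# : {A : Set} {P : A → Set} → (∀ x → Dec (P x)) → List A → ℕ
# P? xs = ∑ xs (λ x → 𝟙 (does (P? x)))

∑-mono∈ : {A : Set} (xs : List A) {f g : A → ℕ} → (∀ x → x ∈ xs → f x ≤ g x) → ∑ xs f ≤ ∑ xs g
∑-mono∈ [] h = z≤n
∑-mono∈ (x ∷ xs) h = +-mono-≤ (h x (here refl)) (∑-mono∈ xs (λ y y∈ → h y (there y∈)))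

∑-mono : {A : Set} (xs : List A) {f g : A → ℕ} → (∀ x → f x ≤ g x) → ∑ xs f ≤ ∑ xs g
∑-mono xs h = ∑-mono∈ xs (λ x _ → h x)

∑-cong : {A : Set} (xs : List A) {f g : A → ℕ} → (∀ x → f x ≡ g x) → ∑ xs f ≡ ∑ xs g
∑-cong [] h = refl
∑-cong (x ∷ xs) h = cong₂ _+_ (h x) (∑-cong xs h)

∑-+ : {A : Set} (xs : List A) (f g : A → ℕ) → ∑ xs (λ x → f x + g x) ≡ ∑ xs f + ∑ xs g
∑-+ [] f g = refl
∑-+ (x ∷ xs) f g = trans (cong (f x + g x +_) (∑-+ xs f g)) (lemma (f x) (g x) (∑ xs f) (∑ xs g))
  where
  lemma : ∀ a b c d → a + b + (c + d) ≡ a + c + (b + d)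
  lemma = solve-∀

∑-*ˡ : {A : Set} (xs : List A) (c : ℕ) (f : A → ℕ) → ∑ xs (λ x → c * f x) ≡ c * ∑ xs f
∑-*ˡ [] c f = sym (*-zeroʳ c)
∑-*ˡ (x ∷ xs) c f = trans (cong (c * f x +_) (∑-*ˡ xs c f)) (sym (*-distribˡ-+ c (f x) (∑ xs f)))

∑-*ʳ : {A : Set} (xs : List A) (f : A → ℕ) (c : ℕ) → ∑ xs (λ x → f x * c) ≡ ∑ xs f * c
∑-*ʳ xs f c = trans (∑-cong xs (λ x → *-comm (f x) c)) (trans (∑-*ˡ xs c f) (*-comm c _))

∑-const : {A : Set} (xs : List A) (c : ℕ) → ∑ xs (λ _ → c) ≡ length xs * c
∑-const [] c = refl
∑-const (x ∷ xs) c = cong (c +_) (∑-const xs c)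

∑-swap : {A B : Set} (xs : List A) (ys : List B) (f : A → B → ℕ) →
  ∑ xs (λ x → ∑ ys (f x)) ≡ ∑ ys (λ y → ∑ xs (λ x → f x y))
∑-swap [] ys f = sym (trans (∑-const ys 0) (*-zeroʳ (length ys)))
∑-swap (x ∷ xs) ys f = trans (cong (∑ ys (f x) +_) (∑-swap xs ys f)) (sym (∑-+ ys (f x) _))

∑-++ : {A : Set} (xs ys : List A) (f : A → ℕ) → ∑ (xs ++ ys) f ≡ ∑ xs f + ∑ ys f
∑-++ [] ys f = refl
∑-++ (x ∷ xs) ys f = trans (cong (f x +_) (∑-++ xs ys f)) (sym (+-assoc (f x) _ _))

∑-map : {A B : Set} (g : A → B) (xs : List A) (f : B → ℕ) → ∑ (map g xs) f ≡ ∑ xs (λ x → f (g x))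
∑-map g [] f = refl
∑-map g (x ∷ xs) f = cong (f (g x) +_) (∑-map g xs f)

∑-filter : {A : Set} {P : A → Set} (P? : ∀ x → Dec (P x)) (xs : List A) (f : A → ℕ) →
  ∑ (filter P? xs) f ≡ ∑ xs (λ x → 𝟙 (does (P? x)) * f x)
∑-filter P? [] f = refl
∑-filter P? (x ∷ xs) f with does (P? x)
... | true  = cong₂ _+_ (sym (*-identityˡ (f x))) (∑-filter P? xs f)
... | false = ∑-filter P? xs f

∑-product : {A B C : Set} (g : A → B → C) (xs : List A) (ys : List B) (f : C → ℕ) →
  ∑ (cartesianProductWith g xs ys) f ≡ ∑ xs (λ x → ∑ ys (λ y → f (g x y)))
∑-product g [] ys f = refl
∑-product g (x ∷ xs) ys f =
  trans (∑-++ (map (g x) ys) _ f) (cong₂ _+_ (∑-map (g x) ys f) (∑-product g xs ys f))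

length-product : {A B C : Set} (g : A → B → C) (xs : List A) (ys : List B) →
  length (cartesianProductWith g xs ys) ≡ length xs * length ys
length-product g [] ys = refl
length-product g (x ∷ xs) ys = trans (List.length-++ (map (g x) ys))
  (cong₂ _+_ (List.length-map (g x) ys) (length-product g xs ys))

∑≤length* : {A : Set} (xs : List A) {f : A → ℕ} {c : ℕ} → (∀ x → x ∈ xs → f x ≤ c) → ∑ xs f ≤ length xs * c
∑≤length* xs {c = c} h = ≤-trans (∑-mono∈ xs h) (≤-reflexive (∑-const xs c))

length*≤∑ : {A : Set} (xs : List A) {f : A → ℕ} {c : ℕ} → (∀ x → x ∈ xs → c ≤ f x) → length xs * c ≤ ∑ xs f
length*≤∑ xs {c = c} h = ≤-trans (≤-reflexive (sym (∑-const xs c))) (∑-mono∈ xs h)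

-- By induction: the cross term of (a + S)² splits into the terms 2 a f(y), and each of these is at
-- most a² + f(y)².
∑-cauchy-schwarz : {A : Set} (xs : List A) (f : A → ℕ) →
  ∑ xs f * ∑ xs f ≤ length xs * ∑ xs (λ x → f x * f x)
∑-cauchy-schwarz [] f = z≤n
∑-cauchy-schwarz (x ∷ xs) f = begin
  (a + S) * (a + S)  ≡⟨ expand a S ⟩
  a * a + (2 * (a * S) + S * S)  ≤⟨ +-monoʳ-≤ (a * a) (+-mono-≤ cross (∑-cauchy-schwarz xs f)) ⟩
  a * a + (length xs * (a * a) + Q + length xs * Q) ≡⟨ collect (a * a) (length xs) Q ⟩
  suc (length xs) * (a * a + Q)  ∎
  where
  a = f x
  S = ∑ xs f
  Q = ∑ xs (λ y → f y * f y)
  expand : ∀ a S → (a + S) * (a + S) ≡ a * a + (2 * (a * S) + S * S)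
  expand = solve-∀
  collect : ∀ q l Q → q + (l * q + Q + l * Q) ≡ suc l * (q + Q)
  collect = solve-∀
  amgm : ∀ u v → 2 * (u * v) ≤ u * u + v * v
  amgm u v with ≤-total u v
  ... | inj₁ u≤v = subst (λ w → 2 * (u * w) ≤ u * u + w * w) (m+[n∸m]≡n u≤v)
                     (≤-trans (m≤m+n _ ((v ∸ u) * (v ∸ u))) (≤-reflexive (square u (v ∸ u))))
    where
    square : ∀ u d → 2 * (u * (u + d)) + d * d ≡ u * u + (u + d) * (u + d)
    square = solve-∀
  ... | inj₂ v≤u = subst (λ w → 2 * (w * v) ≤ w * w + v * v) (m+[n∸m]≡n v≤u)
                     (≤-trans (m≤m+n _ ((u ∸ v) * (u ∸ v))) (≤-reflexive (square v (u ∸ v))))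
    where
    square : ∀ v d → 2 * ((v + d) * v) + d * d ≡ (v + d) * (v + d) + v * v
    square = solve-∀
  cross : 2 * (a * S) ≤ length xs * (a * a) + Q
  cross = begin
    2 * (a * S)  ≡⟨ cong (2 *_) (∑-*ˡ xs a f) ⟨
    2 * ∑ xs (λ y → a * f y)  ≡⟨ ∑-*ˡ xs 2 _ ⟨
    ∑ xs (λ y → 2 * (a * f y))  ≤⟨ ∑-mono xs (λ y → amgm a (f y)) ⟩
    ∑ xs (λ y → a * a + f y * f y)  ≡⟨ ∑-+ xs _ _ ⟩
    ∑ xs (λ _ → a * a) + Q  ≡⟨ cong (_+ Q) (∑-const xs (a * a)) ⟩
    length xs * (a * a) + Q  ∎

𝟙-mono : {P Q : Set} (P? : Dec P) (Q? : Dec Q) → (P → Q) → 𝟙 (does P?) ≤ 𝟙 (does Q?)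
𝟙-mono (no _)  Q? h = z≤n
𝟙-mono (yes p) (yes q) h = ≤-refl
𝟙-mono (yes p) (no ¬q) h = contradiction (h p) ¬q

𝟙-cong : {P Q : Set} (P? : Dec P) (Q? : Dec Q) → (P → Q) → (Q → P) → 𝟙 (does P?) ≡ 𝟙 (does Q?)
𝟙-cong P? Q? f g = ≤-antisym (𝟙-mono P? Q? f) (𝟙-mono Q? P? g)

𝟙-× : {P Q : Set} (P? : Dec P) (Q? : Dec Q) → 𝟙 (does (P? ×-dec Q?)) ≡ 𝟙 (does P?) * 𝟙 (does Q?)
𝟙-× (yes p) Q? = sym (+-identityʳ _)
𝟙-× (no ¬p) Q? = refl

𝟙-∪ : {P Q R : Set} (P? : Dec P) (Q? : Dec Q) (R? : Dec R) → (P → Q ⊎ R) →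
  𝟙 (does P?) ≤ 𝟙 (does Q?) + 𝟙 (does R?)
𝟙-∪ (no _)  Q? R? h = z≤n
𝟙-∪ (yes p) Q? R? h with h p
... | inj₁ q = ≤-trans (≤-reflexive (cong 𝟙 (sym (dec-true Q? q)))) (m≤m+n _ _)
... | inj₂ r = ≤-trans (≤-reflexive (cong 𝟙 (sym (dec-true R? r)))) (m≤n+m _ _)

𝟙-*-≤ : {P : Set} (P? : Dec P) {k l : ℕ} → (P → k ≤ l) → 𝟙 (does P?) * k ≤ l
𝟙-*-≤ (no _)  h = z≤n
𝟙-*-≤ (yes p) {k} h = ≤-trans (≤-reflexive (+-identityʳ k)) (h p)

-- Counting the elements of a list.

module _ {A : Set} where

  #-mono : {P Q : A → Set} (P? : ∀ x → Dec (P x)) (Q? : ∀ x → Dec (Q x)) (xs : List A) →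
    (∀ x → P x → Q x) → # P? xs ≤ # Q? xs
  #-mono P? Q? xs h = ∑-mono xs (λ x → 𝟙-mono (P? x) (Q? x) (h x))

  #-∪ : {P Q R : A → Set} (P? : ∀ x → Dec (P x)) (Q? : ∀ x → Dec (Q x)) (R? : ∀ x → Dec (R x)) (xs : List A) →
    (∀ x → P x → Q x ⊎ R x) → # P? xs ≤ # Q? xs + # R? xs
  #-∪ P? Q? R? xs h = ≤-trans (∑-mono xs (λ x → 𝟙-∪ (P? x) (Q? x) (R? x) (h x))) (≤-reflexive (∑-+ xs _ _))

  #-×≤ : {P : A → Set} {Q : Set} (P? : ∀ x → Dec (P x)) (Q? : Dec Q) (xs : List A) {k : ℕ} →
    (Q → # P? xs ≤ k) → # (λ x → P? x ×-dec Q?) xs ≤ k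
  #-×≤ P? (yes q) xs h = ≤-trans (#-mono (λ x → P? x ×-dec yes q) P? xs (λ _ → proj₁)) (h q)
  #-×≤ P? (no ¬q) xs h = ≤-trans (#-mono (λ x → P? x ×-dec no ¬q) (λ _ → no id) xs (λ _ → ¬q ∘ proj₂))
    (≤-trans (≤-reflexive (trans (∑-const xs 0) (*-zeroʳ (length xs)))) z≤n)

  length-filter≡# : {P : A → Set} (P? : ∀ x → Dec (P x)) (xs : List A) → length (filter P? xs) ≡ # P? xs
  length-filter≡# P? [] = refl
  length-filter≡# P? (x ∷ xs) with does (P? x)
  ... | true  = cong suc (length-filter≡# P? xs)
  ... | false = length-filter≡# P? xs

  #-complement : {P : A → Set} (P? : ∀ x → Dec (P x)) (xs : List A) →
    # P? xs + # (λ x → ¬? (P? x)) xs ≡ length xs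
  #-complement P? [] = refl
  #-complement P? (x ∷ xs) with does (P? x)
  ... | true  = cong suc (#-complement P? xs)
  ... | false = trans (+-suc _ _) (cong suc (#-complement P? xs))

  unique-⊆⇒length≤ : {xs ys : List A} → Unique xs → xs ⊆ ys → length xs ≤ length ys
  unique-⊆⇒length≤ {[]} _ _ = z≤n
  unique-⊆⇒length≤ {x ∷ xs} {ys} (x∉ ∷ u) sub with ∈-∃++ (sub (here refl))
  ... | as , bs , refl = begin
    suc (length xs)  ≤⟨ s≤s (unique-⊆⇒length≤ u sub′) ⟩
    suc (length (as ++ bs))  ≡⟨ cong suc (List.length-++ as) ⟩
    suc (length as + length bs) ≡⟨ +-suc (length as) (length bs) ⟨
    length as + length (x ∷ bs) ≡⟨ List.length-++ as ⟨
    length (as ++ x ∷ bs)  ∎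
    where
    sub′ : xs ⊆ as ++ bs
    sub′ {y} y∈ with ∈-++⁻ as (sub (there y∈))
    ... | inj₁ p = ∈-++⁺ˡ p
    ... | inj₂ (here refl) = contradiction refl (All.lookup x∉ y∈)
    ... | inj₂ (there p) = ∈-++⁺ʳ as p

  unique-length≤# : {P : A → Set} (P? : ∀ x → Dec (P x)) {xs ys : List A} →
    Unique xs → xs ⊆ ys → All P xs → length xs ≤ # P? ys
  unique-length≤# P? {xs} {ys} u sub p = ≤-trans
    (unique-⊆⇒length≤ u (λ x∈ → ∈-filter⁺ P? (sub x∈) (All.lookup p x∈)))
    (≤-reflexive (length-filter≡# P? ys))

  ∃-of-# : {P : A → Set} (P? : ∀ x → Dec (P x)) (xs : List A) → 0 < # P? xs → Σ A λ x → x ∈ xs × P x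
  ∃-of-# P? xs lt with filter P? xs in eq
  ... | [] = contradiction (≤-trans lt (≤-reflexive (trans (sym (length-filter≡# P? xs)) (cong length eq)))) (λ ())
  ... | x ∷ _ = x , ∈-filter⁻ P? (subst (x ∈_) (sym eq) (here refl))

  -- A union bound: every `y` spoils at most `c` elements. All greedy choices below, of cells, of
  -- neighbours and of matchings, rest on it.
  #-blocked : {B : Set} {P : A → Set} {R : A → B → Set} (P? : ∀ x → Dec (P x)) (R? : ∀ x y → Dec (R x y))
    (xs : List A) (ys : List B) (c : ℕ) →
    (∀ y → # (λ x → P? x ×-dec R? x y) xs ≤ c) →
    # P? xs ≤ # (λ x → P? x ×-dec All.all? (λ y → ¬? (R? x y)) ys) xs + length ys * c
  #-blocked P? R? xs [] c h = ≤-trans (#-mono P? (λ x → P? x ×-dec All.all? (λ y → ¬? (R? x y)) []) xs (λ x p → p , [])) (m≤m+n _ 0)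
  #-blocked P? R? xs (y ∷ ys) c h = begin
    # P? xs  ≤⟨ #-blocked P? R? xs ys c h ⟩
    # (λ x → P? x ×-dec All.all? (λ z → ¬? (R? x z)) ys) xs + length ys * c
      ≤⟨ +-monoˡ-≤ _ (#-∪ (λ x → P? x ×-dec All.all? (λ z → ¬? (R? x z)) ys) (λ x → P? x ×-dec All.all? (λ z → ¬? (R? x z)) (y ∷ ys)) (λ x → P? x ×-dec R? x y) xs split) ⟩
    N + # (λ x → P? x ×-dec R? x y) xs + length ys * c
      ≤⟨ +-monoˡ-≤ _ (+-monoʳ-≤ N (h y)) ⟩
    N + c + length ys * c  ≡⟨ +-assoc N c _ ⟩
    N + (c + length ys * c)  ∎
    where
    N = # (λ x → P? x ×-dec All.all? (λ z → ¬? (R? x z)) (y ∷ ys)) xs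
    split : ∀ x → _ × All (λ z → ¬ _) ys → (_ × All (λ z → ¬ _) (y ∷ ys)) ⊎ (_ × _)
    split x (p , a) with R? x y
    ... | yes r = inj₂ (p , r)
    ... | no ¬r = inj₁ (p , ¬r ∷ a)

^-cancel-≤ : ∀ k {a b} → 1 ≤ k → a ^ k ≤ b ^ k → a ≤ b
^-cancel-≤ (suc k) {a} {b} _ h with a ≤? b
... | yes a≤b = a≤b
... | no a≰b = contradiction h (<⇒≱ (^-monoˡ-< (suc k) (≰⇒> a≰b)))

*-^-distrib : ∀ a b k → (a * b) ^ k ≡ a ^ k * b ^ k
*-^-distrib a b zero = refl
*-^-distrib a b (suc k) = trans (cong (a * b *_) (*-^-distrib a b k)) (lemma a b (a ^ k) (b ^ k))
  where
  lemma : ∀ a b c d → a * b * (c * d) ≡ a * c * (b * d)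
  lemma = solve-∀

-- Degree sums, and dense vertex lists as subgraphs.

Target : {n : ℕ} → Graph n → ℕ → ℕ → Set
Target G r t = Σ (Subgraph G) λ S →
  (1 ≤ m S) × ((2 * t + 1) * m S ≤ 2 * edges (H S)) × RadiusAtMost (H S) (r + 1) × (m S ≤ r * (4 * t * t + 2 * t))

-- `edges` sees an edge only from its smaller end. Of an ordered adjacent pair exactly one
-- orientation is increasing, and the diagonal vanishes by irreflexivity.
degree-sum : {n : ℕ} (G : Graph n) →
  ∑ (allFin n) (λ i → ∑ (allFin n) (λ j → 𝟙 (adj G i j))) ≡ 2 * edges G
degree-sum {n} G = begin-equality
  ∑ V (λ i → ∑ V (λ j → 𝟙 (adj G i j)))
    ≡⟨ ∑-cong V (λ i → trans (∑-cong V (split i)) (∑-+ V _ _)) ⟩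
  ∑ V (λ i → ∑ V (up i) + ∑ V (λ j → up j i))
    ≡⟨ ∑-+ V _ _ ⟩
  ∑ V (λ i → ∑ V (up i)) + ∑ V (λ i → ∑ V (λ j → up j i))
    ≡⟨ cong (∑ V (λ i → ∑ V (up i)) +_) (∑-swap V V (λ i j → up j i)) ⟩
  ∑ V (λ i → ∑ V (up i)) + ∑ V (λ i → ∑ V (up i))
    ≡⟨ cong₂ _+_ edges-∑ (trans edges-∑ (sym (+-identityʳ (edges G)))) ⟩
  2 * edges G ∎
  where
  V = allFin n
  up : Fin n → Fin n → ℕ
  up i j = 𝟙 ((toℕ i <ᵇ toℕ j) ∧ adj G i j)
  edges-∑ : ∑ V (λ i → ∑ V (up i)) ≡ edges G
  edges-∑ = trans (∑-cong V (λ i → sym (sum-map V (up i)))) (sym (sum-map V _))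
  split : ∀ i j → 𝟙 (adj G i j) ≡ up i j + up j i
  split i j with toℕ i <ᵇ toℕ j in p | toℕ j <ᵇ toℕ i in q
  ... | true  | false = sym (+-identityʳ _)
  ... | false | true  = cong 𝟙 (Graph.sym G i j)
  ... | true  | true  = contradiction (<ᵇ⇒< (toℕ j) (toℕ i) (subst T (sym q) tt))
                          (<⇒≯ (<ᵇ⇒< (toℕ i) (toℕ j) (subst T (sym p) tt)))
  ... | false | false = cong 𝟙 (trans (cong (adj G i) (sym i≡j)) (irrefl G i))
    where
    ≮ : ∀ {a b} → (a <ᵇ b) ≡ false → ¬ a < b
    ≮ e a<b = subst T e (<⇒<ᵇ a<b)
    i≡j : i ≡ j
    i≡j = Fin.toℕ-injective (≤-antisym (≮⇒≥ (≮ q)) (≮⇒≥ (≮ p)))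

module Density {n : ℕ} (G : Graph n) where

  infix 4 _~_
  _~_ : Fin n → Fin n → Set
  x ~ y = adj G x y ≡ true

  _~?_ : ∀ x y → Dec (x ~ y)
  x ~? y = adj G x y Bool.≟ true

  ~-sym : ∀ {x y} → x ~ y → y ~ x
  ~-sym {x} {y} p = trans (Graph.sym G y x) p

  ~⇒≢ : ∀ {x y} → x ~ y → x ≢ y
  ~⇒≢ {x} p refl with trans (sym (irrefl G x)) p
  ... | ()

  𝟙-~? : ∀ x y → 𝟙 (does (x ~? y)) ≡ 𝟙 (adj G x y)
  𝟙-~? x y with adj G x y
  ... | true  = refl
  ... | false = refl

  degreeIn : List (Fin n) → Fin n → ℕ
  degreeIn U x = ∑ U (λ v → 𝟙 (adj G x v))

  degreeSum : List (Fin n) → ℕ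
  degreeSum U = ∑ U (degreeIn U)

  degreeSum-∷ : ∀ x U → degreeSum (x ∷ U) ≡ degreeSum U + 2 * degreeIn U x
  degreeSum-∷ x U = begin-equality
    𝟙 (adj G x x) + degreeIn U x + ∑ U (λ u → 𝟙 (adj G u x) + degreeIn U u)
      ≡⟨ cong₂ (λ b s → 𝟙 b + degreeIn U x + s) (irrefl G x) (∑-+ U _ _) ⟩
    degreeIn U x + (∑ U (λ u → 𝟙 (adj G u x)) + degreeSum U)
      ≡⟨ cong (λ s → degreeIn U x + (s + degreeSum U)) (∑-cong U (λ u → cong 𝟙 (Graph.sym G u x))) ⟩
    degreeIn U x + (degreeIn U x + degreeSum U)
      ≡⟨ rearrange (degreeIn U x) (degreeSum U) ⟩
    degreeSum U + 2 * degreeIn U x ∎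
    where
    rearrange : ∀ d e → d + (d + e) ≡ e + 2 * d
    rearrange = solve-∀

  length≤degreeIn : ∀ {U L x} → Unique L → L ⊆ U → All (x ~_) L → length L ≤ degreeIn U x
  length≤degreeIn {U} {L} {x} u sub adjacent = ≤-trans
    (unique-length≤# (x ~?_) u sub adjacent)
    (≤-reflexive (∑-cong U (𝟙-~? x)))

  degreeSum-gain : ∀ {U L x} → Unique L → L ⊆ U → All (x ~_) L →
    degreeSum U + 2 * length L ≤ degreeSum (x ∷ U)
  degreeSum-gain {U} {L} {x} u sub adjacent = ≤-trans
    (+-monoʳ-≤ (degreeSum U) (*-monoʳ-≤ 2 (length≤degreeIn u sub adjacent)))
    (≤-reflexive (sym (degreeSum-∷ x U)))

  -- Walks live on the vertices of `G` and inside a list `U`, so that they survive every enlargement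
  -- of `U`. They become walks of an induced graph, whose vertices are positions in the list, only
  -- at the very end.
  data Reach (U : List (Fin n)) : ℕ → Fin n → Fin n → Set where
    stay : ∀ {k v} → v ∈ U → Reach U k v v
    move : ∀ {k v w u} → Reach U k v w → w ~ u → u ∈ U → Reach U (suc k) v u

  reach-mono : ∀ {U U′ k k′ v u} → U ⊆ U′ → k ≤ k′ → Reach U k v u → Reach U′ k′ v u
  reach-mono sub k≤ (stay v∈) = stay (sub v∈)
  reach-mono sub (s≤s k≤) (move w e u∈) = move (reach-mono sub k≤ w) e (sub u∈)

  reach-end : ∀ {U k v u} → Reach U k v u → u ∈ U
  reach-end (stay v∈) = v∈
  reach-end (move _ _ u∈) = u∈

  lookup-injective : ∀ {U : List (Fin n)} → Unique U → ∀ i j → Data.List.lookup U i ≡ Data.List.lookup U j → i ≡ j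
  lookup-injective (_ ∷ _) Fin.zero Fin.zero _ = refl
  lookup-injective {U} (x∉ ∷ _) Fin.zero (Fin.suc j) e = contradiction e (All.lookup x∉ (∈-lookup j))
  lookup-injective (x∉ ∷ _) (Fin.suc i) Fin.zero e = contradiction (sym e) (All.lookup x∉ (∈-lookup i))
  lookup-injective (_ ∷ u) (Fin.suc i) (Fin.suc j) e = cong Fin.suc (lookup-injective u i j e)

  induced : List (Fin n) → Σ ℕ Graph
  induced U = length U , record
    { adj    = λ i j → adj G (Data.List.lookup U i) (Data.List.lookup U j)
    ; sym    = λ i j → Graph.sym G _ _
    ; irrefl = λ i → irrefl G _
    }

  ∑-lookup : (U : List (Fin n)) (f : Fin n → ℕ) → ∑ (allFin (length U)) (λ i → f (Data.List.lookup U i)) ≡ ∑ U f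
  ∑-lookup U f = trans (sym (sum-map (allFin (length U)) _)) (trans
    (cong sum (trans (List.map-tabulate id (λ i → f (Data.List.lookup U i)))
      (trans (sym (List.map-tabulate (Data.List.lookup U) f)) (cong (map f) (List.tabulate-lookup U)))))
    (sum-map U f))

  walk : ∀ {U k c u} → Unique U → ∀ i j → Data.List.lookup U i ≡ c → Data.List.lookup U j ≡ u →
    Reach U k c u → WalkWithin (proj₂ (induced U)) k i j
  walk {U} {k} uniq i j p q (stay _) = subst (WalkWithin _ k i) (lookup-injective uniq i j (trans p (sym q))) here
  walk {U} uniq i j p q (move {w = w} r e _) =
    step (walk uniq i l p eq r) (trans (cong₂ (adj G) eq q) e)
    where
    l = Any.index (reach-end r)
    eq : Data.List.lookup U l ≡ w
    eq = sym (lookup-index (reach-end r))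

  dense⇒target : ∀ {r t U c} → Unique U → c ∈ U → (∀ {u} → u ∈ U → Reach U (r + 1) c u) →
    (2 * t + 1) * length U ≤ degreeSum U → length U ≤ r * (4 * t * t + 2 * t) → Target G r t
  dense⇒target {r} {t} {U} {c} uniq c∈ reach dense small =
    record { m = length U ; H = K ; emb = Data.List.lookup U ; emb-inj = lookup-injective uniq _ _ ; edge-pres = λ _ _ e → e } ,
    nonempty c∈ ,
    ≤-trans dense (≤-reflexive (trans (sym sums) (degree-sum K))) ,
    (Any.index c∈ , λ j → walk uniq (Any.index c∈) j (sym (lookup-index c∈)) refl (reach (∈-lookup j))) ,
    small
    where
    K = proj₂ (induced U)
    nonempty : ∀ {U} → c ∈ U → 1 ≤ length U
    nonempty (here _) = s≤s z≤n
    nonempty (there _) = s≤s z≤n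
    sums : ∑ (allFin (length U)) (λ i → ∑ (allFin (length U)) (λ j → 𝟙 (adj K i j))) ≡ degreeSum U
    sums = trans (∑-cong (allFin (length U)) (λ i → ∑-lookup U (λ v → 𝟙 (adj G (Data.List.lookup U i) v))))
                 (∑-lookup U (degreeIn U))

module _ {n : ℕ} (G : Graph n) where

  open Density G

  degree : Fin n → ℕ
  degree x = # (x ~?_) (allFin n)

  ∑-degree : ∑ (allFin n) degree ≡ 2 * edges G
  ∑-degree = trans (∑-cong (allFin n) (λ x → ∑-cong (allFin n) (𝟙-~? x))) (degree-sum G)

length-allFin : ∀ n → length (allFin n) ≡ n
length-allFin n = List.length-tabulate id

#-equal≤1 : {n : ℕ} {P : Fin n → Set} (P? : ∀ x → Dec (P x)) (z : Fin n) →
  # (λ x → P? x ×-dec (x Fin.≟ z)) (allFin n) ≤ 1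
#-equal≤1 {n} P? z = ≤-trans (≤-reflexive (sym (length-filter≡# Q? (allFin n))))
  (unique-⊆⇒length≤ {ys = z ∷ []} (Unique.filter⁺ Q? (Unique.allFin⁺ n))
    (λ x∈ → here (proj₂ (proj₂ (∈-filter⁻ Q? {xs = allFin n} x∈)))))
  where
  Q? = λ x → P? x ×-dec (x Fin.≟ z)

target-⊆ : {n : ℕ} {G G′ : Graph n} {r t : ℕ} → (∀ i j → adj G′ i j ≡ true → adj G i j ≡ true) →
  Target G′ r t → Target G r t
target-⊆ sub (S , nonempty , dense , radius , small) =
  record { m = m S ; H = H S ; emb = emb S ; emb-inj = emb-inj S ; edge-pres = λ i j e → sub _ _ (edge-pres S i j e) } ,
  nonempty , dense , radius , small

-- States, cells, histories and their density.

module Growth {n : ℕ} (G : Graph n) (t : ℕ) where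

  open Density G

  Cell : Set
  Cell = Fin n × Fin n

  record State : Set where
    constructor state
    field
      left right   : List (Fin n)
      length-left  : length left ≡ t
      length-right : length right ≡ t
      unique-left  : Unique left
      unique-right : Unique right
      disjoint     : Disjoint left right

    vertices : List (Fin n)
    vertices = left ++ right

    unique : Unique vertices
    unique = Unique.++⁺ unique-left unique-right disjoint

    length-vertices : length vertices ≡ 2 * t
    length-vertices = trans (List.length-++ left)
      (cong₂ _+_ length-left (trans length-right (sym (+-identityʳ t))))

  open State public

  Extends : State → Cell → Set
  Extends s (x , y) = x ~ y × All (x ~_) (left s) × All (y ~_) (right s)

  extends? : ∀ s c → Dec (Extends s c)
  extends? s (x , y) = (x ~? y) ×-dec (All.all? (x ~?_) (left s) ×-dec All.all? (y ~?_) (right s))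

  cellVertices : List Cell → List (Fin n)
  cellVertices [] = []
  cellVertices ((x , y) ∷ cs) = x ∷ y ∷ cellVertices cs

  length-cellVertices : ∀ cs → length (cellVertices cs) ≡ 2 * length cs
  length-cellVertices [] = refl
  length-cellVertices (c ∷ cs) = trans (cong (2 +_) (length-cellVertices cs)) (sym (*-suc 2 (length cs)))

  ∈-cellVertices⁻ : ∀ cs {p} → p ∈ cellVertices cs → ∃ λ q → ((p , q) ∈ cs ⊎ (q , p) ∈ cs) × q ∈ cellVertices cs
  ∈-cellVertices⁻ ((x , y) ∷ cs) (here refl) = y , inj₁ (here refl) , there (here refl)
  ∈-cellVertices⁻ ((x , y) ∷ cs) (there (here refl)) = x , inj₂ (here refl) , here refl
  ∈-cellVertices⁻ ((x , y) ∷ cs) (there (there p∈)) with ∈-cellVertices⁻ cs p∈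
  ... | q , inj₁ e , q∈ = q , inj₁ (there e) , there (there q∈)
  ... | q , inj₂ e , q∈ = q , inj₂ (there e) , there (there q∈)

  ∈-cellVertices⁺ : ∀ {cs x y} → (x , y) ∈ cs → x ∈ cellVertices cs × y ∈ cellVertices cs
  ∈-cellVertices⁺ (here refl) = here refl , there (here refl)
  ∈-cellVertices⁺ (there p) with ∈-cellVertices⁺ p
  ... | x∈ , y∈ = there (there x∈) , there (there y∈)

  -- The last index collects the whole history. New cells must avoid all of it, but nothing is
  -- demanded between two different histories; their overlaps are absorbed when they are united. The
  -- cell `c` witnesses that every step adds something.
  data Path (s₀ : State) : ℕ → State → List (Fin n) → Set where
    root : Path s₀ 0 s₀ (vertices s₀)
    grow : ∀ {i s s′ P c} → Path s₀ i s P → (cs : List Cell) → length cs ≤ 2 * t → c ∈ cs →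
           All (Extends s) cs → All (_∉ P) (cellVertices cs) → vertices s′ ⊆ cellVertices cs →
           Path s₀ (suc i) s′ (cellVertices cs ++ P)

  end⊆path : ∀ {s₀ i s P} → Path s₀ i s P → vertices s ⊆ P
  end⊆path root v∈ = v∈
  end⊆path (grow p cs _ _ _ _ inside) v∈ = ∈-++⁺ˡ (inside v∈)

  start⊆path : ∀ {s₀ i s P} → Path s₀ i s P → vertices s₀ ⊆ P
  start⊆path root v∈ = v∈
  start⊆path (grow p cs _ _ _ _ _) v∈ = ∈-++⁺ʳ (cellVertices cs) (start⊆path p v∈)

  length-path : ∀ {s₀ i s P} → Path s₀ i s P → length P ≤ 2 * t + i * (4 * t)
  length-path {s₀} root = ≤-trans (≤-reflexive (length-vertices s₀)) (m≤m+n _ _)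
  length-path {i = suc i} (grow {P = P} p cs small _ _ _ _) = begin
    length (cellVertices cs ++ P)  ≡⟨ List.length-++ (cellVertices cs) ⟩
    length (cellVertices cs) + length P  ≡⟨ cong (_+ length P) (length-cellVertices cs) ⟩
    2 * length cs + length P  ≤⟨ +-mono-≤ (*-monoʳ-≤ 2 small) (length-path p) ⟩
    2 * (2 * t) + (2 * t + i * (4 * t))  ≡⟨ rearrange t i ⟩
    2 * t + suc i * (4 * t)  ∎
    where
    rearrange : ∀ t i → 2 * (2 * t) + (2 * t + i * (4 * t)) ≡ 2 * t + suc i * (4 * t)
    rearrange = solve-∀

  -- The density 2t + 1 is reached up to the deficit of the 2t starting vertices, whose mutual edges are not counted.
  AlmostDense : List (Fin n) → Set
  AlmostDense U = (2 * t + 1) * length U ≤ degreeSum U + (2 * t + 1) * (2 * t)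

  record Enlargement (U W : List (Fin n)) (b : ℕ) : Set where
    field
      set       : List (Fin n)
      set-unique : Unique set
      dense     : AlmostDense set
      old       : U ⊆ set
      new       : W ⊆ set
      bounded   : ∀ {u} → u ∈ set → u ∈ U ⊎ u ∈ W
      size      : length set ≤ length U + b

  open Enlargement

  _∈?_ : ∀ (x : Fin n) U → Dec (x ∈ U)
  x ∈? U = Any.any? (x Fin.≟_) U

  ∉⇒≢ : ∀ {x : Fin n} {U} → x ∉ U → All (x ≢_) U
  ∉⇒≢ x∉ = All.tabulate (λ y∈ x≡y → x∉ (subst (_∈ _) (sym x≡y) y∈))

  almostDense-∷ : ∀ {U L x} → AlmostDense U → Unique L → L ⊆ U → All (x ~_) L → t + 1 ≤ length L → AlmostDense (x ∷ U)
  almostDense-∷ {U} {L} {x} d u sub e big = begin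
    (2 * t + 1) * suc (length U)  ≡⟨ *-suc (2 * t + 1) (length U) ⟩
    2 * t + 1 + (2 * t + 1) * length U  ≤⟨ +-mono-≤ (m≤m+n (2 * t + 1) 1) d ⟩
    2 * t + 1 + 1 + (degreeSum U + (2 * t + 1) * (2 * t)) ≡⟨ rearrange t (degreeSum U) ((2 * t + 1) * (2 * t)) ⟩
    degreeSum U + 2 * (t + 1) + (2 * t + 1) * (2 * t)  ≤⟨ +-monoˡ-≤ _ (+-monoʳ-≤ (degreeSum U) (*-monoʳ-≤ 2 big)) ⟩
    degreeSum U + 2 * length L + (2 * t + 1) * (2 * t)  ≤⟨ +-monoˡ-≤ _ (degreeSum-gain u sub e) ⟩
    degreeSum (x ∷ U) + (2 * t + 1) * (2 * t)  ∎
    where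
    rearrange : ∀ t e d → 2 * t + 1 + 1 + (e + d) ≡ e + 2 * (t + 1) + d
    rearrange = solve-∀

  -- Two new vertices bring t + t + 1 edges, hence 2(2t+1) to the degree sum: exactly density 2t+1.
  -- A single new vertex brings t edges and the one to its mate, hence 2t+2. The vertices must lie
  -- off the state, for otherwise the mate could be one of the t neighbours already counted.
  addCell : ∀ {U x y} (s : State) → Unique U → AlmostDense U → vertices s ⊆ U → Extends s (x , y) →
    x ∉ vertices s → y ∉ vertices s → Enlargement U (x ∷ y ∷ []) 2
  addCell {U} {x} {y} s u d sub (x~y , x~A , y~B) x∉ y∉ with x ∈? U | y ∈? U
  ... | yes x∈U | yes y∈U = record
    { set = U ; set-unique = u ; dense = d ; old = id
    ; new = λ { (here refl) → x∈U ; (there (here refl)) → y∈U }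
    ; bounded = inj₁ ; size = m≤m+n _ 2 }
  ... | yes x∈U | no y∉U = record
    { set = y ∷ U ; set-unique = ∉⇒≢ y∉U ∷ u
    ; dense = almostDense-∷ d (∉⇒≢ (x∉ ∘ ∈-++⁺ʳ (left s)) ∷ unique-right s)
        (λ { (here refl) → x∈U ; (there v∈) → sub (∈-++⁺ʳ (left s) v∈) })
        (~-sym x~y ∷ y~B) (≤-reflexive (trans (+-comm t 1) (cong suc (sym (length-right s)))))
    ; old = there
    ; new = λ { (here refl) → there x∈U ; (there (here refl)) → here refl }
    ; bounded = λ { (here refl) → inj₂ (there (here refl)) ; (there v∈) → inj₁ v∈ }
    ; size = ≤-trans (n≤1+n _) (≤-reflexive (+-comm 2 (length U))) }
  ... | no x∉U | yes y∈U = record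
    { set = x ∷ U ; set-unique = ∉⇒≢ x∉U ∷ u
    ; dense = almostDense-∷ d (∉⇒≢ (y∉ ∘ ∈-++⁺ˡ) ∷ unique-left s)
        (λ { (here refl) → y∈U ; (there v∈) → sub (∈-++⁺ˡ v∈) })
        (x~y ∷ x~A) (≤-reflexive (trans (+-comm t 1) (cong suc (sym (length-left s)))))
    ; old = there
    ; new = λ { (here refl) → here refl ; (there (here refl)) → there y∈U }
    ; bounded = λ { (here refl) → inj₂ (here refl) ; (there v∈) → inj₁ v∈ }
    ; size = ≤-trans (n≤1+n _) (≤-reflexive (+-comm 2 (length U))) }
  ... | no x∉U | no y∉U = record
    { set = y ∷ x ∷ U
    ; set-unique = ((~⇒≢ (~-sym x~y)) ∷ ∉⇒≢ y∉U) ∷ (∉⇒≢ x∉U ∷ u)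
    ; dense = both
    ; old = there ∘ there
    ; new = λ { (here refl) → there (here refl) ; (there (here refl)) → here refl }
    ; bounded = λ { (here refl) → inj₂ (there (here refl)) ; (there (here refl)) → inj₂ (here refl)
                  ; (there (there v∈)) → inj₁ v∈ }
    ; size = ≤-reflexive (+-comm 2 (length U)) }
    where
    gain-x : degreeSum U + 2 * t ≤ degreeSum (x ∷ U)
    gain-x = subst (λ l → degreeSum U + 2 * l ≤ _) (length-left s)
      (degreeSum-gain (unique-left s) (sub ∘ ∈-++⁺ˡ) x~A)
    gain-y : degreeSum (x ∷ U) + 2 * suc t ≤ degreeSum (y ∷ x ∷ U)
    gain-y = subst (λ l → degreeSum (x ∷ U) + 2 * suc l ≤ _) (length-right s)
      (degreeSum-gain (∉⇒≢ (x∉ ∘ ∈-++⁺ʳ (left s)) ∷ unique-right s)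
        (λ { (here refl) → here refl ; (there v∈) → there (sub (∈-++⁺ʳ (left s) v∈)) })
        (~-sym x~y ∷ y~B))
    rearrange : ∀ t l → (2 * t + 1) * (2 + l) ≡ (2 * t + 1) * l + (2 * t + 2 * suc t)
    rearrange = solve-∀
    rearrange′ : ∀ e t d → e + d + (2 * t + 2 * suc t) ≡ e + 2 * t + 2 * suc t + d
    rearrange′ = solve-∀
    both : AlmostDense (y ∷ x ∷ U)
    both = begin
      (2 * t + 1) * (2 + length U)  ≡⟨ rearrange t (length U) ⟩
      (2 * t + 1) * length U + (2 * t + 2 * suc t)  ≤⟨ +-monoˡ-≤ _ d ⟩
      degreeSum U + (2 * t + 1) * (2 * t) + (2 * t + 2 * suc t) ≡⟨ rearrange′ (degreeSum U) t _ ⟩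
      degreeSum U + 2 * t + 2 * suc t + (2 * t + 1) * (2 * t) ≤⟨ +-monoˡ-≤ _ (≤-trans (+-monoˡ-≤ (2 * suc t) gain-x) gain-y) ⟩
      degreeSum (y ∷ x ∷ U) + (2 * t + 1) * (2 * t)  ∎

  addCells : ∀ {U} (s : State) (cs : List Cell) → Unique U → AlmostDense U → vertices s ⊆ U → All (Extends s) cs →
    All (_∉ vertices s) (cellVertices cs) → Enlargement U (cellVertices cs) (2 * length cs)
  addCells s [] u d sub [] [] = record
    { set = _ ; set-unique = u ; dense = d ; old = id ; new = λ () ; bounded = inj₁ ; size = m≤m+n _ 0 }
  addCells {U} s ((x , y) ∷ cs) u d sub (e ∷ es) (x∉ ∷ y∉ ∷ av) = record
    { set = set E₂ ; set-unique = set-unique E₂ ; dense = dense E₂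
    ; old = old E₂ ∘ old E₁
    ; new = λ { (here refl) → old E₂ (new E₁ (here refl))
              ; (there (here refl)) → old E₂ (new E₁ (there (here refl)))
              ; (there (there v∈)) → new E₂ v∈ }
    ; bounded = λ u∈ → case₂ (bounded E₂ u∈)
    ; size = begin
        length (set E₂)  ≤⟨ size E₂ ⟩
        length (set E₁) + 2 * length cs  ≤⟨ +-monoˡ-≤ _ (size E₁) ⟩
        length U + 2 + 2 * length cs  ≡⟨ +-assoc (length U) 2 _ ⟩
        length U + (2 + 2 * length cs)  ≡⟨ cong (length U +_) (*-suc 2 (length cs)) ⟨
        length U + 2 * suc (length cs)  ∎ }
    where
    E₁ = addCell s u d sub e x∉ y∉
    E₂ = addCells s cs (set-unique E₁) (dense E₁) (old E₁ ∘ sub) es av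
    case₂ : ∀ {u} → u ∈ set E₁ ⊎ u ∈ cellVertices cs → u ∈ U ⊎ u ∈ x ∷ y ∷ cellVertices cs
    case₂ (inj₂ v∈) = inj₂ (there (there v∈))
    case₂ (inj₁ u∈) with bounded E₁ u∈
    ... | inj₁ v∈ = inj₁ v∈
    ... | inj₂ (here refl) = inj₂ (here refl)
    ... | inj₂ (there (here refl)) = inj₂ (there (here refl))

  -- Only vertices still missing from `U` are added, cell by cell. When a cell is treated its state
  -- is already present, since the shorter history was added before it.
  addPath : ∀ {s₀ i s P U} → Path s₀ i s P → Unique U → AlmostDense U → vertices s₀ ⊆ U →
    Enlargement U P (i * (4 * t))
  addPath root u d sub = record
    { set = _ ; set-unique = u ; dense = d ; old = id ; new = sub ; bounded = inj₁ ; size = m≤m+n _ 0 }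
  addPath {i = suc i} {U = U} (grow {s = s} {P = P} p cs small _ ext avoid _) u d sub = record
    { set = set E₂ ; set-unique = set-unique E₂ ; dense = dense E₂
    ; old = old E₂ ∘ old E₁
    ; new = λ v∈ → new′ (∈-++⁻ (cellVertices cs) v∈)
    ; bounded = λ u∈ → bounded′ (bounded E₂ u∈)
    ; size = begin
        length (set E₂)  ≤⟨ size E₂ ⟩
        length (set E₁) + 2 * length cs  ≤⟨ +-mono-≤ (size E₁) (*-monoʳ-≤ 2 small) ⟩
        length U + i * (4 * t) + 2 * (2 * t)  ≡⟨ rearrange (length U) i t ⟩
        length U + suc i * (4 * t)  ∎ }
    where
    E₁ = addPath p u d sub
    E₂ = addCells s cs (set-unique E₁) (dense E₁) (new E₁ ∘ end⊆path p) ext (All.map (λ v∉ v∈ → v∉ (end⊆path p v∈)) avoid)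
    rearrange : ∀ l i t → l + i * (4 * t) + 2 * (2 * t) ≡ l + suc i * (4 * t)
    rearrange = solve-∀
    new′ : ∀ {v} → v ∈ cellVertices cs ⊎ v ∈ P → v ∈ set E₂
    new′ (inj₁ v∈) = new E₂ v∈
    new′ (inj₂ v∈) = old E₂ (new E₁ v∈)
    bounded′ : ∀ {u} → u ∈ set E₁ ⊎ u ∈ cellVertices cs → u ∈ U ⊎ u ∈ cellVertices cs ++ P
    bounded′ (inj₂ v∈) = inj₂ (∈-++⁺ˡ v∈)
    bounded′ (inj₁ u∈) with bounded E₁ u∈
    ... | inj₁ v∈ = inj₁ v∈
    ... | inj₂ v∈ = inj₂ (∈-++⁺ʳ (cellVertices cs) v∈)

  ∃-∈ : 1 ≤ t → ∀ {L : List (Fin n)} → length L ≡ t → ∃ (_∈ L)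
  ∃-∈ 1≤t {x ∷ L} _ = x , here refl
  ∃-∈ 1≤t {[]} refl = contradiction 1≤t (λ ())

  cell-reach : ∀ {U k c x y} → 1 ≤ t → (s : State) → Extends s (x , y) → x ∈ U → y ∈ U →
    (∀ {v} → v ∈ vertices s → Reach U k c v) → Reach U (suc k) c x × Reach U (suc k) c y
  cell-reach 1≤t s (_ , x~A , y~B) x∈ y∈ reach with ∃-∈ 1≤t (length-left s) | ∃-∈ 1≤t (length-right s)
  ... | a , a∈ | b , b∈ =
    move (reach (∈-++⁺ˡ a∈)) (~-sym (All.lookup x~A a∈)) x∈ ,
    move (reach (∈-++⁺ʳ (left s) b∈)) (~-sym (All.lookup y~B b∈)) y∈

  path-reach : ∀ {s₀ i s P U c} → 1 ≤ t → Path s₀ i s P → P ⊆ U → (∀ {v} → v ∈ vertices s₀ → Reach U 2 c v) →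
    ∀ {v} → v ∈ P → Reach U (i + 2) c v
  path-reach 1≤t root sub reach₀ v∈ = reach₀ v∈
  path-reach 1≤t (grow {s = s} p cs _ _ ext _ _) sub reach₀ v∈ with ∈-++⁻ (cellVertices cs) v∈
  ... | inj₂ v∈P = reach-mono id (n≤1+n _) (path-reach 1≤t p (sub ∘ ∈-++⁺ʳ (cellVertices cs)) reach₀ v∈P)
  ... | inj₁ v∈cs with ∈-cellVertices⁻ cs v∈cs
  ...   | q , inj₁ c∈ , q∈ = proj₁ (cell-reach 1≤t s (All.lookup ext c∈) (sub v∈) (sub (∈-++⁺ˡ q∈))
                               (λ w∈ → path-reach 1≤t p (sub ∘ ∈-++⁺ʳ (cellVertices cs)) reach₀ (end⊆path p w∈)))
  ...   | q , inj₂ c∈ , q∈ = proj₂ (cell-reach 1≤t s (All.lookup ext c∈) (sub (∈-++⁺ˡ q∈)) (sub v∈)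
                               (λ w∈ → path-reach 1≤t p (sub ∘ ∈-++⁺ʳ (cellVertices cs)) reach₀ (end⊆path p w∈)))

  firstCell : ∀ {s₀ i s P} → Path s₀ (suc i) s P → ∃ λ x → ∃ λ y → Extends s₀ (x , y) × x ∈ P × y ∈ P
  firstCell (grow {c = x , y} root cs _ c∈ ext _ _) =
    x , y , All.lookup ext c∈ , ∈-++⁺ˡ (proj₁ (∈-cellVertices⁺ c∈)) , ∈-++⁺ˡ (proj₂ (∈-cellVertices⁺ c∈))
  firstCell (grow p@(grow _ _ _ _ _ _ _) cs _ _ _ _ _) with firstCell p
  ... | x , y , e , x∈ , y∈ = x , y , e , ∈-++⁺ʳ (cellVertices cs) x∈ , ∈-++⁺ʳ (cellVertices cs) y∈

  -- `x` sees the left side directly and the right side through `y`. A vertex of a first cell thus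
  -- serves as centre: the start is within distance 2, and each further level costs one more.
  start-reach : ∀ {U x y} → 1 ≤ t → (s : State) → Extends s (x , y) → x ∈ U → y ∈ U → vertices s ⊆ U →
    ∀ {v} → v ∈ vertices s → Reach U 2 x v
  start-reach 1≤t s (x~y , x~A , y~B) x∈ y∈ sub v∈ with ∈-++⁻ (left s) v∈
  ... | inj₁ a∈ = move (stay x∈) (All.lookup x~A a∈) (sub v∈)
  ... | inj₂ b∈ = move (move (stay x∈) x~y y∈) (All.lookup y~B b∈) (sub v∈)

-- Breadth-first growth and the collision of histories.

record Block {n : ℕ} (G : Graph n) (t : ℕ) (Good : Growth.State G t → Set) (s : Growth.State G t) (Z : List (Fin n)) : Set where
  open Growth G t
  field
    next     : State
    good     : Good next
    cells    : List Cell
    cell     : Cell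
    nonempty : cell ∈ cells
    small    : length cells ≤ 2 * t
    extend   : All (Extends s) cells
    avoid    : All (_∉ Z) (cellVertices cells)
    inside   : vertices next ⊆ cellVertices cells

∃⊎∀ : {A : Set} {P : A → Set} (P? : ∀ x → Dec (P x)) (xs : List A) → (Σ A λ x → x ∈ xs × P x) ⊎ (∀ x → x ∈ xs → ¬ P x)
∃⊎∀ P? [] = inj₂ (λ _ ())
∃⊎∀ P? (x ∷ xs) with P? x | ∃⊎∀ P? xs
... | yes p | _ = inj₁ (x , here refl , p)
... | no ¬p | inj₁ (y , y∈ , p) = inj₁ (y , there y∈ , p)
... | no ¬p | inj₂ h = inj₂ (λ { _ (here refl) → ¬p ; y (there y∈) → h y y∈ })

module Search {n : ℕ} (G : Graph n) (t r m₀ γ k : ℕ) (1≤t : 1 ≤ t)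
  (Good : Growth.State G t → Set)
  (expand : ∀ s → Good s → ∀ Z → length Z ≤ m₀ → Block G t Good s Z)
  (s₀ : Growth.State G t) (good₀ : Good s₀)
  (m₀-large : 2 * t * (2 * t + 2) * γ + (2 * t + k * (4 * t)) ≤ m₀)
  (3k≤r+2 : 3 * k ≤ r + 2) where

  open Density G
  open Growth G t

  record Node (i : ℕ) : Set where
    constructor node
    field
      {end}  : State
      {set}  : List (Fin n)
      path   : Path s₀ i end set
      good   : Good end
  open Node

  Apart : ∀ {i j} → Node i → Node j → Set
  Apart ν μ = Disjoint (vertices (end ν)) (vertices (end μ))

  -- These are the vertices through which a new cell at `ν`, chosen off its history, could meet a
  -- state already placed on the next level. If the cell also avoids the hitting vertices of that
  -- level, its state is disjoint from all of them.
  Hits : ∀ {i} → Fin n → Node i → Set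
  Hits z ν = z ∉ set ν × ∃ λ y → y ∉ set ν × (Extends (end ν) (z , y) ⊎ Extends (end ν) (y , z))

  hits? : ∀ {i} z (ν : Node i) → Dec (Hits z ν)
  hits? z ν = ¬? (z ∈? set ν) ×-dec Fin.any? (λ y → ¬? (y ∈? set ν) ×-dec (extends? (end ν) (z , y) ⊎-dec extends? (end ν) (y , z)))

  -- Forgets whether `z` is the first or the second vertex of the cell: `side` is the half of the
  -- state joined to `z`, and `other` the half joined to its mate.
  record Contact (z : Fin n) {i : ℕ} (ν : Node i) : Set where
    field
      mate         : Fin n
      z~mate       : z ~ mate
      mate∉        : mate ∉ set ν
      side         : List (Fin n)
      side⊆        : side ⊆ vertices (end ν)
      side-unique  : Unique side
      side-length  : length side ≡ t
      z~side       : All (z ~_) side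
      other        : List (Fin n)
      other⊆       : other ⊆ vertices (end ν)
      other-unique : Unique other
      other-length : length other ≡ t
      mate~other   : All (mate ~_) other
  open Contact

  contact : ∀ {z i} (ν : Node i) → Hits z ν → Contact z ν
  contact ν (_ , y , y∉ , inj₁ (z~y , z~A , y~B)) = record
    { mate = y ; z~mate = z~y ; mate∉ = y∉
    ; side = left s ; side⊆ = ∈-++⁺ˡ ; side-unique = unique-left s ; side-length = length-left s ; z~side = z~A
    ; other = right s ; other⊆ = ∈-++⁺ʳ (left s) ; other-unique = unique-right s ; other-length = length-right s ; mate~other = y~B }
    where s = end ν
  contact ν (_ , y , y∉ , inj₂ (y~z , y~A , z~B)) = record
    { mate = y ; z~mate = ~-sym y~z ; mate∉ = y∉
    ; side = right s ; side⊆ = ∈-++⁺ʳ (left s) ; side-unique = unique-right s ; side-length = length-right s ; z~side = z~B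
    ; other = left s ; other⊆ = ∈-++⁺ˡ ; other-unique = unique-left s ; other-length = length-left s ; mate~other = y~A }
    where s = end ν

  record Sides (z : Fin n) {i : ℕ} (νs : List (Node i)) : Set where
    field
      nbrs        : List (Fin n)
      nbrs-unique : Unique nbrs
      nbrs-length : length nbrs ≡ length νs * t
      z~nbrs      : All (z ~_) nbrs
      nbrs-in     : ∀ {v} → v ∈ nbrs → Any (λ ν → v ∈ vertices (end ν)) νs
  open Sides

  sides : ∀ {z i} (νs : List (Node i)) → All (Hits z) νs → AllPairs Apart νs → Sides z νs
  sides [] [] [] = record { nbrs = [] ; nbrs-unique = [] ; nbrs-length = refl ; z~nbrs = [] ; nbrs-in = λ () }
  sides {z} (ν ∷ νs) (h ∷ hs) (ap ∷ aps) = record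
    { nbrs = side c ++ nbrs S
    ; nbrs-unique = Unique.++⁺ (side-unique c) (nbrs-unique S)
        (λ (v∈ , v∈′) → clash (nbrs-in S v∈′) ap (side⊆ c v∈))
    ; nbrs-length = trans (List.length-++ (side c)) (cong₂ _+_ (side-length c) (nbrs-length S))
    ; z~nbrs = All.++⁺ (z~side c) (z~nbrs S)
    ; nbrs-in = λ v∈ → locate (∈-++⁻ (side c) v∈) }
    where
    c = contact ν h
    S = sides νs hs aps
    clash : ∀ {v μs} → Any (λ μ → v ∈ vertices (end μ)) μs → All (Apart ν) μs → v ∉ vertices (end ν)
    clash (here v∈μ) (a ∷ _) v∈ν = a (v∈ν , v∈μ)
    clash (there p) (_ ∷ as) v∈ν = clash p as v∈ν
    locate : ∀ {v} → v ∈ side c ⊎ v ∈ nbrs S → Any (λ μ → v ∈ vertices (end μ)) (ν ∷ νs)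
    locate (inj₁ v∈) = here (side⊆ c v∈)
    locate (inj₂ v∈) = there (nbrs-in S v∈)

  record Union {i : ℕ} (νs : List (Node i)) : Set where
    field
      union        : List (Fin n)
      union-unique : Unique union
      union-dense  : AlmostDense union
      start⊆union  : vertices s₀ ⊆ union
      paths⊆union  : ∀ {ν} → ν ∈ νs → set ν ⊆ union
      in-union     : ∀ {u} → u ∈ union → u ∈ vertices s₀ ⊎ Any (λ ν → u ∈ set ν) νs
      union-size   : length union ≤ 2 * t + length νs * (i * (4 * t))
  open Union

  unite : ∀ {i} (νs : List (Node i)) → Union νs
  unite [] = record
    { union = vertices s₀ ; union-unique = unique s₀
    ; union-dense = ≤-trans (≤-reflexive (cong ((2 * t + 1) *_) (length-vertices s₀))) (m≤n+m _ _)
    ; start⊆union = id ; paths⊆union = λ () ; in-union = inj₁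
    ; union-size = ≤-trans (≤-reflexive (length-vertices s₀)) (m≤m+n _ _) }
  unite {i} (ν ∷ νs) = record
    { union = Enlargement.set E ; union-unique = set-unique ; union-dense = dense
    ; start⊆union = old ∘ start⊆union W
    ; paths⊆union = λ { (here refl) → new ; (there ν∈) → old ∘ paths⊆union W ν∈ }
    ; in-union = λ u∈ → locate (bounded u∈)
    ; union-size = begin
        length (Enlargement.set E)  ≤⟨ size ⟩
        length (union W) + i * (4 * t)  ≤⟨ +-monoˡ-≤ _ (union-size W) ⟩
        2 * t + length νs * (i * (4 * t)) + i * (4 * t)  ≡⟨ rearrange (2 * t) (length νs) (i * (4 * t)) ⟩
        2 * t + suc (length νs) * (i * (4 * t))  ∎ }
    where
    W = unite νs
    E = addPath (path ν) (union-unique W) (union-dense W) (start⊆union W)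
    open Enlargement E hiding (set)
    rearrange : ∀ a l b → a + l * b + b ≡ a + suc l * b
    rearrange = solve-∀
    locate : ∀ {u} → u ∈ union W ⊎ u ∈ set ν → u ∈ vertices s₀ ⊎ Any (λ μ → u ∈ set μ) (ν ∷ νs)
    locate (inj₂ u∈) = inj₂ (here u∈)
    locate (inj₁ u∈) with in-union W u∈
    ... | inj₁ v∈ = inj₁ v∈
    ... | inj₂ a = inj₂ (there a)

  -- Disjoint states cannot share `y`, so at most one of them is discarded.
  apart-filter : ∀ {i} (y : Fin n) (νs : List (Node i)) → AllPairs Apart νs →
    length νs ≤ suc (length (filter (λ ν → ¬? (y ∈? vertices (end ν))) νs))
  apart-filter y [] [] = z≤n
  apart-filter y (ν ∷ νs) (ap ∷ aps) with y ∈? vertices (end ν)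
  ... | yes y∈ = s≤s (≤-reflexive (cong length (sym (List.filter-all (λ ν → ¬? (y ∈? vertices (end ν)))
                   (All.map (λ a y∈μ → a (y∈ , y∈μ)) ap)))))
  ... | no _ = s≤s (apart-filter y νs aps)

  -- The new vertex z has t(2t+2) neighbours in the union of the histories. Its mate over ν either lies in the union,
  -- giving z one more neighbour, or is a further new vertex with t + 1 neighbours; either way the deficit is just covered.
  collide : ∀ {i} z (ν : Node (suc i)) (νs : List (Node (suc i))) (h : Hits z ν) → All (Hits z) νs →
    AllPairs Apart (ν ∷ νs) → All (λ μ → mate (contact ν h) ∉ vertices (end μ)) νs → length νs ≡ 2 * t + 1 →
    suc i < k → Target G r t
  collide {i} z ν νs h hs apart misses len i<k = finish (y ∈? U)
    where
    ℓ = suc i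
    W = unite (ν ∷ νs)
    S = sides (ν ∷ νs) (h ∷ hs) apart
    c = contact ν h
    y = mate c
    U = union W
    X = (2 * t + 1) * (2 * t)

    z∉U : z ∉ U
    z∉U z∈ with in-union W z∈
    ... | inj₁ v∈ = proj₁ h (start⊆path (path ν) v∈)
    ... | inj₂ a = outside (h ∷ hs) a
      where
      outside : ∀ {μs} → All (Hits z) μs → ¬ Any (λ μ → z ∈ set μ) μs
      outside (h ∷ _) (here z∈) = proj₁ h z∈
      outside (_ ∷ hs) (there a) = outside hs a

    located : ∀ {v μs} → Any (λ μ → v ∈ vertices (end μ)) μs → (∀ {μ} → μ ∈ μs → set μ ⊆ U) → v ∈ U
    located {μs = μ ∷ _} (here v∈) sub = sub (here refl) (end⊆path (path μ) v∈)
    located (there a) sub = located a (sub ∘ there)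

    nbrs⊆U : nbrs S ⊆ U
    nbrs⊆U v∈ = located (nbrs-in S v∈) (paths⊆union W)

    nbrs-count : length (nbrs S) ≡ (2 * t + 2) * t
    nbrs-count = trans (nbrs-length S) (trans (cong (λ l → suc l * t) len) (lemma t))
      where
      lemma : ∀ t → suc (2 * t + 1) * t ≡ (2 * t + 2) * t
      lemma = solve-∀

    y∉nbrs : y ∉ nbrs S
    y∉nbrs y∈ with nbrs-in S y∈
    ... | here y∈ν = mate∉ c (end⊆path (path ν) y∈ν)
    ... | there a = elsewhere misses a
      where
      elsewhere : ∀ {μs} → All (λ μ → y ∉ vertices (end μ)) μs → ¬ Any (λ μ → y ∈ vertices (end μ)) μs
      elsewhere (y∉ ∷ _) (here y∈) = y∉ y∈
      elsewhere (_ ∷ ms) (there a) = elsewhere ms a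

    other⊆U : other c ⊆ U
    other⊆U v∈ = paths⊆union W (here refl) (end⊆path (path ν) (other⊆ c v∈))

    first = firstCell (path ν)
    x₀ = proj₁ first

    x₀∈U : x₀ ∈ U
    x₀∈U = paths⊆union W (here refl) (proj₁ (proj₂ (proj₂ (proj₂ first))))

    reach₀ : ∀ {v} → v ∈ vertices s₀ → Reach U 2 x₀ v
    reach₀ = start-reach 1≤t s₀ (proj₁ (proj₂ (proj₂ first))) x₀∈U
      (paths⊆union W (here refl) (proj₂ (proj₂ (proj₂ (proj₂ first))))) (start⊆union W)

    -- The collision happens strictly before level `k`, so 3(ℓ+1) ≤ 3k ≤ r+2. Both the radius and
    -- the size are paid from this inequality.
    3ℓ+1≤r : 3 * ℓ + 1 ≤ r
    3ℓ+1≤r = +-cancelʳ-≤ 2 (3 * ℓ + 1) r (≤-trans (≤-reflexive (lemma ℓ)) (≤-trans (*-monoʳ-≤ 3 i<k) 3k≤r+2))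
      where
      lemma : ∀ ℓ → 3 * ℓ + 1 + 2 ≡ 3 * suc ℓ
      lemma = solve-∀

    ℓ+3≤r+1 : suc (ℓ + 2) ≤ r + 1
    ℓ+3≤r+1 = ≤-trans (≤-trans (m≤m+n _ (2 * i + 1)) (≤-reflexive (lemma i))) (+-monoˡ-≤ 1 3ℓ+1≤r)
      where
      lemma : ∀ i → suc (suc i + 2) + (2 * i + 1) ≡ 3 * suc i + 1 + 1
      lemma = solve-∀

    size-bound : length U + 2 ≤ r * (4 * t * t + 2 * t)
    size-bound = begin
      length U + 2  ≤⟨ +-monoˡ-≤ 2 (union-size W) ⟩
      2 * t + suc (length νs) * (ℓ * (4 * t)) + 2  ≡⟨ cong (λ l → 2 * t + suc l * (ℓ * (4 * t)) + 2) len ⟩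
      2 * t + suc (2 * t + 1) * (ℓ * (4 * t)) + 2  ≤⟨ polynomial 1≤t ⟩
      (3 * ℓ + 1) * (4 * t * t + 2 * t)  ≤⟨ *-monoˡ-≤ _ 3ℓ+1≤r ⟩
      r * (4 * t * t + 2 * t)  ∎
      where
      lemma : ∀ s ℓ → 2 * suc s + suc (2 * suc s + 1) * (ℓ * (4 * suc s)) + 2 +
        (2 * ℓ + 6 * ℓ * s + 4 * ℓ * s * s + 2 + 8 * s + 4 * s * s) ≡ (3 * ℓ + 1) * (4 * suc s * suc s + 2 * suc s)
      lemma = solve-∀
      polynomial : ∀ {t} → 1 ≤ t → 2 * t + suc (2 * t + 1) * (ℓ * (4 * t)) + 2 ≤ (3 * ℓ + 1) * (4 * t * t + 2 * t)
      polynomial {suc s} _ = ≤-trans (m≤m+n _ _) (≤-reflexive (lemma s ℓ))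

    reach-U : ∀ {u} → u ∈ U → Reach U (ℓ + 2) x₀ u
    reach-U u∈ with in-union W u∈
    ... | inj₁ v∈ = reach-mono id (m≤n+m 2 ℓ) (reach₀ v∈)
    ... | inj₂ a = along (paths⊆union W) a
      where
      along : ∀ {u μs} → (∀ {μ} → μ ∈ μs → set μ ⊆ U) → Any (λ μ → u ∈ set μ) μs → Reach U (ℓ + 2) x₀ u
      along {μs = μ ∷ _} sub (here u∈) = path-reach 1≤t (path μ) (sub (here refl)) reach₀ u∈
      along sub (there a) = along (sub ∘ there) a

    reach-new : ∀ {V v L} → U ⊆ V → v ∈ V → length L ≡ t → L ⊆ U → All (v ~_) L → Reach V (r + 1) x₀ v
    reach-new sub v∈ len L⊆U e with ∃-∈ 1≤t len
    ... | a , a∈ = reach-mono id ℓ+3≤r+1 (move (reach-mono sub ≤-refl (reach-U (L⊆U a∈))) (~-sym (All.lookup e a∈)) v∈)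

    reach-old : ∀ {V u} → U ⊆ V → u ∈ U → Reach V (r + 1) x₀ u
    reach-old sub u∈ = reach-mono sub (≤-trans (n≤1+n _) ℓ+3≤r+1) (reach-U u∈)

    side⊆U : side c ⊆ U
    side⊆U v∈ = paths⊆union W (here refl) (end⊆path (path ν) (side⊆ c v∈))

    finish : Dec (y ∈ U) → Target G r t
    -- `z` has t(2t+2) neighbours in the sides and one more in `y`, which adds 4t²+4t+2 to the
    -- degree sum. The new vertex and the deficit require (2t+1)(1+2t) = 4t²+4t+1.
    finish (yes y∈U) = dense⇒target {r = r} {t = t} {U = z ∷ U} (∉⇒≢ z∉U ∷ union-unique W) (there x₀∈U)
      (λ { (here refl) → reach-new there (here refl) (side-length c) side⊆U (z~side c)
         ; (there u∈) → reach-old there u∈ })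
      (begin
        (2 * t + 1) * suc (length U)  ≡⟨ *-suc (2 * t + 1) (length U) ⟩
        2 * t + 1 + (2 * t + 1) * length U  ≤⟨ +-monoʳ-≤ (2 * t + 1) (union-dense W) ⟩
        2 * t + 1 + (degreeSum U + X)  ≤⟨ n≤1+n _ ⟩
        1 + (2 * t + 1 + (degreeSum U + X))  ≡⟨ lemma t (degreeSum U) ⟩
        degreeSum U + 2 * suc ((2 * t + 2) * t)  ≡⟨ cong (λ l → degreeSum U + 2 * suc l) nbrs-count ⟨
        degreeSum U + 2 * suc (length (nbrs S))  ≤⟨ degreeSum-gain {L = y ∷ nbrs S} (∉⇒≢ y∉nbrs ∷ nbrs-unique S)
                                                       (λ { (here refl) → y∈U ; (there v∈) → nbrs⊆U v∈ })
                                                       (z~mate c ∷ z~nbrs S) ⟩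
        degreeSum (z ∷ U)  ∎)
      (≤-trans (≤-trans (n≤1+n _) (≤-reflexive (+-comm 2 (length U)))) size-bound)
      where
      lemma : ∀ t d → 1 + (2 * t + 1 + (d + (2 * t + 1) * (2 * t))) ≡ d + 2 * suc ((2 * t + 2) * t)
      lemma = solve-∀
    -- Here the balance is exact: `z` contributes 2t(2t+2) and then `y` contributes 2(t+1), together
    -- (2t+1)(2t+2), which is the requirement for two vertices and the deficit 2t.
    finish (no y∉U) = dense⇒target {r = r} {t = t} {U = y ∷ z ∷ U}
      ((~⇒≢ (~-sym (z~mate c)) ∷ ∉⇒≢ y∉U) ∷ (∉⇒≢ z∉U ∷ union-unique W)) (there (there x₀∈U))
      (λ { (here refl) → reach-new (there ∘ there) (here refl) (other-length c) other⊆U (mate~other c)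
         ; (there (here refl)) → reach-new (there ∘ there) (there (here refl)) (side-length c) side⊆U (z~side c)
         ; (there (there u∈)) → reach-old (there ∘ there) u∈ })
      (begin
        (2 * t + 1) * (2 + length U)  ≡⟨ lemma₁ t (length U) ⟩
        2 * (2 * t + 1) + (2 * t + 1) * length U  ≤⟨ +-monoʳ-≤ (2 * (2 * t + 1)) (union-dense W) ⟩
        2 * (2 * t + 1) + (degreeSum U + X)  ≡⟨ lemma₂ t (degreeSum U) ⟩
        degreeSum U + 2 * ((2 * t + 2) * t) + 2 * suc t  ≡⟨ cong₂ (λ l l′ → degreeSum U + 2 * l + 2 * suc l′) nbrs-count (other-length c) ⟨
        degreeSum U + 2 * length (nbrs S) + 2 * suc (length (other c)) ≤⟨ +-monoˡ-≤ _ (degreeSum-gain (nbrs-unique S) nbrs⊆U (z~nbrs S)) ⟩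
        degreeSum (z ∷ U) + 2 * suc (length (other c))  ≤⟨ degreeSum-gain {L = z ∷ other c} (∉⇒≢ (z∉U ∘ other⊆U) ∷ other-unique c)
                                                                            (λ { (here refl) → here refl ; (there v∈) → there (other⊆U v∈) })
                                                                            (~-sym (z~mate c) ∷ mate~other c) ⟩
        degreeSum (y ∷ z ∷ U)  ∎)
      (≤-trans (≤-reflexive (+-comm 2 (length U))) size-bound)
      where
      lemma₁ : ∀ t l → (2 * t + 1) * (2 + l) ≡ 2 * (2 * t + 1) + (2 * t + 1) * l
      lemma₁ = solve-∀
      lemma₂ : ∀ t d → 2 * (2 * t + 1) + (d + (2 * t + 1) * (2 * t)) ≡ d + 2 * ((2 * t + 2) * t) + 2 * suc t
      lemma₂ = solve-∀

  -- One more node than the 2t+2 that are united: the mate of `z` over the first node may lie in the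
  -- state of one other node, and that node is dropped so that the mate is not among the neighbours
  -- counted for `z`.
  collide-hits : ∀ {i} z (νs : List (Node (suc i))) → All (Hits z) νs → AllPairs Apart νs → 2 * t + 3 ≤ length νs →
    suc i < k → Target G r t
  collide-hits z [] [] [] long i<k = contradiction (≤-trans (m≤n+m 3 (2 * t)) long) (λ ())
  collide-hits {i} z (ν ∷ νs) (h ∷ hs) (ap ∷ aps) long i<k =
    collide z ν os h (All.take⁺ (2 * t + 1) (All.filter⁺ misses? hs))
      (All.take⁺ (2 * t + 1) (All.filter⁺ misses? ap) ∷ AllPairs.take⁺ (2 * t + 1) (AllPairs.filter⁺ misses? aps))
      (All.take⁺ (2 * t + 1) (All.all-filter misses? νs))
      (trans (List.length-take (2 * t + 1) (filter misses? νs)) (m≤n⇒m⊓n≡m enough)) i<k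
    where
    misses? : ∀ (μ : Node (suc i)) → Dec (mate (contact ν h) ∉ vertices (end μ))
    misses? μ = ¬? (mate (contact ν h) ∈? vertices (end μ))
    os = take (2 * t + 1) (filter misses? νs)
    lemma : ∀ t → 2 * t + 3 ≡ suc (suc (2 * t + 1))
    lemma = solve-∀
    enough : 2 * t + 1 ≤ length (filter misses? νs)
    enough = ≤-pred (≤-trans (≤-pred (≤-trans (≤-reflexive (sym (lemma t))) long)) (apart-filter _ νs aps))

  length-concatMap : ∀ {i} (νs : List (Node i)) → length (concatMap (λ ν → vertices (end ν)) νs) ≡ length νs * (2 * t)
  length-concatMap [] = refl
  length-concatMap (ν ∷ νs) = trans (List.length-++ (vertices (end ν)))
    (cong₂ _+_ (length-vertices (end ν)) (length-concatMap νs))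

  ∈-concatMap : ∀ {i v} {μ : Node i} {μs} → μ ∈ μs → v ∈ vertices (end μ) → v ∈ concatMap (λ ν → vertices (end ν)) μs
  ∈-concatMap (here refl) v∈ = ∈-++⁺ˡ v∈
  ∈-concatMap {μs = ν ∷ _} (there μ∈) v∈ = ∈-++⁺ʳ (vertices (end ν)) (∈-concatMap μ∈ v∈)

  -- If every node of the level were blocked by many vertices of the new level, some vertex would hit 2t + 3 nodes.
  addNode : ∀ {i} (νs : List (Node i)) → AllPairs Apart νs → length νs ≡ γ ^ i → i < k →
    (μs : List (Node (suc i))) → length μs < length νs * γ →
    Target G r t ⊎ Σ (Node (suc i)) λ μ → All (Apart μ) μs
  addNode {i} νs apart len i<k μs room with ∃⊎∀ free? νs
    where
    Z = concatMap (λ μ → vertices (end μ)) μs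
    free? : ∀ ν → Dec (length (filter (λ z → hits? z ν) Z) + length (set ν) ≤ m₀)
    free? ν = length (filter (λ z → hits? z ν) Z) + length (set ν) ≤? m₀
  ... | inj₁ (ν , _ , free) = inj₂ (new , All.tabulate fresh)
    where
    Z = concatMap (λ μ → vertices (end μ)) μs
    blocked = filter (λ z → hits? z ν) Z
    B = expand (end ν) (good ν) (set ν ++ blocked)
      (≤-trans (≤-reflexive (trans (List.length-++ (set ν)) (+-comm (length (set ν)) _))) free)
    open Block B using (cells; next; small; nonempty; extend; avoid; inside) renaming (good to good′)
    new : Node (suc i)
    new = node (grow (path ν) cells small nonempty extend (All.map (λ v∉ v∈ → v∉ (∈-++⁺ˡ v∈)) avoid) inside) good′
    cell-extends : ∀ {v q} → (v , q) ∈ cells ⊎ (q , v) ∈ cells → Extends (end ν) (v , q) ⊎ Extends (end ν) (q , v)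
    cell-extends (inj₁ c∈) = inj₁ (All.lookup extend c∈)
    cell-extends (inj₂ c∈) = inj₂ (All.lookup extend c∈)
    fresh : ∀ {μ} → μ ∈ μs → Apart new μ
    fresh μ∈ {v} (v∈ , v∈μ) with ∈-cellVertices⁻ cells (inside v∈)
    ... | q , c∈ , q∈ = All.lookup avoid (inside v∈) (∈-++⁺ʳ (set ν) (∈-filter⁺ (λ z → hits? z ν) (∈-concatMap μ∈ v∈μ)
      ( (λ v∈ν → All.lookup avoid (inside v∈) (∈-++⁺ˡ v∈ν)) , q
      , (λ q∈ν → All.lookup avoid q∈ (∈-++⁺ˡ q∈ν)) , cell-extends c∈)))
  ... | inj₂ crowded with ∃⊎∀ (λ z → 2 * t + 3 ≤? length (filter (hits? z) νs)) (concatMap (λ μ → vertices (end μ)) μs)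
  ...   | inj₁ (z , _ , many) = inj₁ (decide νs apart len i<k many)
    where
    decide : ∀ {i} (νs : List (Node i)) → AllPairs Apart νs → length νs ≡ γ ^ i → i < k →
      2 * t + 3 ≤ length (filter (hits? z) νs) → Target G r t
    -- Level zero has a single node, so a collision occurs only at a level where the histories
    -- contain a first cell, from which the centre is taken.
    decide {zero} νs apart len i<k many = contradiction
      (≤-trans (≤-trans (m≤n+m 3 (2 * t)) many) (≤-trans (List.length-filter (hits? z) νs) (≤-reflexive len))) (λ { (s≤s ()) })
    decide {suc i} νs apart len i<k many =
      collide-hits z (filter (hits? z) νs) (All.all-filter (hits? z) νs) (AllPairs.filter⁺ (hits? z) apart) many i<k
  -- Double counting of pairs of a node and a vertex hitting it: each node is hit at least `w`
  -- times, each vertex hits at most 2t+2 nodes, and fewer than γ new states per node supply 2t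
  -- vertices each.
  ...   | inj₂ few = contradiction refl (<⇒≢ (begin-strict
    length νs * w  ≤⟨ length*≤∑ νs blocked ⟩
    ∑ νs (λ ν → # (λ z → hits? z ν) Z)  ≡⟨ ∑-swap νs Z _ ⟩
    ∑ Z (λ z → # (hits? z) νs)  ≤⟨ ∑≤length* Z few′ ⟩
    length Z * (2 * t + 2)  ≡⟨ cong (_* (2 * t + 2)) (length-concatMap μs) ⟩
    length μs * (2 * t) * (2 * t + 2)  ≡⟨ *-assoc (length μs) (2 * t) _ ⟩
    length μs * (2 * t * (2 * t + 2))  <⟨ *-monoˡ-< _ {{>-nonZero positive}} room ⟩
    length νs * γ * (2 * t * (2 * t + 2))  ≡⟨ lemma (length νs) γ (2 * t * (2 * t + 2)) ⟩
    length νs * w  ∎))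
    where
    Z = concatMap (λ μ → vertices (end μ)) μs
    w = 2 * t * (2 * t + 2) * γ
    lemma : ∀ a b c → a * b * c ≡ a * (c * b)
    lemma = solve-∀
    positive : 1 ≤ 2 * t * (2 * t + 2)
    positive = *-mono-≤ (*-mono-≤ {1} {2} (s≤s z≤n) 1≤t) (≤-trans (s≤s z≤n) (m≤n+m 2 (2 * t)))
    few′ : ∀ z → z ∈ Z → # (hits? z) νs ≤ 2 * t + 2
    few′ z z∈ = ≤-trans (≤-reflexive (sym (length-filter≡# (hits? z) νs)))
      (≤-pred (≤-trans (≰⇒> (few z z∈)) (≤-reflexive (+-suc (2 * t) 2))))
    -- A history occupies at most 2t + 4tk of the capacity `m₀`; a crowded node must fill the
    -- remaining `w` places with hitting vertices.
    blocked : ∀ ν → ν ∈ νs → w ≤ # (λ z → hits? z ν) Z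
    blocked ν ν∈ = ≤-trans (+-cancelʳ-≤ (2 * t + k * (4 * t)) w _ (begin
      w + (2 * t + k * (4 * t))  ≤⟨ m₀-large ⟩
      m₀  ≤⟨ <⇒≤ (≰⇒> (crowded ν ν∈)) ⟩
      length (filter (λ z → hits? z ν) Z) + length (set ν)
        ≤⟨ +-monoʳ-≤ _ (≤-trans (length-path (path ν)) (+-monoʳ-≤ (2 * t) (*-monoˡ-≤ (4 * t) (<⇒≤ i<k)))) ⟩
      length (filter (λ z → hits? z ν) Z) + (2 * t + k * (4 * t))  ∎))
      (≤-reflexive (length-filter≡# (λ z → hits? z ν) Z))

  fillLevel : ∀ {i} (νs : List (Node i)) → AllPairs Apart νs → length νs ≡ γ ^ i → i < k → ∀ j → j ≤ length νs * γ →
    Target G r t ⊎ Σ (List (Node (suc i))) λ μs → AllPairs Apart μs × length μs ≡ j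
  fillLevel νs apart len i<k zero _ = inj₂ ([] , [] , refl)
  fillLevel νs apart len i<k (suc j) j≤ with fillLevel νs apart len i<k j (<⇒≤ j≤)
  ... | inj₁ found = inj₁ found
  ... | inj₂ (μs , apart′ , refl) with addNode νs apart len i<k μs j≤
  ...   | inj₁ found = inj₁ found
  ...   | inj₂ (μ , ap) = inj₂ (μ ∷ μs , ap ∷ apart′ , refl)

  levels : ∀ i → i ≤ k → Target G r t ⊎ Σ (List (Node i)) λ νs → AllPairs Apart νs × length νs ≡ γ ^ i
  levels zero _ = inj₂ (node root good₀ ∷ [] , [] ∷ [] , refl)
  levels (suc i) i<k with levels i (<⇒≤ i<k)
  ... | inj₁ found = inj₁ found
  ... | inj₂ (νs , apart , len) with fillLevel νs apart len i<k (length νs * γ) ≤-refl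
  ...   | inj₁ found = inj₁ found
  ...   | inj₂ (μs , apart′ , len′) = inj₂ (μs , apart′ , trans len′ (trans (cong (_* γ) len) (*-comm (γ ^ i) γ)))

  target : n < γ ^ k → Target G r t
  target n<γᵏ with levels k ≤-refl
  ... | inj₁ found = found
  ... | inj₂ (νs , apart , len) = contradiction n<γᵏ (≤⇒≯ (begin
    γ ^ k  ≡⟨ len ⟨
    length νs  ≤⟨ m≤m*n (length νs) (2 * t) {{>-nonZero (≤-trans 1≤t (m≤n*m t 2))}} ⟩
    length νs * (2 * t)  ≡⟨ length-concatMap νs ⟨
    length (concatMap (λ ν → vertices (end ν)) νs)
      ≤⟨ unique-⊆⇒length≤ (Unique.concat⁺ (All.map⁺ (All.universal (λ ν → unique (end ν)) νs)) (AllPairs.map⁺ apart)) (λ _ → ∈-allFin _) ⟩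
    length (allFin n)  ≡⟨ List.length-tabulate id ⟩
    n  ∎))

-- Complete bipartite subgraphs and bounded codegrees.

tuples : {A : Set} → List A → ∀ k → List (Vec A k)
tuples xs zero = [] ∷ []
tuples xs (suc k) = cartesianProductWith _∷_ xs (tuples xs k)

∈-tuples : {A : Set} {xs : List A} {k : ℕ} (v : Vec A k) → (∀ i → lookup v i ∈ xs) → v ∈ tuples xs k
∈-tuples [] h = here refl
∈-tuples (x ∷ v) h = ∈-cartesianProductWith⁺ _∷_ (h Fin.zero) (∈-tuples v (h ∘ Fin.suc))

unique-tuples : {A : Set} {xs : List A} → Unique xs → ∀ k → Unique (tuples xs k)
unique-tuples u zero = [] ∷ []
unique-tuples u (suc k) = Unique.cartesianProductWith⁺ _∷_ (λ { refl → refl , refl }) u (unique-tuples u k)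

-- The solution M of 2M(t+1) = (2t+1)(M+t+1).
bound : ℕ → ℕ
bound t = (2 * t + 1) * (t + 1)

BoundedCodegree : {n : ℕ} → Graph n → ℕ → Set
BoundedCodegree {n} G t = ∀ (S ys : List (Fin n)) → Unique S → length S ≡ suc t → Unique ys →
  All (λ y → All (y ~_) S) ys → length ys < bound t
  where open Density G

module _ {n : ℕ} (G : Graph n) (t r : ℕ) where

  open Density G

  degreeSum-join : ∀ S ys → Unique S → All (λ y → All (y ~_) S) ys →
    length ys * (2 * length S) ≤ degreeSum (ys ++ S)
  degreeSum-join S [] uS [] = z≤n
  degreeSum-join S (y ∷ ys) uS (e ∷ es) = begin
    2 * length S + length ys * (2 * length S)  ≤⟨ +-monoʳ-≤ (2 * length S) (degreeSum-join S ys uS es) ⟩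
    2 * length S + degreeSum (ys ++ S)  ≡⟨ +-comm (2 * length S) _ ⟩
    degreeSum (ys ++ S) + 2 * length S  ≤⟨ degreeSum-gain uS (∈-++⁺ʳ ys) e ⟩
    degreeSum (y ∷ ys ++ S)  ∎

  -- The total size 2(t+1)² fits into r(4t²+2t) because r ≥ 2; for r = t = 1 it would be 8 against
  -- 6.
  complete-bipartite : 1 ≤ t → 2 ≤ r → ∀ S ys → Unique S → length S ≡ suc t → Unique ys → length ys ≡ bound t →
    All (λ y → All (y ~_) S) ys → Target G r t
  complete-bipartite 1≤t 2≤r S@(s ∷ _) [] uS lenS uys leny es =
    contradiction leny (<⇒≢ (*-mono-≤ (m≤n+m 1 (2 * t)) (m≤n+m 1 t)))
  complete-bipartite 1≤t 2≤r S@(s ∷ _) ys@(y₀ ∷ _) uS lenS uys leny es =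
    dense⇒target {r = r} {t = t} {U = ys ++ S}
      (Unique.++⁺ uys uS (λ (v∈ys , v∈S) → ~⇒≢ (All.lookup (All.lookup es v∈ys) v∈S) refl))
      (∈-++⁺ʳ ys (here refl)) (λ u∈ → reach u∈ (∈-++⁻ ys u∈))
      (begin
        (2 * t + 1) * length (ys ++ S)  ≡⟨ cong ((2 * t + 1) *_) total ⟩
        (2 * t + 1) * (bound t + suc t)  ≡⟨ lemma₁ t ⟩
        bound t * (2 * suc t)  ≡⟨ cong₂ (λ a b → a * (2 * b)) leny lenS ⟨
        length ys * (2 * length S)  ≤⟨ degreeSum-join S ys uS es ⟩
        degreeSum (ys ++ S)  ∎)
      (begin
        length (ys ++ S)  ≡⟨ total ⟩
        bound t + suc t  ≤⟨ polynomial 1≤t ⟩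
        2 * (4 * t * t + 2 * t)  ≤⟨ *-monoˡ-≤ _ 2≤r ⟩
        r * (4 * t * t + 2 * t)  ∎)
    where
    total : length (ys ++ S) ≡ bound t + suc t
    total = trans (List.length-++ ys) (cong₂ _+_ leny lenS)
    lemma₁ : ∀ t → (2 * t + 1) * ((2 * t + 1) * (t + 1) + suc t) ≡ (2 * t + 1) * (t + 1) * (2 * suc t)
    lemma₁ = solve-∀
    lemma₂ : ∀ s → (2 * suc s + 1) * (suc s + 1) + suc (suc s) + (4 + 12 * s + 6 * s * s) ≡ 2 * (4 * suc s * suc s + 2 * suc s)
    lemma₂ = solve-∀
    polynomial : ∀ {t} → 1 ≤ t → bound t + suc t ≤ 2 * (4 * t * t + 2 * t)
    polynomial {suc s} _ = ≤-trans (m≤m+n _ _) (≤-reflexive (lemma₂ s))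
    edge : ∀ {y v} → y ∈ ys → v ∈ S → y ~ v
    edge y∈ v∈ = All.lookup (All.lookup es y∈) v∈
    reach : ∀ {u} → u ∈ ys ++ S → u ∈ ys ⊎ u ∈ S → Reach (ys ++ S) (r + 1) s u
    reach u∈ (inj₁ u∈ys) = reach-mono id (≤-trans (≤-trans (s≤s z≤n) 2≤r) (m≤m+n r 1))
      (move {k = 0} (stay (∈-++⁺ʳ ys (here refl))) (~-sym (edge u∈ys (here refl))) u∈)
    reach u∈ (inj₂ u∈S) = reach-mono id (≤-trans 2≤r (m≤m+n r 1))
      (move (move {k = 0} (stay (∈-++⁺ʳ ys (here refl))) (~-sym (edge (here refl) (here refl))) (here refl)) (edge (here refl) u∈S) u∈)

  boundedCodegree : 1 ≤ t → 2 ≤ r → Target G r t ⊎ BoundedCodegree G t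
  boundedCodegree 1≤t 2≤r with ∃⊎∀ rich? (tuples (allFin n) (suc t))
    where
    rich? : ∀ (v : Vec (Fin n) (suc t)) → Dec (Unique (toList v) × bound t ≤ length (filter (λ y → All.all? (y ~?_) (toList v)) (allFin n)))
    rich? v = AllPairs.allPairs? (λ x y → ¬? (x Fin.≟ y)) (toList v) ×-dec (bound t ≤? _)
  ... | inj₁ (v , _ , u , rich) = inj₁ (complete-bipartite 1≤t 2≤r (toList v) (take (bound t) common) u
          (Vec.length-toList v) (Unique.take⁺ (bound t) (Unique.filter⁺ adjacent? (Unique.allFin⁺ n)))
          (trans (List.length-take (bound t) common) (m≤n⇒m⊓n≡m rich))
          (All.take⁺ (bound t) (All.all-filter adjacent? (allFin n))))
    where
    adjacent? = λ y → All.all? (y ~?_) (toList v)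
    common = filter adjacent? (allFin n)
  ... | inj₂ none = inj₂ free
    where
    vector : ∀ (S : List (Fin n)) {k} → length S ≡ k → Σ (Vec (Fin n) k) λ v → toList v ≡ S
    vector S refl = Data.Vec.fromList S , Vec.toList∘fromList S
    free : BoundedCodegree G t
    free S ys uS lenS uys es with vector S lenS
    ... | v , refl = ≰⇒> (λ big → none v (∈-tuples v (λ _ → ∈-allFin _)) (uS , ≤-trans big
      (unique-⊆⇒length≤ uys (λ y∈ → ∈-filter⁺ (λ y → All.all? (y ~?_) (toList v)) (∈-allFin _) (All.lookup es y∈)))))

-- Robust subfamilies.

module Cleaning {T I Y : Set} (_≟_ : ∀ (y z : Y) → Dec (y ≡ z)) (_≟ᴵ_ : ∀ (i j : I) → Dec (i ≡ j))
  (π : I → T → Y) (is : List I) (κ : ℕ) where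

  fibre? : ∀ i ω ω′ → Dec (π i ω′ ≡ π i ω)
  fibre? i ω ω′ = π i ω′ ≟ π i ω

  fibre : I → T → List T → List T
  fibre i ω Ω = filter (fibre? i ω) Ω

  -- In the applications a projection `π i` forgets one cell, so a large fibre means that this cell
  -- can be replaced in κ ways by another one without leaving the core.
  record Robust (Ω : List T) : Set where
    field
      core     : List T
      ⊆Ω       : core ⊆ Ω
      uniq     : Unique core
      member   : T
      member∈  : member ∈ core
      rich     : ∀ {i ω} → i ∈ is → ω ∈ core → κ ≤ length (fibre i ω core)

  -- Each deletion of a small fibre loses at most κ tuples and one of the available values of the projections.
  clean : (Ω : List T) (values : List (I × Y)) → Unique Ω → (∀ {i ω} → i ∈ is → ω ∈ Ω → (i , π i ω) ∈ values) →
    κ * length values < length Ω → Robust Ω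
  clean Ω = go (length Ω) Ω ≤-refl
    where
    go : ∀ fuel Ω → length Ω ≤ fuel → (values : List (I × Y)) → Unique Ω →
      (∀ {i ω} → i ∈ is → ω ∈ Ω → (i , π i ω) ∈ values) → κ * length values < length Ω → Robust Ω
    go fuel Ω _ values u vals lt with ∃⊎∀ (λ (i , ω) → length (fibre i ω Ω) <? κ) (cartesianProduct is Ω)
    go fuel [] _ values u vals () | inj₂ _
    go fuel Ω@(ω₀ ∷ _) _ values u vals lt | inj₂ none = record
      { core = Ω ; ⊆Ω = id ; uniq = u ; member = ω₀ ; member∈ = here refl
      ; rich = λ i∈ ω∈ → ≮⇒≥ (none _ (∈-cartesianProduct⁺ i∈ ω∈)) }
    go zero [] _ values u vals () | inj₁ _
    go (suc fuel) Ω bound values u vals lt | inj₁ ((i , ω) , iω∈ , small) = record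
      { core = core ; ⊆Ω = λ ω∈ → proj₁ (∈-filter⁻ keep? (⊆Ω ω∈)) ; uniq = uniq
      ; member = member ; member∈ = member∈ ; rich = rich }
      where
      i∈ : i ∈ is
      i∈ = proj₁ (∈-cartesianProduct⁻ is Ω iω∈)
      ω∈ : ω ∈ Ω
      ω∈ = proj₂ (∈-cartesianProduct⁻ is Ω iω∈)
      keep? : ∀ ω′ → Dec (¬ π i ω′ ≡ π i ω)
      keep? ω′ = ¬? (fibre? i ω ω′)
      _≟′_ : ∀ (p q : I × Y) → Dec (p ≡ q)
      _≟′_ = Product.≡-dec _≟ᴵ_ _≟_
      other? : ∀ (p : I × Y) → Dec (¬ p ≡ (i , π i ω))
      other? p = ¬? (p ≟′ (i , π i ω))
      Ω₁ = filter keep? Ω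
      values₁ = filter other? values
      shorter : length Ω₁ < length Ω
      shorter = List.filter-notAll keep? Ω (Any.map (λ { refl ¬e → ¬e refl }) ω∈)
      fewer : length values₁ < length values
      fewer = List.filter-notAll other? values (Any.map (λ { refl ¬e → ¬e refl }) (vals i∈ ω∈))
      inequality : κ * length values₁ < length Ω₁
      inequality = +-cancelˡ-< κ _ _ (begin-strict
        κ + κ * length values₁  ≡⟨ *-suc κ (length values₁) ⟨
        κ * suc (length values₁)  ≤⟨ *-monoʳ-≤ κ fewer ⟩
        κ * length values  <⟨ lt ⟩
        length Ω  ≡⟨ #-complement (fibre? i ω) Ω ⟨
        # (fibre? i ω) Ω + # keep? Ω  ≡⟨ cong₂ _+_ (length-filter≡# (fibre? i ω) Ω) (length-filter≡# keep? Ω) ⟨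
        length (fibre i ω Ω) + length Ω₁  ≤⟨ +-monoˡ-≤ _ (<⇒≤ small) ⟩
        κ + length Ω₁  ∎)
      vals₁ : ∀ {j ω′} → j ∈ is → ω′ ∈ Ω₁ → (j , π j ω′) ∈ values₁
      vals₁ j∈ ω′∈ with ∈-filter⁻ keep? ω′∈
      ... | ω′∈Ω , kept = ∈-filter⁺ other? (vals j∈ ω′∈Ω) (λ e → kept (same (cong proj₁ e) (cong proj₂ e)))
        where
        same : ∀ {j ω′} → j ≡ i → π j ω′ ≡ π i ω → π i ω′ ≡ π i ω
        same refl e = e
      open Robust (go fuel Ω₁ (≤-pred (≤-trans shorter bound)) values₁ (Unique.filter⁺ keep? u) vals₁ inequality)

-- Cells over a state that avoid prescribed vertices.

_≟ᶜ_ : {n : ℕ} (c d : Fin n × Fin n) → Dec (c ≡ d)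
_≟ᶜ_ = Product.≡-dec Fin._≟_ Fin._≟_

pairs : ∀ n → List (Fin n × Fin n)
pairs n = cartesianProduct (allFin n) (allFin n)

unique-pairs : ∀ n → Unique (pairs n)
unique-pairs n = Unique.cartesianProduct⁺ (Unique.allFin⁺ n) (Unique.allFin⁺ n)

∈-pairs : ∀ {n} (c : Fin n × Fin n) → c ∈ pairs n
∈-pairs (x , y) = ∈-cartesianProduct⁺ (∈-allFin x) (∈-allFin y)

length-pairs : ∀ n → length (pairs n) ≡ n * n
length-pairs n = trans (length-product _,_ (allFin n) (allFin n)) (cong₂ _*_ (length-allFin n) (length-allFin n))

∑-pairs : ∀ n (f : Fin n × Fin n → ℕ) → ∑ (pairs n) f ≡ ∑ (allFin n) (λ x → ∑ (allFin n) (λ y → f (x , y)))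
∑-pairs n f = ∑-product _,_ (allFin n) (allFin n) f

Touches : {n : ℕ} → Fin n × Fin n → Fin n → Set
Touches c z = z ≡ proj₁ c ⊎ z ≡ proj₂ c

touches? : {n : ℕ} (c : Fin n × Fin n) (z : Fin n) → Dec (Touches c z)
touches? c z = (z Fin.≟ proj₁ c) ⊎-dec (z Fin.≟ proj₂ c)

unique-cofibre : {n : ℕ} {z : Fin n} (f g : Fin n × Fin n → Fin n) → (∀ {c d} → f c ≡ f d → g c ≡ g d → c ≡ d) →
  ∀ {cs} → Unique cs → All (λ c → z ≡ f c) cs → Unique (map g cs)
unique-cofibre f g inj [] [] = []
unique-cofibre f g inj (c∉ ∷ u) (e ∷ es) =
  All.map⁺ (All.zipWith (λ (c≢d , e′) ge → c≢d (inj (trans (sym e) e′) ge)) (c∉ , es)) ∷ unique-cofibre f g inj u es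

module Crowding {n : ℕ} (G : Graph n) (t : ℕ) (bounded : BoundedCodegree G t) where

  open Density G
  open Growth G t

  Fresh : State → Cell → Set
  Fresh s c = Extends s c × proj₁ c ∉ vertices s × proj₂ c ∉ vertices s

  -- If `z` is the first vertex of several cells, their second vertices are common neighbours of `z`
  -- and the right side of the state; symmetrically for second vertices. Freshness puts `z` off the
  -- state, so these are t+1 distinct vertices and the codegree bound applies.
  length-touching : ∀ s z cs → Unique cs → All (Fresh s) cs → All (λ c → Touches c z) cs → length cs ≤ 2 * bound t
  length-touching s z cs u fresh touching = begin
    length cs  ≡⟨ #-complement first? cs ⟨
    # first? cs + # second? cs  ≡⟨ cong₂ _+_ (length-filter≡# first? cs) (length-filter≡# second? cs) ⟨
    length cs₁ + length cs₂  ≤⟨ +-mono-≤ firsts seconds ⟩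
    bound t + bound t  ≡⟨ cong (bound t +_) (+-identityʳ _) ⟨
    2 * bound t  ∎
    where
    first? : ∀ (c : Cell) → Dec (z ≡ proj₁ c)
    first? c = z Fin.≟ proj₁ c
    second? : ∀ (c : Cell) → Dec (¬ z ≡ proj₁ c)
    second? c = ¬? (first? c)
    cs₁ = filter first? cs
    cs₂ = filter second? cs
    firsts : length cs₁ ≤ bound t
    firsts with cs₁ in eq
    ... | [] = z≤n
    ... | ds@(d ∷ _) = <⇒≤ (≤-trans (s≤s (≤-reflexive (sym (List.length-map proj₂ ds))))
        (bounded (z ∷ right s) (map proj₂ ds) (∉⇒≢ z∉ ∷ unique-right s) (cong suc (length-right s))
          (unique-cofibre proj₁ proj₂ (cong₂ _,_) (subst Unique eq (Unique.filter⁺ first? u)) hits)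
          (All.map⁺ (All.zipWith (λ { (((x~y , _ , y~B) , _) , refl) → ~-sym x~y ∷ y~B }) (fresh′ , hits)))))
      where
      hits : All (λ c → z ≡ proj₁ c) ds
      hits = subst (All _) eq (All.all-filter first? cs)
      fresh′ : All (Fresh s) ds
      fresh′ = subst (All _) eq (All.filter⁺ first? fresh)
      z∉ : z ∉ right s
      z∉ z∈ = proj₁ (proj₂ (All.head fresh′)) (subst (_∈ _) (All.head hits) (∈-++⁺ʳ (left s) z∈))
    seconds : length cs₂ ≤ bound t
    seconds with cs₂ in eq
    ... | [] = z≤n
    ... | ds@(d ∷ _) = <⇒≤ (≤-trans (s≤s (≤-reflexive (sym (List.length-map proj₁ ds))))
        (bounded (z ∷ left s) (map proj₁ ds) (∉⇒≢ z∉ ∷ unique-left s) (cong suc (length-left s))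
          (unique-cofibre proj₂ proj₁ (λ p q → cong₂ _,_ q p) (subst Unique eq (Unique.filter⁺ second? u)) hits)
          (All.map⁺ (All.zipWith (λ { (((x~y , x~A , _) , _) , refl) → x~y ∷ x~A }) (fresh′ , hits)))))
      where
      hits : All (λ c → z ≡ proj₂ c) ds
      hits = subst (All _) eq (All.zipWith (λ { (inj₁ e , ¬e) → contradiction e ¬e ; (inj₂ e , _) → e })
        (All.filter⁺ second? touching , All.all-filter second? cs))
      fresh′ : All (Fresh s) ds
      fresh′ = subst (All _) eq (All.filter⁺ second? fresh)
      z∉ : z ∉ left s
      z∉ z∈ = proj₂ (proj₂ (All.head fresh′)) (subst (_∈ _) (All.head hits) (∈-++⁺ˡ z∈))

  #-touching : ∀ s z {P : Cell → Set} (P? : ∀ c → Dec (P c)) cs → Unique cs → (∀ c → P c → Fresh s c) →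
    # (λ c → P? c ×-dec touches? c z) cs ≤ 2 * bound t
  #-touching s z P? cs u fresh = ≤-trans (≤-reflexive (sym (length-filter≡# Q? cs)))
    (length-touching s z (filter Q? cs) (Unique.filter⁺ Q? u)
      (All.map (λ (p , _) → fresh _ p) (All.all-filter Q? cs)) (All.map proj₂ (All.all-filter Q? cs)))
    where
    Q? = λ c → P? c ×-dec touches? c z

  pick : ∀ s cs Z → Unique cs → All (Fresh s) cs → length Z * (2 * bound t) < length cs →
    ∃ λ c → c ∈ cs × proj₁ c ∉ Z × proj₂ c ∉ Z
  pick s cs Z u fresh big with ∃-of-# free? cs (+-cancelʳ-< (length Z * (2 * bound t)) 0 _ (≤-trans big (begin
      length cs  ≡⟨ List.filter-all fresh? (All.tabulate id) ▹ length-filter≡# fresh? cs ⟩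
      # fresh? cs  ≤⟨ #-blocked fresh? touches? cs Z (2 * bound t)
                                                         (λ z → #-touching s z fresh? cs u (λ c → All.lookup fresh)) ⟩
      # free? cs + length Z * (2 * bound t)  ∎)))
    where
    fresh? : ∀ c → Dec (c ∈ cs)
    fresh? c = Any.any? (c ≟ᶜ_) cs
    free? : ∀ c → Dec (c ∈ cs × All (λ z → ¬ Touches c z) Z)
    free? c = fresh? c ×-dec All.all? (λ z → ¬? (touches? c z)) Z
    _▹_ : ∀ {xs} {m} → xs ≡ cs → length xs ≡ m → length cs ≡ m
    refl ▹ e = e
  ... | c , c∈ , _ , free = c , c∈ , (λ z∈ → All.lookup free z∈ (inj₁ refl)) , (λ z∈ → All.lookup free z∈ (inj₂ refl))

-- The hexagon template.

module Hexagons {n : ℕ} (G : Graph n) (bounded : BoundedCodegree G 1) where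

  open Density G
  open Growth G 1
  open Crowding G 1 bounded

  Tuple : Set
  Tuple = Cell × Cell × Cell

  -- A path a x y b on four distinct vertices, that is, a cell over the state with sides {a} and
  -- {b}.
  Path3 : Cell → Cell → Set
  Path3 (a , b) (x , y) = a ≢ b × x ~ y × x ~ a × y ~ b × x ≢ b × y ≢ a

  path3? : ∀ ab xy → Dec (Path3 ab xy)
  path3? (a , b) (x , y) = ¬? (a Fin.≟ b) ×-dec (x ~? y) ×-dec (x ~? a) ×-dec (y ~? b) ×-dec ¬? (x Fin.≟ b) ×-dec ¬? (y Fin.≟ a)

  Hexagon : Tuple → Set
  Hexagon (ab , c , c′) = Path3 ab c × Path3 ab c′ × ¬ Touches c′ (proj₁ c) × ¬ Touches c′ (proj₂ c)

  hexagon? : ∀ ω → Dec (Hexagon ω)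
  hexagon? (ab , c , c′) = path3? ab c ×-dec path3? ab c′ ×-dec ¬? (touches? c′ (proj₁ c)) ×-dec ¬? (touches? c′ (proj₂ c))

  -- In the hexagon a x y b y′ x′, half is the rotation by three steps; turn is the reflection taking
  -- the opposite pair (a , b) to the opposite pair (x , y′).
  half : Tuple → Tuple
  half ((a , b) , (x , y) , (x′ , y′)) = (b , a) , (y′ , x′) , (y , x)

  turn : Tuple → Tuple
  turn ((a , b) , (x , y) , (x′ , y′)) = (x , y′) , (a , x′) , (y , b)

  half-hexagon : ∀ {ω} → Hexagon ω → Hexagon (half ω)
  half-hexagon ((a≢b , xy , xa , yb , x≢b , y≢a) , (_ , xy′ , xa′ , yb′ , x≢b′ , y≢a′) , x∉ , y∉) =
    (a≢b ∘ sym , ~-sym xy′ , yb′ , xa′ , y≢a′ , x≢b′) , (a≢b ∘ sym , ~-sym xy , yb , xa , y≢a , x≢b) ,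
    (λ { (inj₁ e) → y∉ (inj₂ (sym e)) ; (inj₂ e) → x∉ (inj₂ (sym e)) }) ,
    (λ { (inj₁ e) → y∉ (inj₁ (sym e)) ; (inj₂ e) → x∉ (inj₁ (sym e)) })

  turn-hexagon : ∀ {ω} → Hexagon ω → Hexagon (turn ω)
  turn-hexagon ((a≢b , xy , xa , yb , x≢b , y≢a) , (_ , xy′ , xa′ , yb′ , x≢b′ , y≢a′) , x∉ , y∉) =
    (x∉ ∘ inj₂ , ~-sym xa′ , ~-sym xa , xy′ , y≢a′ ∘ sym , x∉ ∘ inj₁ ∘ sym) ,
    (x∉ ∘ inj₂ , yb , ~-sym xy , ~-sym yb′ , y∉ ∘ inj₂ , x≢b ∘ sym) ,
    (λ { (inj₁ e) → y≢a (sym e) ; (inj₂ e) → a≢b e }) ,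
    (λ { (inj₁ e) → y∉ (inj₁ (sym e)) ; (inj₂ e) → x≢b′ e })

  -- `half` and `turn` are commuting involutions, so the four maps form a group.
  act : Bool × Bool → Tuple → Tuple
  act (false , false) ω = ω
  act (false , true)  ω = half ω
  act (true  , false) ω = turn ω
  act (true  , true)  ω = turn (half ω)

  act-involutive : ∀ i ω → act i (act i ω) ≡ ω
  act-involutive (false , false) ω = refl
  act-involutive (false , true)  ω = refl
  act-involutive (true  , false) ω = refl
  act-involutive (true  , true)  ω = refl

  act-hexagon : ∀ i {ω} → Hexagon ω → Hexagon (act i ω)
  act-hexagon (false , false) h = h
  act-hexagon (false , true)  h = half-hexagon h
  act-hexagon (true  , false) h = turn-hexagon h
  act-hexagon (true  , true)  h = turn-hexagon (half-hexagon h)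

  symmetries : List (Bool × Bool)
  symmetries = (false , false) ∷ (false , true) ∷ (true , false) ∷ (true , true) ∷ []

  ∈-symmetries : ∀ i → i ∈ symmetries
  ∈-symmetries (false , false) = here refl
  ∈-symmetries (false , true)  = there (here refl)
  ∈-symmetries (true  , false) = there (there (here refl))
  ∈-symmetries (true  , true)  = there (there (there (here refl)))

  -- Over the four symmetries, the erased cell is the middle of each of the two paths joining a to b
  -- and of each of the two joining x to y′.
  forget : Bool × Bool → Tuple → Cell × Cell
  forget i ω with act i ω
  ... | ab , _ , c′ = ab , c′

  pathState : ∀ {a b} → a ≢ b → State
  pathState {a} {b} a≢b = state (a ∷ []) (b ∷ []) refl refl ([] ∷ []) ([] ∷ [])
    (λ { (here refl , here refl) → a≢b refl })

  path3⇒fresh : ∀ {a b c} (a≢b : a ≢ b) → Path3 (a , b) c → Fresh (pathState a≢b) c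
  path3⇒fresh a≢b (_ , xy , xa , yb , x≢b , y≢a) =
    (xy , xa ∷ [] , yb ∷ []) ,
    (λ { (here e) → ~⇒≢ xa e ; (there (here e)) → x≢b e }) ,
    (λ { (here e) → y≢a e ; (there (here e)) → ~⇒≢ yb e })

  module Resampling (κ : ℕ) (Ω : List Tuple) (hexagons : ∀ {ω} → ω ∈ Ω → Hexagon ω)
    (R : Cleaning.Robust (Product.≡-dec _≟ᶜ_ _≟ᶜ_) (Product.≡-dec Bool._≟_ Bool._≟_) forget symmetries κ Ω)
    where

    open Cleaning (Product.≡-dec _≟ᶜ_ _≟ᶜ_) (Product.≡-dec Bool._≟_ Bool._≟_) forget symmetries κ
    open Robust R

    -- The core need not be invariant under the symmetries, but its orbit is. Large fibres pass to
    -- the orbit because each symmetry comes with its own projection.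
    Alive : Tuple → Set
    Alive ω = ∃ λ i → act i ω ∈ core

    alive-hexagon : ∀ {ω} → Alive ω → Hexagon ω
    alive-hexagon {ω} (i , ω∈) = subst Hexagon (act-involutive i ω) (act-hexagon i (hexagons (⊆Ω ω∈)))

    alive-half : ∀ {ω} → Alive ω → Alive (half ω)
    alive-half ((false , false) , ω∈) = (false , true) , ω∈
    alive-half ((false , true)  , ω∈) = (false , false) , ω∈
    alive-half ((true  , false) , ω∈) = (true , true) , ω∈
    alive-half ((true  , true)  , ω∈) = (true , false) , ω∈

    alive-turn : ∀ {ω} → Alive ω → Alive (turn ω)
    alive-turn ((false , false) , ω∈) = (true , false) , ω∈
    alive-turn ((false , true)  , ω∈) = (true , true) , ω∈
    alive-turn ((true  , false) , ω∈) = (false , false) , ω∈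
    alive-turn ((true  , true)  , ω∈) = (false , true) , ω∈

    -- The members of a fibre agree except in the erased cell, so κ members give κ distinct cells
    -- over the same state, and the vertices of `Z` cannot spoil them all.
    resample : ∀ {ab c c′} → Alive (ab , c , c′) → ∀ Z → length Z * (2 * bound 1) < κ →
      ∃ λ d → Alive (ab , d , c′) × proj₁ d ∉ Z × proj₂ d ∉ Z
    resample {ab} {c} {c′} alive@(i , ω∈) Z big = finish (pick (pathState a≢b) ds Z unique-ds fresh-ds
        (≤-trans big (≤-trans (rich (∈-symmetries i) ω∈) (≤-reflexive (sym (List.length-map middle F))))))
      where
      a≢b = proj₁ (proj₁ (alive-hexagon alive))
      middle : Tuple → Cell
      middle ω = proj₁ (proj₂ (act i ω))
      F = fibre i (act i (ab , c , c′)) core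
      ds = map middle F
      rebuilt : ∀ {ω} → ω ∈ F → act i ω ≡ (ab , middle ω , c′)
      rebuilt {ω} ω∈F with ∈-filter⁻ (fibre? i (act i (ab , c , c′))) {xs = core} ω∈F
      ... | _ , e = trans (cong (λ (p , q) → p , middle ω , q) e) (cong (λ (p , _ , q) → p , middle ω , q) (act-involutive i (ab , c , c′)))
      alive-ds : ∀ {d} → d ∈ ds → Alive (ab , d , c′)
      alive-ds d∈ with ∈-map⁻ middle d∈
      ... | ω , ω∈F , refl = i , subst (_∈ core) (trans (sym (act-involutive i ω)) (cong (act i) (rebuilt ω∈F)))
                                  (proj₁ (∈-filter⁻ (fibre? i (act i (ab , c , c′))) {xs = core} ω∈F))
      unique-map : ∀ {F′} → F′ ⊆ F → Unique F′ → Unique (map middle F′)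
      unique-map {[]} sub [] = []
      unique-map {ω ∷ F′} sub (ω∉ ∷ u) = All.map⁺ (All.tabulate (λ {ω′} ω′∈ e → All.lookup ω∉ ω′∈
          (trans (sym (act-involutive i ω)) (trans (cong (act i) (trans (rebuilt (sub (here refl)))
            (trans (cong (λ d → ab , d , c′) e) (sym (rebuilt (sub (there ω′∈))))))) (act-involutive i ω′))))) ∷ unique-map (sub ∘ there) u
      unique-ds : Unique ds
      unique-ds = unique-map id (Unique.filter⁺ (fibre? i (act i (ab , c , c′))) uniq)
      fresh-ds : All (Fresh (pathState a≢b)) ds
      fresh-ds = All.tabulate (λ d∈ → path3⇒fresh a≢b (proj₁ (alive-hexagon (alive-ds d∈))))
      finish : (∃ λ d → d ∈ ds × proj₁ d ∉ Z × proj₂ d ∉ Z) → ∃ λ d → Alive (ab , d , c′) × proj₁ d ∉ Z × proj₂ d ∉ Z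
      finish (d , d∈ , avoid) = d , alive-ds d∈ , avoid

    Good : State → Set
    Good s = ∃ λ a → ∃ λ b → ∃ λ c → ∃ λ c′ → Alive ((a , b) , c , c′) × left s ≡ a ∷ [] × right s ≡ b ∷ []

    resampleBoth : ∀ {a b c c′} → Alive ((a , b) , c , c′) → ∀ Z → length Z * (2 * bound 1) < κ →
      ∃ λ d → ∃ λ d′ → Alive ((a , b) , d , d′) × All (_∉ Z) (cellVertices (d ∷ d′ ∷ []))
    resampleBoth {a} {b} {c′ = c′} alive Z big = first (resample alive Z big)
      where
      Result = ∃ λ d → ∃ λ d′ → Alive ((a , b) , d , d′) × All (_∉ Z) (cellVertices (d ∷ d′ ∷ []))
      -- The half turn moves the cell just chosen into the slot that resampling preserves, so the
      -- second replacement does not undo the first.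
      second : ∀ d → proj₁ d ∉ Z → proj₂ d ∉ Z →
        (∃ λ e → Alive ((b , a) , e , (proj₂ d , proj₁ d)) × proj₁ e ∉ Z × proj₂ e ∉ Z) → Result
      second d x∉ y∉ (e , alive₂ , y′∉ , x′∉) =
        d , (proj₂ e , proj₁ e) , alive-half alive₂ , x∉ ∷ y∉ ∷ x′∉ ∷ y′∉ ∷ []
      first : (∃ λ d → Alive ((a , b) , d , c′) × proj₁ d ∉ Z × proj₂ d ∉ Z) → Result
      first (d , alive₁ , x∉ , y∉) = second d x∉ y∉ (resample (alive-half alive₁) Z big)

    block : ∀ {Z} (s : State) {a b} → left s ≡ a ∷ [] → right s ≡ b ∷ [] → ∀ d d′ → Alive ((a , b) , d , d′) →
      All (_∉ Z) (cellVertices (d ∷ d′ ∷ [])) → Hexagon ((a , b) , d , d′) → Block G 1 Good s Z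
    block {Z} s {a} {b} eˡ eʳ d@(x , y) d′@(x′ , y′) alive avoid (p , p′ , x∉ , _) = record
      { next = pathState {x} {y′} (x∉ ∘ inj₂)
      -- The reflection `turn` carries the pair (a , b) to the opposite pair (x , y′), which has one
      -- vertex on each of the two new paths.
      ; good = x , y′ , (a , x′) , (y , b) , alive-turn alive , refl , refl
      ; cells = d ∷ d′ ∷ []
      ; cell = d
      ; nonempty = here refl
      ; small = s≤s (s≤s z≤n)
      ; extend = extends p ∷ extends p′ ∷ []
      ; avoid = avoid
      ; inside = λ { (here e) → here e ; (there (here e)) → there (there (there (here e))) } }
      where
      extends : ∀ {c} → Path3 (a , b) c → Extends s c
      extends (_ , xy , xa , yb , _) = xy , subst (All _) (sym eˡ) (xa ∷ []) , subst (All _) (sym eʳ) (yb ∷ [])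

    expand : ∀ m₀ → m₀ * (2 * bound 1) < κ → ∀ s → Good s → ∀ Z → length Z ≤ m₀ → Block G 1 Good s Z
    expand m₀ large s (a , b , c , c′ , alive , eˡ , eʳ) Z short =
      finish (resampleBoth alive Z (≤-trans (s≤s (*-monoˡ-≤ (2 * bound 1) short)) large))
      where
      finish : (∃ λ d → ∃ λ d′ → Alive ((a , b) , d , d′) × All (_∉ Z) (cellVertices (d ∷ d′ ∷ []))) → Block G 1 Good s Z
      finish (d , d′ , alive′ , avoid) = block s eˡ eʳ d d′ alive′ avoid (alive-hexagon alive′)

    startState : ∃ Good
    startState = pathState (proj₁ (proj₁ (alive-hexagon {member} alive))) , _ , _ , _ , _ , alive , refl , refl
      where
      alive : Alive member
      alive = (false , false) , member∈

  paths : Cell → ℕ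
  paths ab = # (path3? ab) (pairs n)

  triples : List Tuple
  triples = cartesianProduct (pairs n) (cartesianProduct (pairs n) (pairs n))

  hexagons : List Tuple
  hexagons = filter hexagon? triples

  unique-hexagons : Unique hexagons
  unique-hexagons = Unique.filter⁺ hexagon? (Unique.cartesianProduct⁺ (unique-pairs n)
    (Unique.cartesianProduct⁺ (unique-pairs n) (unique-pairs n)))

  path? : ∀ (q : Cell × Cell) → Dec (Path3 (proj₁ q) (proj₂ q))
  path? (ab , c) = path3? ab c

  values : List ((Bool × Bool) × (Cell × Cell))
  values = cartesianProduct symmetries (filter path? (cartesianProduct (pairs n) (pairs n)))

  length-values : length values ≡ 4 * ∑ (pairs n) paths
  length-values = trans (length-product _,_ symmetries (filter path? (cartesianProduct (pairs n) (pairs n)))) (cong (4 *_)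
    (trans (length-filter≡# path? (cartesianProduct (pairs n) (pairs n))) (∑-product _,_ (pairs n) (pairs n) (λ q → 𝟙 (does (path? q))))))

  forget∈values : ∀ {i ω} → i ∈ symmetries → ω ∈ hexagons → (i , forget i ω) ∈ values
  forget∈values {i} {ω} i∈ ω∈ = ∈-cartesianProduct⁺ i∈ (∈-filter⁺ path?
    (∈-cartesianProduct⁺ (∈-pairs _) (∈-pairs _))
    (proj₁ (proj₂ (act-hexagon i (proj₂ (∈-filter⁻ hexagon? {xs = triples} ω∈))))))

  -- Each of the two vertices of a first path lies on at most `2 * bound 1` of the cells over the
  -- same pair of ends.
  collisions : ℕ
  collisions = 2 * (2 * bound 1)

  paths²≤hexagons : ∑ (pairs n) (λ ab → paths ab * (paths ab ∸ collisions)) ≤ length hexagons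
  paths²≤hexagons = begin
    ∑ (pairs n) (λ ab → paths ab * (paths ab ∸ collisions))
      ≤⟨ ∑-mono (pairs n) (λ ab → ≤-trans (≤-reflexive (sym (∑-*ʳ (pairs n) _ (paths ab ∸ collisions))))
           (∑-mono (pairs n) (λ c → 𝟙-*-≤ (path3? ab c) (extensions ab c)))) ⟩
    ∑ (pairs n) (λ ab → ∑ (pairs n) (λ c → ∑ (pairs n) (λ c′ → 𝟙 (does (hexagon? (ab , c , c′))))))
      ≡⟨ ∑-cong (pairs n) (λ ab → ∑-product _,_ (pairs n) (pairs n) _) ⟨
    ∑ (pairs n) (λ ab → ∑ (cartesianProduct (pairs n) (pairs n)) (λ q → 𝟙 (does (hexagon? (ab , q)))))
      ≡⟨ ∑-product _,_ (pairs n) _ _ ⟨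
    # hexagon? triples
      ≡⟨ length-filter≡# hexagon? triples ⟨
    length hexagons ∎
    where
    extensions : ∀ ab c → Path3 ab c → paths ab ∸ collisions ≤ # (λ c′ → hexagon? (ab , c , c′)) (pairs n)
    extensions ab c p@(a≢b , _) = m≤n+o⇒m∸n≤o (paths ab) collisions (≤-trans
      (#-blocked (path3? ab) touches? (pairs n) (proj₁ c ∷ proj₂ c ∷ []) (2 * bound 1)
        (λ z → #-touching (pathState a≢b) z (path3? ab) (pairs n) (unique-pairs n) (λ _ → path3⇒fresh a≢b)))
      (≤-trans (≤-reflexive (+-comm _ collisions)) (+-monoʳ-≤ collisions
        (#-mono (λ c′ → path3? ab c′ ×-dec All.all? (λ z → ¬? (touches? c′ z)) (proj₁ c ∷ proj₂ c ∷ []))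
          (λ c′ → hexagon? (ab , c , c′)) (pairs n) (λ { c′ (p′ , x∉ ∷ y∉ ∷ []) → p , p′ , x∉ , y∉ })))))

  -- With P the total number of paths, erasing a cell leaves one of 4P values, while Cauchy-Schwarz
  -- over the n² pairs of ends yields about P²/n² hexagons. The latter wins by a factor κ as soon as
  -- P/n² exceeds 4κ and the loss from collisions.
  many-hexagons : ∀ κ → n * n * (collisions + 4 * κ) < ∑ (pairs n) paths → κ * length values < length hexagons
  many-hexagons κ many = ≰⇒> (λ few → contradiction (begin-strict
    P * P  ≤⟨ ∑-cauchy-schwarz (pairs n) paths ⟩
    length (pairs n) * ∑ (pairs n) (λ ab → paths ab * paths ab)  ≡⟨ cong (_* ∑ (pairs n) (λ ab → paths ab * paths ab)) (length-pairs n) ⟩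
    n * n * ∑ (pairs n) (λ ab → paths ab * paths ab)  ≤⟨ *-monoʳ-≤ (n * n) (∑-mono (pairs n) (λ ab → split (paths ab))) ⟩
    n * n * ∑ (pairs n) (λ ab → paths ab * (paths ab ∸ collisions) + collisions * paths ab)
      ≡⟨ cong (n * n *_) (trans (∑-+ (pairs n) _ _) (cong (∑ (pairs n) (λ ab → paths ab * (paths ab ∸ collisions)) +_) (∑-*ˡ (pairs n) collisions paths))) ⟩
    n * n * (∑ (pairs n) (λ ab → paths ab * (paths ab ∸ collisions)) + collisions * P)
      ≤⟨ *-monoʳ-≤ (n * n) (+-monoˡ-≤ (collisions * P) (≤-trans paths²≤hexagons few)) ⟩
    n * n * (κ * length values + collisions * P)  ≡⟨ cong (λ l → n * n * (κ * l + collisions * P)) length-values ⟩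
    n * n * (κ * (4 * P) + collisions * P)  ≡⟨ rearrange (n * n) κ collisions P ⟩
    n * n * (collisions + 4 * κ) * P  <⟨ *-monoˡ-< P {{>-nonZero (≤-trans (s≤s z≤n) many)}} many ⟩
    P * P  ∎) (<-irrefl refl))
    where
    P = ∑ (pairs n) paths
    split : ∀ c → c * c ≤ c * (c ∸ collisions) + collisions * c
    split c = begin
      c * c  ≤⟨ *-monoʳ-≤ c (m≤n+m∸n c collisions) ⟩
      c * (collisions + (c ∸ collisions))  ≡⟨ lemma c collisions (c ∸ collisions) ⟩
      c * (c ∸ collisions) + collisions * c  ∎
      where
      lemma : ∀ c l d → c * (l + d) ≡ c * d + l * c
      lemma = solve-∀
    rearrange : ∀ q κ l P → q * (κ * (4 * P) + l * P) ≡ q * (l + 4 * κ) * P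
    rearrange = solve-∀

-- Counting paths with three edges.

module Paths {n : ℕ} (G : Graph n) (bounded : BoundedCodegree G 1) where

  open Density G
  open Growth G 1
  open Hexagons G bounded

  adjacent-avoiding : ∀ x zs ε → ε + length zs ≤ degree G x →
    ε ≤ # (λ v → (x ~? v) ×-dec All.all? (λ z → ¬? (v Fin.≟ z)) zs) (allFin n)
  adjacent-avoiding x zs ε big = +-cancelʳ-≤ (length zs) ε _ (≤-trans big (≤-trans
    (#-blocked (x ~?_) Fin._≟_ (allFin n) zs 1 (#-equal≤1 (x ~?_)))
    (+-monoʳ-≤ _ (≤-reflexive (*-identityʳ (length zs))))))

  -- Edges with an end of degree below ε+2 make up at most half of all edges. Any other edge xy is
  -- the middle of at least ε² paths: the 2 leaves room for the last vertex to avoid both x and the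
  -- first vertex.
  many-paths : ∀ ε → 4 * (n * (ε + 2)) ≤ 2 * edges G → 2 * edges G * (ε * ε) ≤ 2 * ∑ (pairs n) paths
  many-paths ε δ-small = begin
    E * (ε * ε)  ≤⟨ *-monoˡ-≤ (ε * ε) most-heavy ⟩
    2 * # heavy? (pairs n) * (ε * ε) ≡⟨ *-assoc 2 (# heavy? (pairs n)) (ε * ε) ⟩
    2 * (# heavy? (pairs n) * (ε * ε)) ≤⟨ *-monoʳ-≤ 2 heavy-paths ⟩
    2 * ∑ (pairs n) paths  ∎
    where
    E = 2 * edges G
    V = allFin n
    δ = ε + 2
    heavy? : ∀ (c : Cell) → Dec (proj₁ c ~ proj₂ c × δ ≤ degree G (proj₁ c) × δ ≤ degree G (proj₂ c))
    heavy? (x , y) = (x ~? y) ×-dec (δ ≤? degree G x) ×-dec (δ ≤? degree G y)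
    light? : ∀ (x y : Fin n) → Dec (x ~ y × degree G x < δ)
    light? x y = (x ~? y) ×-dec (degree G x <? δ)

    light≤ : ∑ V (λ x → # (light? x) V) ≤ n * δ
    light≤ = ≤-trans (∑≤length* V (λ x _ → few x)) (≤-reflexive (cong (_* δ) (length-allFin n)))
      where
      few : ∀ x → # (light? x) V ≤ δ
      few x = #-×≤ (x ~?_) (degree G x <? δ) V <⇒≤

    most-heavy : E ≤ 2 * # heavy? (pairs n)
    most-heavy = +-cancelʳ-≤ E E (2 * # heavy? (pairs n)) (begin
      E + E  ≡⟨ cong (E +_) (+-identityʳ E) ⟨
      2 * E  ≤⟨ *-monoʳ-≤ 2 classify ⟩
      2 * (# heavy? (pairs n) + (n * δ + n * δ))  ≡⟨ lemma (# heavy? (pairs n)) (n * δ) ⟩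
      2 * # heavy? (pairs n) + 4 * (n * δ)  ≤⟨ +-monoʳ-≤ (2 * # heavy? (pairs n)) δ-small ⟩
      2 * # heavy? (pairs n) + E  ∎)
      where
      lemma : ∀ h l → 2 * (h + (l + l)) ≡ 2 * h + 4 * l
      lemma = solve-∀
      trichotomy : ∀ x y → x ~ y → (x ~ y × δ ≤ degree G x × δ ≤ degree G y) ⊎ (x ~ y × degree G x < δ) ⊎ (y ~ x × degree G y < δ)
      trichotomy x y e with δ ≤? degree G x | δ ≤? degree G y
      ... | yes dx | yes dy = inj₁ (e , dx , dy)
      ... | no ¬dx | _      = inj₂ (inj₁ (e , ≰⇒> ¬dx))
      ... | yes _  | no ¬dy = inj₂ (inj₂ (~-sym e , ≰⇒> ¬dy))
      cases : ∀ x y → 𝟙 (does (x ~? y)) ≤ 𝟙 (does (heavy? (x , y))) + (𝟙 (does (light? x y)) + 𝟙 (does (light? y x)))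
      cases x y = ≤-trans (𝟙-∪ (x ~? y) (heavy? (x , y)) (light? x y ⊎-dec light? y x) (trichotomy x y))
        (+-monoʳ-≤ _ (𝟙-∪ (light? x y ⊎-dec light? y x) (light? x y) (light? y x) id))
      h l l′ : Fin n → Fin n → ℕ
      h x y = 𝟙 (does (heavy? (x , y)))
      l x y = 𝟙 (does (light? x y))
      l′ x y = l y x
      classify : E ≤ # heavy? (pairs n) + (n * δ + n * δ)
      classify = begin
        E  ≡⟨ ∑-degree G ⟨
        ∑ V (degree G)  ≤⟨ ∑-mono V (λ x → ∑-mono V (cases x)) ⟩
        ∑ V (λ x → ∑ V (λ y → h x y + (l x y + l′ x y)))  ≡⟨ ∑-cong V (λ x → split x) ⟩
        ∑ V (λ x → ∑ V (h x) + (∑ V (l x) + ∑ V (l′ x)))  ≡⟨ ∑-+ V (λ x → ∑ V (h x)) (λ x → ∑ V (l x) + ∑ V (l′ x)) ⟩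
        ∑ V (λ x → ∑ V (h x)) + ∑ V (λ x → ∑ V (l x) + ∑ V (l′ x))
          ≡⟨ cong₂ _+_ (sym (∑-pairs n (λ c → 𝟙 (does (heavy? c))))) (∑-+ V (λ x → ∑ V (l x)) (λ x → ∑ V (l′ x))) ⟩
        # heavy? (pairs n) + (∑ V (λ x → ∑ V (l x)) + ∑ V (λ x → ∑ V (l′ x)))
          ≡⟨ cong (λ s → # heavy? (pairs n) + (∑ V (λ x → ∑ V (l x)) + s)) (∑-swap V V l′) ⟩
        # heavy? (pairs n) + (∑ V (λ x → ∑ V (l x)) + ∑ V (λ x → ∑ V (l x)))
          ≤⟨ +-monoʳ-≤ (# heavy? (pairs n)) (+-mono-≤ light≤ light≤) ⟩
        # heavy? (pairs n) + (n * δ + n * δ)  ∎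
        where
        split : ∀ x → ∑ V (λ y → h x y + (l x y + l′ x y)) ≡ ∑ V (h x) + (∑ V (l x) + ∑ V (l′ x))
        split x = trans (∑-+ V (h x) (λ y → l x y + l′ x y)) (cong (∑ V (h x) +_) (∑-+ V (l x) (l′ x)))

    heavy-paths : # heavy? (pairs n) * (ε * ε) ≤ ∑ (pairs n) paths
    heavy-paths = begin
      # heavy? (pairs n) * (ε * ε)  ≡⟨ ∑-*ʳ (pairs n) _ (ε * ε) ⟨
      ∑ (pairs n) (λ xy → 𝟙 (does (heavy? xy)) * (ε * ε))  ≤⟨ ∑-mono (pairs n) (λ xy → 𝟙-*-≤ (heavy? xy) (middle xy)) ⟩
      ∑ (pairs n) (λ xy → # (λ ab → path3? ab xy) (pairs n))  ≡⟨ ∑-swap (pairs n) (pairs n) _ ⟩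
      ∑ (pairs n) paths  ∎
      where
      middle : ∀ xy → proj₁ xy ~ proj₂ xy × δ ≤ degree G (proj₁ xy) × δ ≤ degree G (proj₂ xy) →
        ε * ε ≤ # (λ ab → path3? ab xy) (pairs n)
      middle (x , y) (x~y , dx , dy) = begin
        ε * ε  ≤⟨ *-monoˡ-≤ ε (adjacent-avoiding x (y ∷ []) ε (≤-trans (+-monoʳ-≤ ε (s≤s z≤n)) dx)) ⟩
        # first? V * ε  ≡⟨ ∑-*ʳ V _ ε ⟨
        ∑ V (λ a → 𝟙 (does (first? a)) * ε)  ≤⟨ ∑-mono V (λ a → 𝟙-*-≤ (first? a) (last a)) ⟩
        ∑ V (λ a → # (λ b → path3? (a , b) (x , y)) V)  ≡⟨ ∑-pairs n _ ⟨
        # (λ ab → path3? ab (x , y)) (pairs n)  ∎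
        where
        first? = λ a → (x ~? a) ×-dec All.all? (λ z → ¬? (a Fin.≟ z)) (y ∷ [])
        last : ∀ a → x ~ a × All (λ z → ¬ a ≡ z) (y ∷ []) → ε ≤ # (λ b → path3? (a , b) (x , y)) V
        last a (x~a , a≢y ∷ []) = ≤-trans (adjacent-avoiding y (x ∷ a ∷ []) ε dy)
          (#-mono (λ b → (y ~? b) ×-dec All.all? (λ z → ¬? (b Fin.≟ z)) (x ∷ a ∷ [])) (λ b → path3? (a , b) (x , y)) V
            (λ { b (y~b , b≢x ∷ b≢a ∷ []) → b≢a ∘ sym , x~y , x~a , y~b , b≢x ∘ sym , a≢y ∘ sym }))

-- Counting tuples and greedy matchings.

module _ {A : Set} (C : List A) where

  length-tuples : ∀ k → length (tuples C k) ≡ length C ^ k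
  length-tuples zero = refl
  length-tuples (suc k) = trans (length-product _∷_ C (tuples C k)) (cong (length C *_) (length-tuples k))

  ∈-tuples⁻ : ∀ {k} (v : Vec A k) → v ∈ tuples C k → All (_∈ C) (toList v)
  ∈-tuples⁻ [] _ = []
  ∈-tuples⁻ {suc k} (x ∷ v) v∈ with ∈-cartesianProductWith⁻ _∷_ C (tuples C k) v∈
  ... | _ , _ , x∈ , v∈′ , refl = x∈ ∷ ∈-tuples⁻ v v∈′

  ∈-tuples⁺ : ∀ {k} (v : Vec A k) → All (_∈ C) (toList v) → v ∈ tuples C k
  ∈-tuples⁺ [] [] = here refl
  ∈-tuples⁺ (x ∷ v) (x∈ ∷ v∈) = ∈-cartesianProductWith⁺ _∷_ x∈ (∈-tuples⁺ v v∈)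

  module _ {P : A → Set} (P? : ∀ x → Dec (P x)) where

    #-all-tuples : ∀ k → # (λ v → All.all? P? (toList v)) (tuples C k) ≡ # P? C ^ k
    #-all-tuples zero = refl
    #-all-tuples (suc k) = begin-equality
      # (λ v → All.all? P? (toList v)) (tuples C (suc k))
        ≡⟨ ∑-product _∷_ C (tuples C k) _ ⟩
      ∑ C (λ x → ∑ (tuples C k) (λ v → 𝟙 (does (All.all? P? (x ∷ toList v)))))
        ≡⟨ ∑-cong C (λ x → trans (∑-cong (tuples C k) (λ v → cons x (toList v))) (∑-*ˡ (tuples C k) (𝟙 (does (P? x))) _)) ⟩
      ∑ C (λ x → 𝟙 (does (P? x)) * # (λ v → All.all? P? (toList v)) (tuples C k))
        ≡⟨ ∑-*ʳ C (λ x → 𝟙 (does (P? x))) _ ⟩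
      # P? C * # (λ v → All.all? P? (toList v)) (tuples C k)
        ≡⟨ cong (# P? C *_) (#-all-tuples k) ⟩
      # P? C ^ suc k ∎
      where
      cons : ∀ x xs → 𝟙 (does (All.all? P? (x ∷ xs))) ≡ 𝟙 (does (P? x)) * 𝟙 (does (All.all? P? xs))
      cons x xs = trans (𝟙-cong (All.all? P? (x ∷ xs)) (P? x ×-dec All.all? P? xs) (λ { (p ∷ ps) → p , ps }) (λ (p , ps) → p ∷ ps))
        (𝟙-× (P? x) (All.all? P? xs))

    module _ {R : A → A → Set} (R? : ∀ x y → Dec (R x y)) where

      matching? : ∀ {k} (v : Vec A k) → Dec (All P (toList v) × AllPairs (λ x y → ¬ R x y) (toList v))
      matching? v = All.all? P? (toList v) ×-dec AllPairs.allPairs? (λ x y → ¬? (R? x y)) (toList v)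

      -- Greedy choice: each entry already present excludes at most `L` candidates. The loss `B` is
      -- fixed for all steps at once, so that the count is a pure power.
      many-matchings : ∀ L → (∀ y → # (λ x → P? x ×-dec R? x y) C ≤ L) → ∀ k B → k * L ≤ B →
        (# P? C ∸ B) ^ k ≤ # matching? (tuples C k)
      many-matchings L few zero B _ = ≤-refl
      many-matchings L few (suc k) B L≤ = begin
        (# P? C ∸ B) * (# P? C ∸ B) ^ k
          ≤⟨ *-monoʳ-≤ (# P? C ∸ B) (many-matchings L few k B (≤-trans (m≤n+m (k * L) L) L≤)) ⟩
        (# P? C ∸ B) * # matching? (tuples C k)
          ≡⟨ *-comm (# P? C ∸ B) _ ⟩
        # matching? (tuples C k) * (# P? C ∸ B)
          ≡⟨ ∑-*ʳ (tuples C k) (λ v → 𝟙 (does (matching? v))) _ ⟨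
        ∑ (tuples C k) (λ v → 𝟙 (does (matching? v)) * (# P? C ∸ B))
          ≤⟨ ∑-mono (tuples C k) (λ v → 𝟙-*-≤ (matching? v) (extend v)) ⟩
        ∑ (tuples C k) (λ v → ∑ C (λ x → 𝟙 (does (matching? (x ∷ v)))))
          ≡⟨ ∑-swap C (tuples C k) (λ x v → 𝟙 (does (matching? (x ∷ v)))) ⟨
        ∑ C (λ x → ∑ (tuples C k) (λ v → 𝟙 (does (matching? (x ∷ v)))))
          ≡⟨ ∑-product _∷_ C (tuples C k) _ ⟨
        # matching? (tuples C (suc k)) ∎
        where
        extend : ∀ v → All P (toList v) × AllPairs (λ x y → ¬ R x y) (toList v) →
          # P? C ∸ B ≤ ∑ C (λ x → 𝟙 (does (matching? (x ∷ v))))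
        extend v (ps , apart) = m≤n+o⇒m∸n≤o (# P? C) B (begin
          # P? C
            ≤⟨ #-blocked P? R? C (toList v) L few ⟩
          # (λ x → P? x ×-dec All.all? (λ y → ¬? (R? x y)) (toList v)) C + length (toList v) * L
            ≤⟨ +-mono-≤ (#-mono (λ x → P? x ×-dec All.all? (λ y → ¬? (R? x y)) (toList v)) (λ x → matching? (x ∷ v)) C
                 (λ x (p , free) → p ∷ ps , free ∷ apart))
                 (≤-trans (*-monoˡ-≤ L (≤-trans (≤-reflexive (Vec.length-toList v)) (n≤1+n k))) L≤) ⟩
          ∑ C (λ x → 𝟙 (does (matching? (x ∷ v)))) + B
            ≡⟨ +-comm _ B ⟩
          B + ∑ C (λ x → 𝟙 (does (matching? (x ∷ v)))) ∎)

-- Removing the vertices of large degree.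

^-halve : ∀ {c d} k → c ≤ 2 * d → c ^ k ≤ 2 ^ k * d ^ k
^-halve {c} {d} k h = ≤-trans (^-monoˡ-≤ k h) (≤-reflexive (*-^-distrib 2 d k))

halve-∸ : ∀ {c B} → 2 * B ≤ c → c ≤ 2 * (c ∸ B)
halve-∸ {c} {B} h = begin
  c  ≡⟨ m+n∸n≡m c c ⟨
  c + c ∸ c  ≤⟨ ∸-monoʳ-≤ (c + c) h ⟩
  c + c ∸ 2 * B  ≡⟨ cong (λ d → c + d ∸ 2 * B) (+-identityʳ c) ⟨
  2 * c ∸ 2 * B  ≡⟨ *-distribˡ-∸ 2 c B ⟨
  2 * (c ∸ B)  ∎

-- A vertex of degree d > Δ sees about d^(t+1) tuples, and each tuple is seen by few vertices.
module HighDegree {n : ℕ} (G : Graph n) (t Δ : ℕ) (bounded : BoundedCodegree G t) (Δ-large : 2 * suc t ≤ Δ) where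

  open Density G

  V : List (Fin n)
  V = allFin n

  high? : ∀ x → Dec (Δ < degree G x)
  high? x = Δ <? degree G x

  highSum : ℕ
  highSum = ∑ V (λ x → 𝟙 (does (high? x)) * degree G x)

  seen? : ∀ x (v : Vec (Fin n) (suc t)) → Dec (All (x ~_) (toList v) × Unique (toList v))
  seen? x = matching? V (x ~?_) Fin._≟_

  few-see : ∀ v → # (λ x → seen? x v) V ≤ bound t
  few-see v with AllPairs.allPairs? (λ x y → ¬? (x Fin.≟ y)) (toList v)
  ... | yes u = <⇒≤ (≤-trans (s≤s (≤-reflexive (sym (length-filter≡# Q? V))))
      (bounded (toList v) (filter Q? V) u (Vec.length-toList v) (Unique.filter⁺ Q? (Unique.allFin⁺ n))
        (All.map proj₁ (All.all-filter Q? V))))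
    where
    Q? = λ x → All.all? (x ~?_) (toList v) ×-dec yes u
  ... | no ¬u = #-×≤ (λ x → All.all? (x ~?_) (toList v)) (no ¬u) V (λ u → contradiction u ¬u)

  highSum-bound : highSum * Δ ^ t ≤ 2 ^ suc t * (n ^ suc t * bound t)
  highSum-bound = begin
    highSum * Δ ^ t
      ≡⟨ ∑-*ʳ V (λ x → 𝟙 (does (high? x)) * degree G x) (Δ ^ t) ⟨
    ∑ V (λ x → 𝟙 (does (high? x)) * degree G x * Δ ^ t)
      ≤⟨ ∑-mono V (λ x → ≤-trans (≤-reflexive (*-assoc (𝟙 (does (high? x))) _ _)) (𝟙-*-≤ (high? x) (sees x))) ⟩
    ∑ V (λ x → 2 ^ suc t * # (seen? x) (tuples V (suc t)))
      ≡⟨ ∑-*ˡ V (2 ^ suc t) (λ x → # (seen? x) (tuples V (suc t))) ⟩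
    2 ^ suc t * ∑ V (λ x → # (seen? x) (tuples V (suc t)))
      ≡⟨ cong (2 ^ suc t *_) (∑-swap V (tuples V (suc t)) (λ x v → 𝟙 (does (seen? x v)))) ⟩
    2 ^ suc t * ∑ (tuples V (suc t)) (λ v → # (λ x → seen? x v) V)
      ≤⟨ *-monoʳ-≤ (2 ^ suc t) (∑≤length* (tuples V (suc t)) (λ v _ → few-see v)) ⟩
    2 ^ suc t * (length (tuples V (suc t)) * bound t)
      ≡⟨ cong (λ l → 2 ^ suc t * (l * bound t)) (trans (length-tuples V (suc t)) (cong (_^ suc t) (length-allFin n))) ⟩
    2 ^ suc t * (n ^ suc t * bound t) ∎
    where
    sees : ∀ x → Δ < degree G x → degree G x * Δ ^ t ≤ 2 ^ suc t * # (seen? x) (tuples V (suc t))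
    sees x Δ<d = begin
      degree G x * Δ ^ t  ≤⟨ *-monoʳ-≤ (degree G x) (^-monoˡ-≤ t (<⇒≤ Δ<d)) ⟩
      degree G x ^ suc t  ≤⟨ ^-halve {degree G x} {degree G x ∸ suc t} (suc t) (halve-∸ {degree G x} {suc t} (≤-trans Δ-large (<⇒≤ Δ<d))) ⟩
      2 ^ suc t * (degree G x ∸ suc t) ^ suc t  ≤⟨ *-monoʳ-≤ (2 ^ suc t) (many-matchings V (x ~?_) Fin._≟_ 1
                                                            (#-equal≤1 (x ~?_)) (suc t) (suc t) (≤-reflexive (*-identityʳ (suc t)))) ⟩
      2 ^ suc t * # (seen? x) (tuples V (suc t))  ∎

  low : Fin n → Bool
  low x = does (degree G x ≤? Δ)

  -- The removed vertices stay as isolated ones, so the vertex set is unchanged and a subgraph found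
  -- here is one of `G` with the same embedding.
  pruned : Graph n
  pruned = record
    { adj    = λ x y → adj G x y ∧ (low x ∧ low y)
    ; sym    = λ x y → cong₂ _∧_ (Graph.sym G x y) (Bool.∧-comm (low x) (low y))
    ; irrefl = λ x → cong (_∧ (low x ∧ low x)) (irrefl G x)
    }

  open Density pruned using () renaming (_~_ to _~′_; _~?_ to _~?′_)

  pruned⊆ : ∀ x y → x ~′ y → x ~ y
  pruned⊆ x y p with adj G x y
  ... | true = refl

  pruned-low : ∀ x y → x ~′ y → degree G x ≤ Δ
  pruned-low x y p = holds (degree G x ≤? Δ) (middle (adj G x y) (low x) (low y) p)
    where
    holds : {P : Set} (P? : Dec P) → does P? ≡ true → P
    holds (yes p) _ = p
    middle : ∀ a b c → a ∧ (b ∧ c) ≡ true → b ≡ true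
    middle true true c _ = refl

  pruned-degree : ∀ x → degree pruned x ≤ Δ
  pruned-degree x with degree pruned x in eq
  ... | zero = z≤n
  ... | suc d with ∃-of-# (x ~?′_) V (≤-trans (s≤s z≤n) (≤-reflexive (sym eq)))
  ...   | y , _ , x~y = ≤-trans (≤-reflexive (sym eq)) (≤-trans (#-mono (x ~?′_) (x ~?_) V (λ y → pruned⊆ x y)) (pruned-low x y x~y))

  pruned-bounded : BoundedCodegree pruned t
  pruned-bounded S ys uS lenS uys es = bounded S ys uS lenS uys (All.map (All.map (pruned⊆ _ _)) es)

  pruned-edges : 2 * edges G ≤ 2 * edges pruned + 2 * highSum
  pruned-edges = begin
    2 * edges G
      ≡⟨ ∑-degree G ⟨
    ∑ V (λ x → ∑ V (λ y → 𝟙 (does (x ~? y))))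
      ≤⟨ ∑-mono V (λ x → ∑-mono V (λ y → cases x y)) ⟩
    ∑ V (λ x → ∑ V (λ y → k x y + (l x y + l′ x y)))
      ≡⟨ ∑-cong V (λ x → trans (∑-+ V (k x) (λ y → l x y + l′ x y)) (cong (∑ V (k x) +_) (∑-+ V (l x) (l′ x)))) ⟩
    ∑ V (λ x → ∑ V (k x) + (∑ V (l x) + ∑ V (l′ x)))
      ≡⟨ trans (∑-+ V (λ x → ∑ V (k x)) (λ x → ∑ V (l x) + ∑ V (l′ x))) (cong (∑ V (λ x → ∑ V (k x)) +_) (∑-+ V (λ x → ∑ V (l x)) (λ x → ∑ V (l′ x)))) ⟩
    ∑ V (λ x → ∑ V (k x)) + (∑ V (λ x → ∑ V (l x)) + ∑ V (λ x → ∑ V (l′ x)))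
      ≡⟨ cong₂ (λ a b → a + (∑ V (λ x → ∑ V (l x)) + b)) (∑-degree pruned) (∑-swap V V l′) ⟩
    2 * edges pruned + (∑ V (λ x → ∑ V (l x)) + ∑ V (λ x → ∑ V (l x)))
      ≡⟨ cong (λ s → 2 * edges pruned + (s + s)) (∑-cong V (λ x → ∑-*ˡ V (𝟙 (does (high? x))) (λ y → 𝟙 (does (x ~? y))))) ⟩
    2 * edges pruned + (highSum + highSum)
      ≡⟨ cong (λ s → 2 * edges pruned + (highSum + s)) (+-identityʳ highSum) ⟨
    2 * edges pruned + 2 * highSum ∎
    where
    k l l′ : Fin n → Fin n → ℕ
    k x y = 𝟙 (does (x ~?′ y))
    l x y = 𝟙 (does (high? x)) * 𝟙 (does (x ~? y))
    l′ x y = l y x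
    kept : ∀ {x y} → x ~ y → degree G x ≤ Δ → degree G y ≤ Δ → x ~′ y
    kept {x} {y} x~y dx dy = cong₂ _∧_ x~y (cong₂ _∧_ (dec-true (degree G x ≤? Δ) dx) (dec-true (degree G y ≤? Δ) dy))
    trichotomy : ∀ x y → x ~ y → x ~′ y ⊎ (Δ < degree G x × x ~ y) ⊎ (Δ < degree G y × y ~ x)
    trichotomy x y e with degree G x ≤? Δ | degree G y ≤? Δ
    ... | yes dx | yes dy = inj₁ (kept e dx dy)
    ... | no ¬dx | _      = inj₂ (inj₁ (≰⇒> ¬dx , e))
    ... | yes _  | no ¬dy = inj₂ (inj₂ (≰⇒> ¬dy , ~-sym e))
    cases : ∀ x y → 𝟙 (does (x ~? y)) ≤ k x y + (l x y + l′ x y)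
    cases x y = ≤-trans (𝟙-∪ (x ~? y) (x ~?′ y) ((high? x ×-dec (x ~? y)) ⊎-dec (high? y ×-dec (y ~? x))) (trichotomy x y))
      (+-monoʳ-≤ (k x y) (≤-trans (𝟙-∪ ((high? x ×-dec (x ~? y)) ⊎-dec (high? y ×-dec (y ~? x))) (high? x ×-dec (x ~? y)) (high? y ×-dec (y ~? x)) id)
        (≤-reflexive (cong₂ _+_ (𝟙-× (high? x) (x ~? y)) (𝟙-× (high? y) (y ~? x))))))

-- The template of two matchings.

removeAt-⊆ : {A : Set} {k : ℕ} (v : Vec A (suc k)) (j : Fin (suc k)) → toList (removeAt v j) ⊆ toList v
removeAt-⊆ (x ∷ v) Fin.zero x∈ = there x∈
removeAt-⊆ (x ∷ v@(_ ∷ _)) (Fin.suc j) (here e) = here e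
removeAt-⊆ (x ∷ v@(_ ∷ _)) (Fin.suc j) (there x∈) = there (removeAt-⊆ v j x∈)

removeAt-lookup : {A : Set} {k : ℕ} (v w : Vec A (suc k)) (j : Fin (suc k)) →
  removeAt v j ≡ removeAt w j → lookup v j ≡ lookup w j → v ≡ w
removeAt-lookup v w j p q =
  trans (sym (Vec.insertAt-removeAt v j)) (trans (cong₂ (λ u x → insertAt u j x) p q) (Vec.insertAt-removeAt w j))

removeAt-agree : {A : Set} {k : ℕ} (v w : Vec A (suc k)) {i j : Fin (suc k)} →
  removeAt v j ≡ removeAt w j → j ≢ i → lookup v i ≡ lookup w i
removeAt-agree v w {i} {j} p j≢i =
  trans (sym (Vec.removeAt-punchOut v j≢i)) (trans (cong (λ u → lookup u (Data.Fin.punchOut j≢i)) p) (Vec.removeAt-punchOut w j≢i))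

lookup-∈ : {A : Set} {k : ℕ} (v : Vec A k) (i : Fin k) → lookup v i ∈ toList v
lookup-∈ (x ∷ v) Fin.zero = here refl
lookup-∈ (x ∷ v) (Fin.suc i) = there (lookup-∈ v i)

all-lookup : {A : Set} {P : A → Set} {k : ℕ} (v : Vec A k) → (∀ i → P (lookup v i)) → All P (toList v)
all-lookup [] h = []
all-lookup (x ∷ v) h = h Fin.zero ∷ all-lookup v (h ∘ Fin.suc)

module Squares {n : ℕ} (G : Graph n) where

  open Density G

  IsEdge : Fin n × Fin n → Set
  IsEdge c = proj₁ c ~ proj₂ c

  isEdge? : ∀ c → Dec (IsEdge c)
  isEdge? c = proj₁ c ~? proj₂ c

  -- (a , b) and (x , y) are opposite edges of the 4-cycle a b x y.
  Square : Fin n × Fin n → Fin n × Fin n → Set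
  Square (a , b) (x , y) = a ~ b × x ~ y × b ~ x × a ~ y × a ≢ x × b ≢ y

  square? : ∀ (w c : Fin n × Fin n) → Dec (Square w c)
  square? (a , b) (x , y) = (a ~? b) ×-dec (x ~? y) ×-dec (b ~? x) ×-dec (a ~? y) ×-dec ¬? (a Fin.≟ x) ×-dec ¬? (b Fin.≟ y)

  square-sym : ∀ {w c} → Square w c → Square c w
  square-sym (ab , xy , bx , ay , a≢x , b≢y) = xy , ab , ~-sym ay , ~-sym bx , a≢x ∘ sym , b≢y ∘ sym

module Cubes {n : ℕ} (G : Graph n) (t′ : ℕ) (bounded : BoundedCodegree G (suc t′)) where

  t : ℕ
  t = suc t′

  open Density G
  open Growth G t
  open Crowding G t bounded
  open Squares G

  Cells : ℕ → Set
  Cells = Vec Cell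

  Tuple : Set
  Tuple = Cells t × Cells t

  Conflict : Cell → Cell → Set
  Conflict c d = Touches c (proj₁ d) ⊎ Touches c (proj₂ d)

  conflict? : ∀ c d → Dec (Conflict c d)
  conflict? c d = touches? c (proj₁ d) ⊎-dec touches? c (proj₂ d)

  Apart : List Cell → Set
  Apart = AllPairs (λ c d → ¬ Conflict c d)

  apart? : ∀ cs → Dec (Apart cs)
  apart? = AllPairs.allPairs? (λ c d → ¬? (conflict? c d))

  Joined : ∀ {k} → Cells k → Cell → Set
  Joined W c = All (λ w → Square w c) (toList W)

  joined? : ∀ {k} (W : Cells k) c → Dec (Joined W c)
  joined? W c = All.all? (λ w → square? w c) (toList W)

  Cube : Tuple → Set
  Cube (W , W′) = Apart (toList W) × Apart (toList W′) × All (Joined W) (toList W′)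

  cube? : ∀ ω → Dec (Cube ω)
  cube? (W , W′) = apart? (toList W) ×-dec apart? (toList W′) ×-dec All.all? (joined? W) (toList W′)

  act : Bool → Tuple → Tuple
  act false ω = ω
  act true (W , W′) = W′ , W

  act-involutive : ∀ b ω → act b (act b ω) ≡ ω
  act-involutive false ω = refl
  act-involutive true ω = refl

  act-cube : ∀ b {ω} → Cube ω → Cube (act b ω)
  act-cube false h = h
  act-cube true (ap , ap′ , joined) = ap′ , ap , All.map (All.map square-sym) (All.All-swap joined)

  members-apart : ∀ {cs c d} → Apart cs → c ∈ cs → d ∈ cs → c ≡ d ⊎ ¬ Conflict c d ⊎ ¬ Conflict d c
  members-apart (_ ∷ _) (here refl) (here refl) = inj₁ refl
  members-apart (ap ∷ _) (here refl) (there d∈) = inj₂ (inj₁ (All.lookup ap d∈))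
  members-apart (ap ∷ _) (there c∈) (here refl) = inj₂ (inj₂ (All.lookup ap c∈))
  members-apart (_ ∷ aps) (there c∈) (there d∈) = members-apart aps c∈ d∈

  unique-ends : ∀ {cs} (f : Cell → Fin n) → (∀ {c d} → f c ≡ f d → Conflict c d) → Apart cs → Unique (map f cs)
  unique-ends f h [] = []
  unique-ends f h (ap ∷ aps) = All.map⁺ (All.map (λ ¬c e → ¬c (h e)) ap) ∷ unique-ends f h aps

  ends-disjoint : ∀ {cs} → Apart cs → All IsEdge cs → Disjoint (map proj₂ cs) (map proj₁ cs)
  ends-disjoint {cs} ap edges (v∈₂ , v∈₁) with ∈-map⁻ proj₂ {xs = cs} v∈₂ | ∈-map⁻ proj₁ {xs = cs} v∈₁
  ... | c , c∈ , refl | d , d∈ , e with members-apart ap c∈ d∈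
  ...   | inj₁ refl = ~⇒≢ (All.lookup edges c∈) (sym e)
  ...   | inj₂ (inj₁ ¬c) = ¬c (inj₁ (inj₂ (sym e)))
  ...   | inj₂ (inj₂ ¬c) = ¬c (inj₂ (inj₁ e))

  -- The sides are crossed because `Square` joins the second end b to x and the first end a to y.
  tupleState : (W : Cells t) → Apart (toList W) → All IsEdge (toList W) → State
  tupleState W ap edges = state (map proj₂ (toList W)) (map proj₁ (toList W))
    (trans (List.length-map proj₂ (toList W)) (Vec.length-toList W))
    (trans (List.length-map proj₁ (toList W)) (Vec.length-toList W))
    (unique-ends proj₂ (λ e → inj₂ (inj₂ (sym e))) ap) (unique-ends proj₁ (λ e → inj₁ (inj₁ (sym e))) ap)
    (ends-disjoint ap edges)

  joined⇒extends : ∀ s (W : Cells t) → left s ≡ map proj₂ (toList W) → right s ≡ map proj₁ (toList W) →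
    ∀ {c} → Joined W c → Extends s c
  joined⇒extends s W@(_ ∷ _) eˡ eʳ joined = proj₁ (proj₂ (All.head joined)) ,
    subst (All _) (sym eˡ) (All.map⁺ (All.map (λ (_ , _ , bx , _) → ~-sym bx) joined)) ,
    subst (All _) (sym eʳ) (All.map⁺ (All.map (λ (_ , _ , _ , ay , _) → ~-sym ay) joined))

  joined⇒fresh : ∀ (W : Cells t) ap edges {c} → Joined W c → Fresh (tupleState W ap edges) c
  joined⇒fresh W ap edges {x , y} joined = joined⇒extends (tupleState W ap edges) W refl refl joined ,
    (λ x∈ → out-x (∈-++⁻ (map proj₂ (toList W)) x∈)) , (λ y∈ → out-y (∈-++⁻ (map proj₂ (toList W)) y∈))
    where
    out-x : ¬ (x ∈ map proj₂ (toList W) ⊎ x ∈ map proj₁ (toList W))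
    out-x (inj₁ x∈) with ∈-map⁻ proj₂ x∈
    ... | w , w∈ , e = ~⇒≢ (proj₁ (proj₂ (proj₂ (All.lookup joined w∈)))) (sym e)
    out-x (inj₂ x∈) with ∈-map⁻ proj₁ x∈
    ... | w , w∈ , e = proj₁ (proj₂ (proj₂ (proj₂ (proj₂ (All.lookup joined w∈))))) (sym e)
    out-y : ¬ (y ∈ map proj₂ (toList W) ⊎ y ∈ map proj₁ (toList W))
    out-y (inj₁ y∈) with ∈-map⁻ proj₂ y∈
    ... | w , w∈ , e = proj₂ (proj₂ (proj₂ (proj₂ (proj₂ (All.lookup joined w∈))))) (sym e)
    out-y (inj₂ y∈) with ∈-map⁻ proj₁ y∈
    ... | w , w∈ , e = ~⇒≢ (proj₁ (proj₂ (proj₂ (proj₂ (All.lookup joined w∈))))) (sym e)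

  cube-edges : ∀ {W W′} → Cube (W , W′) → All IsEdge (toList W)
  cube-edges {W} {_ ∷ _} (_ , _ , joined ∷ _) = All.map proj₁ joined

  Index : Set
  Index = Bool × Fin t

  indices : List Index
  indices = cartesianProduct (false ∷ true ∷ []) (allFin t)

  ∈-indices : ∀ i → i ∈ indices
  ∈-indices (false , j) = ∈-cartesianProduct⁺ {xs = false ∷ true ∷ []} (here refl) (∈-allFin j)
  ∈-indices (true , j) = ∈-cartesianProduct⁺ {xs = false ∷ true ∷ []} (there (here refl)) (∈-allFin j)

  forget : Index → Tuple → Cells t × Cells t′
  forget (b , j) ω = proj₁ (act b ω) , removeAt (proj₂ (act b ω)) j

  _≟ⁱ_ : ∀ (i j : Index) → Dec (i ≡ j)
  _≟ⁱ_ = Product.≡-dec Bool._≟_ Fin._≟_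

  _≟ᵛ_ : ∀ (v w : Cells t × Cells t′) → Dec (v ≡ w)
  _≟ᵛ_ = Product.≡-dec (Vec.≡-dec _≟ᶜ_) (Vec.≡-dec _≟ᶜ_)

  module Resampling (κ : ℕ) (Ω : List Tuple) (cubes : ∀ {ω} → ω ∈ Ω → Cube ω)
    (R : Cleaning.Robust _≟ᵛ_ _≟ⁱ_ forget indices κ Ω) where

    open Cleaning _≟ᵛ_ _≟ⁱ_ forget indices κ
    open Robust R

    Alive : Tuple → Set
    Alive ω = ∃ λ b → act b ω ∈ core

    alive-cube : ∀ {ω} → Alive ω → Cube ω
    alive-cube {ω} (b , ω∈) = subst Cube (act-involutive b ω) (act-cube b (cubes (⊆Ω ω∈)))

    alive-swap : ∀ {W W′} → Alive (W , W′) → Alive (W′ , W)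
    alive-swap (false , ω∈) = true , ω∈
    alive-swap (true , ω∈) = false , ω∈

    Avoids : List (Fin n) → Cell → Set
    Avoids Z d = proj₁ d ∉ Z × proj₂ d ∉ Z

    resample : ∀ {W W′} → Alive (W , W′) → ∀ Z → length Z * (2 * bound t) < κ → ∀ j →
      ∃ λ W″ → Alive (W , W″) × removeAt W″ j ≡ removeAt W′ j × Avoids Z (lookup W″ j)
    resample {W} {W′} alive@(b , ω∈) Z big j = finish (pick s ds Z unique-ds fresh-ds
        (≤-trans big (≤-trans (rich (∈-indices (b , j)) ω∈) (≤-reflexive (sym (List.length-map cellAt F))))))
      where
      s = tupleState W (proj₁ (alive-cube alive)) (cube-edges {W} {W′} (alive-cube alive))
      i = (b , j)
      cellAt : Tuple → Cell
      cellAt ω = lookup (proj₂ (act b ω)) j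
      F = fibre i (act b (W , W′)) core
      ds = map cellAt F
      same : ∀ {ω} → ω ∈ F → forget i ω ≡ (W , removeAt W′ j)
      same {ω} ω∈F = trans (proj₂ (∈-filter⁻ (fibre? i (act b (W , W′))) {xs = core} ω∈F))
        (cong (λ ω → proj₁ ω , removeAt (proj₂ ω) j) (act-involutive b (W , W′)))
      in-core : ∀ {ω} → ω ∈ F → ω ∈ core
      in-core ω∈F = proj₁ (∈-filter⁻ (fibre? i (act b (W , W′))) {xs = core} ω∈F)
      alive-F : ∀ {ω} → ω ∈ F → Alive (W , proj₂ (act b ω))
      alive-F {ω} ω∈F = b , subst (_∈ core) (trans (sym (act-involutive b ω))
        (cong (λ U → act b (U , proj₂ (act b ω))) (cong proj₁ (same ω∈F)))) (in-core ω∈F)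
      injective : ∀ {ω ω′} → ω ∈ F → ω′ ∈ F → cellAt ω ≡ cellAt ω′ → ω ≡ ω′
      injective {ω} {ω′} p q e = trans (sym (act-involutive b ω)) (trans (cong (act b) (cong₂ _,_
        (trans (cong proj₁ (same p)) (sym (cong proj₁ (same q))))
        (removeAt-lookup (proj₂ (act b ω)) (proj₂ (act b ω′)) j (trans (cong proj₂ (same p)) (sym (cong proj₂ (same q)))) e)))
        (act-involutive b ω′))
      unique-map : ∀ {F′} → F′ ⊆ F → Unique F′ → Unique (map cellAt F′)
      unique-map {[]} sub [] = []
      unique-map {ω ∷ F′} sub (ω∉ ∷ u) = All.map⁺ (All.tabulate (λ ω′∈ e →
        All.lookup ω∉ ω′∈ (injective (sub (here refl)) (sub (there ω′∈)) e))) ∷ unique-map (sub ∘ there) u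
      unique-ds : Unique ds
      unique-ds = unique-map id (Unique.filter⁺ (fibre? i (act b (W , W′))) uniq)
      fresh-ds : All (Fresh s) ds
      fresh-ds = All.map⁺ (All.tabulate (λ {ω} ω∈F → joined⇒fresh W (proj₁ (alive-cube alive)) (cube-edges {W} {W′} (alive-cube alive))
        (All.lookup (proj₂ (proj₂ (alive-cube (alive-F ω∈F)))) (lookup-∈ (proj₂ (act b ω)) j))))
      Result = ∃ λ W″ → Alive (W , W″) × removeAt W″ j ≡ removeAt W′ j × Avoids Z (lookup W″ j)
      finish : (∃ λ d → d ∈ ds × proj₁ d ∉ Z × proj₂ d ∉ Z) → Result
      finish (d , d∈ , x∉ , y∉) with ∈-map⁻ cellAt d∈
      ... | ω , ω∈F , refl = proj₂ (act b ω) , alive-F ω∈F , cong proj₂ (same ω∈F) , x∉ , y∉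

    AvoidsBelow : List (Fin n) → ℕ → Cells t → Set
    AvoidsBelow Z k W = ∀ i → toℕ i < k → Avoids Z (lookup W i)

    avoidsBelow-suc : ∀ {Z k} (k<t : k < t) (W₁ W₂ : Cells t) → AvoidsBelow Z k W₁ →
      removeAt W₂ (Data.Fin.fromℕ< k<t) ≡ removeAt W₁ (Data.Fin.fromℕ< k<t) →
      Avoids Z (lookup W₂ (Data.Fin.fromℕ< k<t)) → AvoidsBelow Z (suc k) W₂
    avoidsBelow-suc {Z} k<t W₁ W₂ below agree new i i<1+k = decide (Data.Fin.fromℕ< k<t Fin.≟ i)
      where
      decide : Dec (Data.Fin.fromℕ< k<t ≡ i) → Avoids Z (lookup W₂ i)
      decide (yes e) = subst (λ i → Avoids Z (lookup W₂ i)) e new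
      decide (no j≢i) = subst (Avoids Z) (sym (removeAt-agree W₂ W₁ agree j≢i))
        (below i (≤∧≢⇒< (≤-pred i<1+k) (λ e → j≢i (Fin.toℕ-injective (trans (Fin.toℕ-fromℕ< k<t) (sym e))))))

    -- Robustness replaces one cell at a time. The cells are treated in order, and since the others
    -- agree with the previous tuple, the ones already moved off `Z` stay there.
    resampleFirst : ∀ {W W′} → Alive (W , W′) → ∀ Z → length Z * (2 * bound t) < κ → ∀ k → k ≤ t →
      ∃ λ W″ → Alive (W , W″) × AvoidsBelow Z k W″
    resampleFirst {W} {W′} alive Z big zero _ = W′ , alive , λ _ ()
    resampleFirst {W} {W′} alive Z big (suc k) k<t = next (resampleFirst alive Z big k (<⇒≤ k<t))
      where
      j = Data.Fin.fromℕ< k<t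
      Result = ∃ λ W″ → Alive (W , W″) × AvoidsBelow Z (suc k) W″
      finish : ∀ W₁ → AvoidsBelow Z k W₁ →
        (∃ λ W₂ → Alive (W , W₂) × removeAt W₂ j ≡ removeAt W₁ j × Avoids Z (lookup W₂ j)) → Result
      finish W₁ below (W₂ , alive₂ , agree , new) = W₂ , alive₂ , avoidsBelow-suc k<t W₁ W₂ below agree new
      next : (∃ λ W₁ → Alive (W , W₁) × AvoidsBelow Z k W₁) → Result
      next (W₁ , alive₁ , below) = finish W₁ below (resample alive₁ Z big j)

    Good : State → Set
    Good s = ∃ λ W → ∃ λ W′ → Alive (W , W′) × left s ≡ map proj₂ (toList W) × right s ≡ map proj₁ (toList W)

    avoids-cellVertices : ∀ {Z cs} → All (Avoids Z) cs → All (_∉ Z) (cellVertices cs)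
    avoids-cellVertices [] = []
    avoids-cellVertices ((x∉ , y∉) ∷ as) = x∉ ∷ y∉ ∷ avoids-cellVertices as

    block : ∀ {Z} (s : State) (W W″ : Cells t) → left s ≡ map proj₂ (toList W) → right s ≡ map proj₁ (toList W) →
      Alive (W , W″) → Cube (W , W″) → All (Avoids Z) (toList W″) → Block G t Good s Z
    block s W W″@(c ∷ _) eˡ eʳ alive cube@(ap , ap″ , joined) avoids = record
      { next = tupleState W″ ap″ (cube-edges {W″} {W} (act-cube true cube))
      -- The two matchings exchange their roles: the old one now testifies that the new state is
      -- good.
      ; good = W″ , W , alive-swap alive , refl , refl
      ; cells = toList W″
      ; cell = c
      ; nonempty = here refl
      ; small = ≤-trans (≤-reflexive (Vec.length-toList W″)) (m≤m+n t _)
      ; extend = All.map (joined⇒extends s W eˡ eʳ) joined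
      ; avoid = avoids-cellVertices avoids
      ; inside = λ v∈ → ends (∈-++⁻ (map proj₂ (toList W″)) v∈) }
      where
      ends : ∀ {v} → v ∈ map proj₂ (toList W″) ⊎ v ∈ map proj₁ (toList W″) → v ∈ cellVertices (toList W″)
      ends (inj₁ v∈) with ∈-map⁻ proj₂ v∈
      ... | _ , c∈ , refl = proj₂ (∈-cellVertices⁺ c∈)
      ends (inj₂ v∈) with ∈-map⁻ proj₁ v∈
      ... | _ , c∈ , refl = proj₁ (∈-cellVertices⁺ c∈)

    expand : ∀ m₀ → m₀ * (2 * bound t) < κ → ∀ s → Good s → ∀ Z → length Z ≤ m₀ → Block G t Good s Z
    expand m₀ large s (W , W′ , alive , eˡ , eʳ) Z short =
      finish (resampleFirst alive Z (≤-trans (s≤s (*-monoˡ-≤ (2 * bound t) short)) large) t ≤-refl)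
      where
      finish : (∃ λ W″ → Alive (W , W″) × AvoidsBelow Z t W″) → Block G t Good s Z
      finish (W″ , alive″ , avoids) =
        block s W W″ eˡ eʳ alive″ (alive-cube alive″) (all-lookup W″ (λ i → avoids i (Fin.toℕ<n i)))

    startState : ∃ Good
    startState = tupleState (proj₁ member) (proj₁ cube) (cube-edges {proj₁ member} {proj₂ member} cube) , proj₁ member , proj₂ member , alive , refl , refl
      where
      alive : Alive member
      alive = false , member∈
      cube : Cube member
      cube = alive-cube alive

-- Counting 4-cycles under a degree bound.

#-filter : {A : Set} {P Q : A → Set} (P? : ∀ x → Dec (P x)) (Q? : ∀ x → Dec (Q x)) (xs : List A) →
  (∀ x → P x → Q x) → # P? xs ≤ # P? (filter Q? xs)
#-filter P? Q? xs h = ≤-trans (∑-mono xs (λ x → ≤-trans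
    (𝟙-mono (P? x) (Q? x ×-dec P? x) (λ p → h x p , p)) (≤-reflexive (𝟙-× (Q? x) (P? x)))))
  (≤-reflexive (sym (∑-filter Q? xs _)))

∑∑-product : {A B : Set} (xs : List A) (ys : List B) (f : A → ℕ) (g : B → ℕ) →
  ∑ xs (λ x → ∑ ys (λ y → f x * g y)) ≡ ∑ xs f * ∑ ys g
∑∑-product xs ys f g = trans (∑-cong xs (λ x → ∑-*ˡ ys (f x) g)) (∑-*ʳ xs f (∑ ys g))

module SquareCount {n : ℕ} (G : Graph n) (Δ : ℕ) (degree≤Δ : ∀ x → degree G x ≤ Δ) where

  open Density G
  open Squares G

  V : List (Fin n)
  V = allFin n

  E : ℕ
  E = ∑ V (degree G)

  e : Fin n → Fin n → ℕ
  e x y = 𝟙 (does (x ~? y))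

  codegree : Fin n → Fin n → ℕ
  codegree a x = ∑ V (λ b → e b a * e b x)

  closedWalks : ℕ
  closedWalks = ∑ V (λ a → ∑ V (λ x → codegree a x * codegree a x))

  degree² : ℕ
  degree² = ∑ V (λ b → degree G b * degree G b)

  ∑-codegree : ∑ V (λ a → ∑ V (codegree a)) ≡ degree²
  ∑-codegree = begin-equality
    ∑ V (λ a → ∑ V (λ x → ∑ V (λ b → e b a * e b x)))  ≡⟨ ∑-cong V (λ a → ∑-swap V V (λ x b → e b a * e b x)) ⟩
    ∑ V (λ a → ∑ V (λ b → ∑ V (λ x → e b a * e b x)))  ≡⟨ ∑-swap V V (λ a b → ∑ V (λ x → e b a * e b x)) ⟩
    ∑ V (λ b → ∑ V (λ a → ∑ V (λ x → e b a * e b x)))  ≡⟨ ∑-cong V (λ b → ∑∑-product V V (e b) (e b)) ⟩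
    degree² ∎

  -- Cauchy-Schwarz twice, over vertices for the degrees and over ordered pairs for the codegrees:
  -- the Sidorenko inequality for the 4-cycle.
  E⁴≤n⁴closedWalks : (E * E) * (E * E) ≤ (n * n) * ((n * n) * closedWalks)
  E⁴≤n⁴closedWalks = begin
    (E * E) * (E * E)  ≤⟨ *-mono-≤ step₁ step₁ ⟩
    (n * degree²) * (n * degree²)  ≡⟨ rearrange n degree² ⟩
    (n * n) * (degree² * degree²)  ≤⟨ *-monoʳ-≤ (n * n) step₂ ⟩
    (n * n) * ((n * n) * closedWalks)  ∎
    where
    rearrange : ∀ n d → (n * d) * (n * d) ≡ (n * n) * (d * d)
    rearrange = solve-∀
    step₁ : E * E ≤ n * degree²
    step₁ = ≤-trans (∑-cauchy-schwarz V (degree G)) (≤-reflexive (cong (_* degree²) (length-allFin n)))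
    co : Fin n × Fin n → ℕ
    co (a , x) = codegree a x
    step₂ : degree² * degree² ≤ (n * n) * closedWalks
    step₂ = begin
      degree² * degree²  ≡⟨ cong₂ _*_ total total ⟩
      ∑ (pairs n) co * ∑ (pairs n) co  ≤⟨ ∑-cauchy-schwarz (pairs n) co ⟩
      length (pairs n) * ∑ (pairs n) (λ c → co c * co c) ≡⟨ cong₂ _*_ (length-pairs n) (∑-pairs n (λ c → co c * co c)) ⟩
      (n * n) * closedWalks  ∎
      where
      total : degree² ≡ ∑ (pairs n) co
      total = trans (sym ∑-codegree) (sym (∑-pairs n co))

  C : List (Fin n × Fin n)
  C = filter isEdge? (pairs n)

  length-C : length C ≡ E
  length-C = trans (length-filter≡# isEdge? (pairs n)) (∑-pairs n (λ c → 𝟙 (does (isEdge? c))))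

  unique-C : Unique C
  unique-C = Unique.filter⁺ isEdge? (unique-pairs n)

  squares : ℕ
  squares = ∑ C (λ c → # (λ w → square? w c) C)

  δ : Fin n → Fin n → ℕ
  δ x y = 𝟙 (does (x Fin.≟ y))

  ∑δ≤1 : ∀ a → ∑ V (λ x → δ x a) ≤ 1
  ∑δ≤1 a = #-equal≤1 (λ _ → yes tt) a

  ∑δ* : ∀ a k → ∑ V (λ x → δ x a * k) ≤ k
  ∑δ* a k = ≤-trans (≤-reflexive (∑-*ʳ V (λ x → δ x a) k)) (≤-trans (*-monoˡ-≤ k (∑δ≤1 a)) (≤-reflexive (*-identityˡ k)))

  degree²≤ΔE : degree² ≤ E * Δ
  degree²≤ΔE = ≤-trans (∑-mono V (λ b → *-monoʳ-≤ (degree G b) (degree≤Δ b))) (≤-reflexive (∑-*ʳ V (degree G) Δ))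

  sq : Fin n → Fin n → Fin n → Fin n → ℕ
  sq a b x y = 𝟙 (does (square? (a , b) (x , y)))

  -- A closed walk a b x y is a genuine 4-cycle unless two opposite corners coincide.
  walk-cases : ∀ a b x y → (e b a * e b x) * (e y a * e y x) ≤ sq a b x y + (δ x a * (e a b * e a y) + δ y b * (e b a * e b x))
  walk-cases a b x y = begin
    (e b a * e b x) * (e y a * e y x)
      ≡⟨ cong₂ _*_ (𝟙-× (b ~? a) (b ~? x)) (𝟙-× (y ~? a) (y ~? x)) ⟨
    𝟙 (does ((b ~? a) ×-dec (b ~? x))) * 𝟙 (does ((y ~? a) ×-dec (y ~? x)))
      ≡⟨ 𝟙-× ((b ~? a) ×-dec (b ~? x)) ((y ~? a) ×-dec (y ~? x)) ⟨
    𝟙 (does (walk? ))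
      ≤⟨ 𝟙-∪ walk? (square? (a , b) (x , y)) (left? ⊎-dec right?) cases ⟩
    sq a b x y + 𝟙 (does (left? ⊎-dec right?))
      ≤⟨ +-monoʳ-≤ (sq a b x y) (𝟙-∪ (left? ⊎-dec right?) left? right? id) ⟩
    sq a b x y + (𝟙 (does left?) + 𝟙 (does right?))
      ≡⟨ cong₂ (λ l r → sq a b x y + (l + r)) (three (x Fin.≟ a) (a ~? b) (a ~? y)) (three (y Fin.≟ b) (b ~? a) (b ~? x)) ⟩
    sq a b x y + (δ x a * (e a b * e a y) + δ y b * (e b a * e b x)) ∎
    where
    walk? = ((b ~? a) ×-dec (b ~? x)) ×-dec ((y ~? a) ×-dec (y ~? x))
    left? = (x Fin.≟ a) ×-dec ((a ~? b) ×-dec (a ~? y))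
    right? = (y Fin.≟ b) ×-dec ((b ~? a) ×-dec (b ~? x))
    three : {P Q R : Set} (P? : Dec P) (Q? : Dec Q) (R? : Dec R) →
      𝟙 (does (P? ×-dec (Q? ×-dec R?))) ≡ 𝟙 (does P?) * (𝟙 (does Q?) * 𝟙 (does R?))
    three P? Q? R? = trans (𝟙-× P? (Q? ×-dec R?)) (cong (𝟙 (does P?) *_) (𝟙-× Q? R?))
    cases : (b ~ a × b ~ x) × (y ~ a × y ~ x) → Square (a , b) (x , y) ⊎ ((x ≡ a × a ~ b × a ~ y) ⊎ (y ≡ b × b ~ a × b ~ x))
    cases ((ba , bx) , ya , yx) with x Fin.≟ a | y Fin.≟ b
    ... | yes x≡a | _ = inj₂ (inj₁ (x≡a , ~-sym ba , ~-sym ya))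
    ... | no _ | yes y≡b = inj₂ (inj₂ (y≡b , ba , bx))
    ... | no x≢a | no y≢b = inj₁ (~-sym ba , ~-sym yx , bx , ~-sym ya , x≢a ∘ sym , y≢b ∘ sym)

  ∑⁴ : (Fin n → Fin n → Fin n → Fin n → ℕ) → ℕ
  ∑⁴ f = ∑ V (λ a → ∑ V (λ x → ∑ V (λ b → ∑ V (λ y → f a b x y))))

  ∑⁴-+ : ∀ f g → ∑⁴ (λ a b x y → f a b x y + g a b x y) ≡ ∑⁴ f + ∑⁴ g
  ∑⁴-+ f g = trans (∑-cong V (λ a → trans (∑-cong V (λ x → trans (∑-cong V (λ b → ∑-+ V (f a b x) (g a b x)))
      (∑-+ V (λ b → ∑ V (f a b x)) (λ b → ∑ V (g a b x)))))
      (∑-+ V (λ x → ∑ V (λ b → ∑ V (f a b x))) (λ x → ∑ V (λ b → ∑ V (g a b x))))))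
    (∑-+ V (λ a → ∑ V (λ x → ∑ V (λ b → ∑ V (f a b x)))) (λ a → ∑ V (λ x → ∑ V (λ b → ∑ V (g a b x)))))

  closedWalks-∑⁴ : closedWalks ≡ ∑⁴ (λ a b x y → (e b a * e b x) * (e y a * e y x))
  closedWalks-∑⁴ = ∑-cong V (λ a → ∑-cong V (λ x → sym (∑∑-product V V (λ b → e b a * e b x) (λ y → e y a * e y x))))

  ∑⁴-squares : ∑⁴ sq ≤ squares
  ∑⁴-squares = begin
    ∑ V (λ a → ∑ V (λ x → ∑ V (λ b → ∑ V (λ y → sq a b x y))))
      ≡⟨ ∑-cong V (λ a → ∑-swap V V (λ x b → ∑ V (λ y → sq a b x y))) ⟩
    ∑ V (λ a → ∑ V (λ b → ∑ V (λ x → ∑ V (λ y → sq a b x y))))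
      ≡⟨ ∑-cong V (λ a → ∑-cong V (λ b → ∑-pairs n (λ c → 𝟙 (does (square? (a , b) c))))) ⟨
    ∑ V (λ a → ∑ V (λ b → # (square? (a , b)) (pairs n)))
      ≡⟨ ∑-pairs n (λ w → # (square? w) (pairs n)) ⟨
    ∑ (pairs n) (λ w → # (square? w) (pairs n))
      ≤⟨ ∑-mono (pairs n) (λ w → #-filter (square? w) isEdge? (pairs n) (λ _ → proj₁ ∘ proj₂)) ⟩
    ∑ (pairs n) (λ w → # (square? w) C)
      ≡⟨ ∑-swap (pairs n) C (λ w c → 𝟙 (does (square? w c))) ⟩
    ∑ C (λ c → # (λ w → square? w c) (pairs n))
      ≤⟨ ∑-mono C (λ c → #-filter (λ w → square? w c) isEdge? (pairs n) (λ _ → proj₁)) ⟩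
    squares ∎

  degenerateˡ : ∑⁴ (λ a b x y → δ x a * (e a b * e a y)) ≤ E * Δ
  degenerateˡ = ≤-trans (∑-mono V (λ a → ≤-trans (≤-reflexive (∑-cong V (λ x → inner a x))) (∑δ* a (degree G a * degree G a)))) degree²≤ΔE
    where
    inner : ∀ a x → ∑ V (λ b → ∑ V (λ y → δ x a * (e a b * e a y))) ≡ δ x a * (degree G a * degree G a)
    inner a x = trans (∑-cong V (λ b → ∑-*ˡ V (δ x a) (λ y → e a b * e a y)))
      (trans (∑-*ˡ V (δ x a) (λ b → ∑ V (λ y → e a b * e a y))) (cong (δ x a *_) (∑∑-product V V (e a) (e a))))

  degenerateʳ : ∑⁴ (λ a b x y → δ y b * (e b a * e b x)) ≤ E * Δ
  degenerateʳ = ≤-trans (∑-mono V (λ a → ∑-mono V (λ x → ∑-mono V (λ b → ∑δ* b (e b a * e b x)))))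
    (≤-trans (≤-reflexive ∑-codegree) degree²≤ΔE)

  -- Either kind of degenerate walk is counted by the sum of squared degrees, which the degree bound
  -- keeps below EΔ.
  closedWalks≤squares : closedWalks ≤ squares + (E * Δ + E * Δ)
  closedWalks≤squares = begin
    closedWalks
      ≡⟨ closedWalks-∑⁴ ⟩
    ∑⁴ (λ a b x y → (e b a * e b x) * (e y a * e y x))
      ≤⟨ ∑-mono V (λ a → ∑-mono V (λ x → ∑-mono V (λ b → ∑-mono V (λ y → walk-cases a b x y)))) ⟩
    ∑⁴ (λ a b x y → sq a b x y + (δ x a * (e a b * e a y) + δ y b * (e b a * e b x)))
      ≡⟨ trans (∑⁴-+ sq (λ a b x y → δ x a * (e a b * e a y) + δ y b * (e b a * e b x)))
           (cong (∑⁴ sq +_) (∑⁴-+ (λ a b x y → δ x a * (e a b * e a y)) (λ a b x y → δ y b * (e b a * e b x)))) ⟩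
    ∑⁴ sq + (∑⁴ (λ a b x y → δ x a * (e a b * e a y)) + ∑⁴ (λ a b x y → δ y b * (e b a * e b x)))
      ≤⟨ +-mono-≤ ∑⁴-squares (+-mono-≤ degenerateˡ degenerateʳ) ⟩
    squares + (E * Δ + E * Δ) ∎

-- Counting pairs of joined matchings.

-- According to which of `x` and `h` is larger, one term on the right already suffices. Summed over
-- a family whose average is above `h`, this replaces the power mean inequality and avoids division.
power-cut : ∀ t′ x h → h ^ t′ * x ≤ x ^ suc t′ + h ^ suc t′
power-cut t′ x h with ≤-total h x
... | inj₁ h≤x = ≤-trans (≤-reflexive (*-comm (h ^ t′) x)) (≤-trans (*-monoʳ-≤ x (^-monoˡ-≤ t′ h≤x)) (m≤m+n _ _))
... | inj₂ x≤h = ≤-trans (*-monoʳ-≤ (h ^ t′) x≤h) (≤-trans (≤-reflexive (*-comm (h ^ t′) h)) (m≤n+m _ _))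

-- Compares c^(t-1), c and (c ∸ B)^t: above the threshold H the last one dominates, below it everything is at most H^t.
threshold : ∀ t′ {A B H} c → 2 * B ≤ H → A ≤ H →
  A * c ^ t′ + H ^ t′ * c ≤ 2 ^ suc (suc t′) * (c ∸ B) ^ suc t′ + 2 * H ^ suc t′
threshold t′ {A} {B} {H} c B≤H A≤H with ≤-total H c
... | inj₁ H≤c = begin
  A * c ^ t′ + H ^ t′ * c  ≤⟨ +-mono-≤ (*-monoˡ-≤ (c ^ t′) (≤-trans A≤H H≤c)) (*-monoˡ-≤ c (^-monoˡ-≤ t′ H≤c)) ⟩
  c * c ^ t′ + c ^ t′ * c  ≡⟨ cong (c * c ^ t′ +_) (trans (*-comm (c ^ t′) c) (sym (+-identityʳ _))) ⟩
  2 * c ^ suc t′  ≤⟨ *-monoʳ-≤ 2 (^-halve {c} {c ∸ B} (suc t′) (halve-∸ {c} {B} (≤-trans B≤H H≤c))) ⟩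
  2 * (2 ^ suc t′ * (c ∸ B) ^ suc t′)  ≡⟨ *-assoc 2 (2 ^ suc t′) _ ⟨
  2 ^ suc (suc t′) * (c ∸ B) ^ suc t′  ≤⟨ m≤m+n _ _ ⟩
  2 ^ suc (suc t′) * (c ∸ B) ^ suc t′ + 2 * H ^ suc t′  ∎
... | inj₂ c≤H = begin
  A * c ^ t′ + H ^ t′ * c  ≤⟨ +-mono-≤ (*-mono-≤ A≤H (^-monoˡ-≤ t′ c≤H)) (*-monoʳ-≤ (H ^ t′) c≤H) ⟩
  H * H ^ t′ + H ^ t′ * H  ≡⟨ cong (H * H ^ t′ +_) (trans (*-comm (H ^ t′) H) (sym (+-identityʳ _))) ⟩
  2 * H ^ suc t′  ≤⟨ m≤n+m (2 * H ^ suc t′) (2 ^ suc (suc t′) * (c ∸ B) ^ suc t′) ⟩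
  2 ^ suc (suc t′) * (c ∸ B) ^ suc t′ + 2 * H ^ suc t′  ∎

module CubeCount {n : ℕ} (G : Graph n) (t′ Δ : ℕ) (bounded : BoundedCodegree G (suc t′))
  (degree≤Δ : ∀ x → degree G x ≤ Δ) where

  open Density G
  open Growth G (suc t′)
  open Crowding G (suc t′) bounded
  open Squares G
  open SquareCount G Δ degree≤Δ
  open Cubes G t′ bounded

  apartTuple? : ∀ (W : Cells t) → Dec (Apart (toList W))
  apartTuple? W = apart? (toList W)

  matchings : List (Cells t)
  matchings = filter apartTuple? (tuples C t)

  common : Cells t → ℕ
  common W = # (joined? W) C

  tuplePairs : List Tuple
  tuplePairs = cartesianProduct (tuples C t) (tuples C t)

  cubes : List Tuple
  cubes = filter cube? tuplePairs

  unique-cubes : Unique cubes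
  unique-cubes = Unique.filter⁺ cube? (Unique.cartesianProduct⁺ (unique-tuples unique-C t) (unique-tuples unique-C t))

  -- The greedy loss for a second matching: each of its at most t earlier cells has two vertices,
  -- and each vertex spoils `2 * bound t` cells.
  B : ℕ
  B = t * (2 * bound t + 2 * bound t)

  cubes≥ : ∑ matchings (λ W → (common W ∸ B) ^ t) ≤ length cubes
  cubes≥ = begin
    ∑ matchings (λ W → (common W ∸ B) ^ t)
      ≡⟨ ∑-filter apartTuple? (tuples C t) (λ W → (common W ∸ B) ^ t) ⟩
    ∑ (tuples C t) (λ W → 𝟙 (does (apartTuple? W)) * (common W ∸ B) ^ t)
      ≤⟨ ∑-mono∈ (tuples C t) (λ W W∈ → 𝟙-*-≤ (apartTuple? W) (completions W W∈)) ⟩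
    ∑ (tuples C t) (λ W → ∑ (tuples C t) (λ W′ → 𝟙 (does (cube? (W , W′)))))
      ≡⟨ ∑-product _,_ (tuples C t) (tuples C t) (λ ω → 𝟙 (does (cube? ω))) ⟨
    # cube? tuplePairs
      ≡⟨ length-filter≡# cube? tuplePairs ⟨
    length cubes ∎
    where
    completions : ∀ W → W ∈ tuples C t → Apart (toList W) →
      (common W ∸ B) ^ t ≤ # (λ W′ → cube? (W , W′)) (tuples C t)
    completions W W∈ ap = ≤-trans
      (many-matchings C (joined? W) conflict? (2 * bound t + 2 * bound t) few t B ≤-refl)
      (#-mono (matching? C (joined? W) conflict?) (λ W′ → cube? (W , W′)) (tuples C t) (λ W′ (joined , ap′) → ap , ap′ , joined))
      where
      edges-W = All.map (λ c∈ → proj₂ (∈-filter⁻ isEdge? {xs = pairs n} c∈)) (∈-tuples⁻ C W W∈)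
      s = tupleState W ap edges-W
      touching : ∀ z → # (λ c → joined? W c ×-dec touches? c z) C ≤ 2 * bound t
      touching z = #-touching s z (joined? W) C unique-C (λ c joined → joined⇒fresh W ap edges-W joined)
      few : ∀ d → # (λ c → joined? W c ×-dec conflict? c d) C ≤ 2 * bound t + 2 * bound t
      few d = ≤-trans (#-∪ (λ c → joined? W c ×-dec conflict? c d) (λ c → joined? W c ×-dec touches? c (proj₁ d))
          (λ c → joined? W c ×-dec touches? c (proj₂ d)) C
          (λ { c (j , inj₁ e) → inj₁ (j , e) ; c (j , inj₂ e) → inj₂ (j , e) }))
        (+-mono-≤ (touching (proj₁ d)) (touching (proj₂ d)))

  value? : ∀ (v : Cells t × Cells t′) → Dec (Apart (toList (proj₁ v)) × All (Joined (proj₁ v)) (toList (proj₂ v)))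
  value? (W , v) = apartTuple? W ×-dec All.all? (joined? W) (toList v)

  valuePairs : List (Cells t × Cells t′)
  valuePairs = cartesianProduct (tuples C t) (tuples C t′)

  values : List (Index × (Cells t × Cells t′))
  values = cartesianProduct indices (filter value? valuePairs)

  length-values : length values ≡ 2 * t * ∑ matchings (λ W → common W ^ t′)
  length-values = trans (length-product _,_ indices (filter value? valuePairs))
    (cong₂ _*_ (trans (length-product _,_ (false ∷ true ∷ []) (allFin t)) (cong (2 *_) (length-allFin t))) (begin-equality
      length (filter value? valuePairs)
        ≡⟨ length-filter≡# value? valuePairs ⟩
      # value? valuePairs
        ≡⟨ ∑-product _,_ (tuples C t) (tuples C t′) (λ v → 𝟙 (does (value? v))) ⟩
      ∑ (tuples C t) (λ W → ∑ (tuples C t′) (λ v → 𝟙 (does (value? (W , v)))))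
        ≡⟨ ∑-cong (tuples C t) (λ W → trans (∑-cong (tuples C t′) (λ v → 𝟙-× (apartTuple? W) (All.all? (joined? W) (toList v))))
             (trans (∑-*ˡ (tuples C t′) (𝟙 (does (apartTuple? W))) (λ v → 𝟙 (does (All.all? (joined? W) (toList v)))))
               (cong (𝟙 (does (apartTuple? W)) *_) (#-all-tuples C (joined? W) t′)))) ⟩
      ∑ (tuples C t) (λ W → 𝟙 (does (apartTuple? W)) * common W ^ t′)
        ≡⟨ ∑-filter apartTuple? (tuples C t) (λ W → common W ^ t′) ⟨
      ∑ matchings (λ W → common W ^ t′) ∎))

  forget∈values : ∀ {i ω} → i ∈ indices → ω ∈ cubes → (i , forget i ω) ∈ values
  forget∈values {i} {ω} i∈ ω∈ = ∈-cartesianProduct⁺ i∈ (∈-filter⁺ value?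
      (∈-cartesianProduct⁺ (proj₁ tup) (∈-tuples⁺ C (removeAt W′ (proj₂ i)) (shrink (∈-tuples⁻ C W′ (proj₂ tup)))))
      (proj₁ cube , shrink (proj₂ (proj₂ cube))))
    where
    W′ = proj₂ (act (proj₁ i) ω)
    split = ∈-filter⁻ cube? {xs = tuplePairs} ω∈
    cube : Cube (act (proj₁ i) ω)
    cube = act-cube (proj₁ i) (proj₂ split)
    act-tuples : ∀ b → proj₁ ω ∈ tuples C t × proj₂ ω ∈ tuples C t → proj₁ (act b ω) ∈ tuples C t × proj₂ (act b ω) ∈ tuples C t
    act-tuples false p = p
    act-tuples true (p , q) = q , p
    tup = act-tuples (proj₁ i) (∈-cartesianProduct⁻ (tuples C t) (tuples C t) (proj₁ split))
    shrink : {P : Cell → Set} → All P (toList W′) → All P (toList (removeAt W′ (proj₂ i)))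
    shrink ps = All.tabulate (λ c∈ → All.lookup ps (removeAt-⊆ W′ (proj₂ i) c∈))

  -- Regroups the pairs around the single edge `c`, so that a matching can be chosen greedily among
  -- the edges forming squares with `c`.
  ∑-common : ∑ matchings common ≡ ∑ C (λ c → # (matching? C (λ w → square? w c) conflict?) (tuples C t))
  ∑-common = begin-equality
    ∑ matchings common
      ≡⟨ ∑-filter apartTuple? (tuples C t) common ⟩
    ∑ (tuples C t) (λ W → 𝟙 (does (apartTuple? W)) * common W)
      ≡⟨ ∑-cong (tuples C t) (λ W → ∑-*ˡ C (𝟙 (does (apartTuple? W))) (λ c → 𝟙 (does (joined? W c)))) ⟨
    ∑ (tuples C t) (λ W → ∑ C (λ c → 𝟙 (does (apartTuple? W)) * 𝟙 (does (joined? W c))))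
      ≡⟨ ∑-swap (tuples C t) C (λ W c → 𝟙 (does (apartTuple? W)) * 𝟙 (does (joined? W c))) ⟩
    ∑ C (λ c → ∑ (tuples C t) (λ W → 𝟙 (does (apartTuple? W)) * 𝟙 (does (joined? W c))))
      ≡⟨ ∑-cong C (λ c → ∑-cong (tuples C t) (λ W → trans (*-comm (𝟙 (does (apartTuple? W))) _) (sym (𝟙-× (joined? W c) (apartTuple? W))))) ⟩
    ∑ C (λ c → # (matching? C (λ w → square? w c) conflict?) (tuples C t)) ∎

  -- Either end of `d` may be either end of `w`, and the remaining end of `w` is then one of at most
  -- Δ neighbours. Unlike in the second matching, codegrees are of no help: only a single edge is
  -- fixed.
  square-conflicts : ∀ c d → # (λ w → square? w c ×-dec conflict? w d) C ≤ 4 * Δ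
  square-conflicts c@(x , y) d = begin
    # (λ w → square? w c ×-dec conflict? w d) C
      ≤⟨ #-∪ (λ w → square? w c ×-dec conflict? w d) (λ w → square? w c ×-dec touches? w (proj₁ d))
           (λ w → square? w c ×-dec touches? w (proj₂ d)) C
           (λ { w (s , inj₁ e) → inj₁ (s , e) ; w (s , inj₂ e) → inj₂ (s , e) }) ⟩
    # (λ w → square? w c ×-dec touches? w (proj₁ d)) C + # (λ w → square? w c ×-dec touches? w (proj₂ d)) C
      ≤⟨ +-mono-≤ (touching (proj₁ d)) (touching (proj₂ d)) ⟩
    (Δ + Δ) + (Δ + Δ)
      ≡⟨ lemma Δ ⟩
    4 * Δ ∎
    where
    lemma : ∀ Δ → (Δ + Δ) + (Δ + Δ) ≡ 4 * Δ
    lemma = solve-∀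
    at : ∀ z (f g : Cell → Fin n) → (∀ {c d} → f c ≡ f d → g c ≡ g d → c ≡ d) → (∀ {w} → IsEdge w → f w ~ g w) →
      # (λ w → square? w c ×-dec (z Fin.≟ f w)) C ≤ Δ
    at z f g inj edge = begin
      # Q? C  ≡⟨ length-filter≡# Q? C ⟨
      length (filter Q? C)  ≡⟨ List.length-map g (filter Q? C) ⟨
      length (map g (filter Q? C))
        ≤⟨ unique-length≤# (z ~?_) (unique-cofibre f g inj (Unique.filter⁺ Q? unique-C) (All.map proj₂ (All.all-filter Q? C)))
             (λ _ → ∈-allFin _) (All.map⁺ (All.map (λ { (s , refl) → edge (proj₁ s) }) (All.all-filter Q? C))) ⟩
      degree G z  ≤⟨ degree≤Δ z ⟩
      Δ  ∎
      where
      Q? = λ w → square? w c ×-dec (z Fin.≟ f w)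
    touching : ∀ z → # (λ w → square? w c ×-dec touches? w z) C ≤ Δ + Δ
    touching z = ≤-trans (#-∪ (λ w → square? w c ×-dec touches? w z) (λ w → square? w c ×-dec (z Fin.≟ proj₁ w))
        (λ w → square? w c ×-dec (z Fin.≟ proj₂ w)) C
        (λ { w (s , inj₁ e) → inj₁ (s , e) ; w (s , inj₂ e) → inj₂ (s , e) }))
      (+-mono-≤ (at z proj₁ proj₂ (λ p q → cong₂ _,_ p q) id) (at z proj₂ proj₁ (λ p q → cong₂ _,_ q p) ~-sym))

  -- On average an edge begins with (4t+4)Δ closed walks. Degenerate walks take away 2Δ and the
  -- greedy choice 4tΔ, so 2Δ remain; `power-cut` with h = Δ spends Δ^t per edge and leaves Δ^t.
  many-common : 1 ≤ n → (n * n) * ((n * n) * (E * ((4 * t + 4) * Δ))) ≤ (E * E) * (E * E) → Δ ^ t * E ≤ ∑ matchings common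
  many-common 1≤n dense = +-cancelʳ-≤ (E * Δ ^ t) _ _ (begin
    Δ ^ t * E + E * Δ ^ t
      ≡⟨ lemma₁ (Δ ^ t′) Δ E ⟩
    Δ ^ t′ * (E * (2 * Δ))
      ≤⟨ *-monoʳ-≤ (Δ ^ t′) surplus ⟩
    Δ ^ t′ * ∑ C (λ c → g c ∸ t * (4 * Δ))
      ≡⟨ ∑-*ˡ C (Δ ^ t′) (λ c → g c ∸ t * (4 * Δ)) ⟨
    ∑ C (λ c → Δ ^ t′ * (g c ∸ t * (4 * Δ)))
      ≤⟨ ∑-mono C (λ c → power-cut t′ (g c ∸ t * (4 * Δ)) Δ) ⟩
    ∑ C (λ c → (g c ∸ t * (4 * Δ)) ^ t + Δ ^ t)
      ≡⟨ trans (∑-+ C (λ c → (g c ∸ t * (4 * Δ)) ^ t) (λ _ → Δ ^ t)) (cong (∑ C (λ c → (g c ∸ t * (4 * Δ)) ^ t) +_) (trans (∑-const C (Δ ^ t)) (cong (_* Δ ^ t) length-C))) ⟩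
    ∑ C (λ c → (g c ∸ t * (4 * Δ)) ^ t) + E * Δ ^ t
      ≤⟨ +-monoˡ-≤ (E * Δ ^ t) (∑-mono C (λ c → many-matchings C (λ w → square? w c) conflict? (4 * Δ) (square-conflicts c) t (t * (4 * Δ)) ≤-refl)) ⟩
    ∑ C (λ c → # (matching? C (λ w → square? w c) conflict?) (tuples C t)) + E * Δ ^ t
      ≡⟨ cong (_+ E * Δ ^ t) ∑-common ⟨
    ∑ matchings common + E * Δ ^ t ∎)
    where
    g : Cell → ℕ
    g c = # (λ w → square? w c) C
    lemma₁ : ∀ p d e → d * p * e + e * (d * p) ≡ p * (e * (2 * d))
    lemma₁ = solve-∀
    instance
      n≢0 : NonZero (n * n)
      n≢0 = >-nonZero (*-mono-≤ 1≤n 1≤n)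
    walks : E * ((4 * t + 4) * Δ) ≤ closedWalks
    walks = *-cancelˡ-≤ (n * n) (*-cancelˡ-≤ (n * n) (≤-trans dense E⁴≤n⁴closedWalks))
    surplus : E * (2 * Δ) ≤ ∑ C (λ c → g c ∸ t * (4 * Δ))
    surplus = +-cancelʳ-≤ (E * (t * (4 * Δ)) + (E * Δ + E * Δ)) _ _ (begin
      E * (2 * Δ) + (E * (t * (4 * Δ)) + (E * Δ + E * Δ))  ≡⟨ lemma₂ E Δ t ⟩
      E * ((4 * t + 4) * Δ)  ≤⟨ walks ⟩
      closedWalks  ≤⟨ closedWalks≤squares ⟩
      ∑ C g + (E * Δ + E * Δ)  ≤⟨ +-monoˡ-≤ (E * Δ + E * Δ) (∑-mono C (λ c → m≤n+m∸n (g c) (t * (4 * Δ)))) ⟩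
      ∑ C (λ c → t * (4 * Δ) + (g c ∸ t * (4 * Δ))) + (E * Δ + E * Δ)
        ≡⟨ cong (_+ (E * Δ + E * Δ)) (trans (∑-+ C (λ _ → t * (4 * Δ)) (λ c → g c ∸ t * (4 * Δ)))
             (cong (_+ ∑ C (λ c → g c ∸ t * (4 * Δ))) (trans (∑-const C (t * (4 * Δ))) (cong (_* (t * (4 * Δ))) length-C)))) ⟩
      E * (t * (4 * Δ)) + ∑ C (λ c → g c ∸ t * (4 * Δ)) + (E * Δ + E * Δ)
        ≡⟨ lemma₃ (E * (t * (4 * Δ))) (∑ C (λ c → g c ∸ t * (4 * Δ))) (E * Δ + E * Δ) ⟩
      ∑ C (λ c → g c ∸ t * (4 * Δ)) + (E * (t * (4 * Δ)) + (E * Δ + E * Δ)) ∎)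
      where
      lemma₂ : ∀ e d t → e * (2 * d) + (e * (t * (4 * d)) + (e * d + e * d)) ≡ e * ((4 * t + 4) * d)
      lemma₂ = solve-∀
      lemma₃ : ∀ a b c → a + b + c ≡ b + (a + c)
      lemma₃ = solve-∀

  -- There are at most E^t matchings, so `large` makes the average of `common` exceed 2H. Summing
  -- `threshold` over all matchings, this excess pays for the error 2H^t, and the term with
  -- coefficient `A` is κ times the number of values, up to the factor 2^(t+1) that is cancelled.
  many-cubes : ∀ κ H → 2 * B ≤ H → 2 ^ suc t * (2 * t * κ) ≤ H → 1 ≤ H → 2 * H * E ^ t < ∑ matchings common →
    κ * length values < length cubes
  many-cubes κ H B≤H A≤H 1≤H large = *-cancelˡ-< (2 ^ suc t) _ _ (+-cancelʳ-< (2 * H ^ t * length matchings) _ _ (begin-strict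
    2 ^ suc t * (κ * length values) + 2 * H ^ t * length matchings
      ≡⟨ cong (λ l → 2 ^ suc t * (κ * l) + 2 * H ^ t * length matchings) length-values ⟩
    2 ^ suc t * (κ * (2 * t * S)) + 2 * H ^ t * length matchings
      ≡⟨ lemma₁ (2 ^ suc t) κ (2 * t) S (H ^ t′) H (length matchings) ⟩
    A * S + H ^ t′ * (2 * H * length matchings)
      ≤⟨ +-monoʳ-≤ (A * S) (*-monoʳ-≤ (H ^ t′) (*-monoʳ-≤ (2 * H) few)) ⟩
    A * S + H ^ t′ * (2 * H * E ^ t)
      <⟨ +-monoʳ-< (A * S) (*-monoʳ-< (H ^ t′) {{m^n≢0 H t′ {{>-nonZero 1≤H}}}} large) ⟩
    A * S + H ^ t′ * ∑ matchings common
      ≡⟨ cong₂ _+_ (∑-*ˡ matchings A (λ W → common W ^ t′)) (∑-*ˡ matchings (H ^ t′) common) ⟨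
    ∑ matchings (λ W → A * common W ^ t′) + ∑ matchings (λ W → H ^ t′ * common W)
      ≡⟨ ∑-+ matchings (λ W → A * common W ^ t′) (λ W → H ^ t′ * common W) ⟨
    ∑ matchings (λ W → A * common W ^ t′ + H ^ t′ * common W)
      ≤⟨ ∑-mono matchings (λ W → threshold t′ {A} {B} {H} (common W) B≤H A≤H) ⟩
    ∑ matchings (λ W → 2 ^ suc t * (common W ∸ B) ^ t + 2 * H ^ t)
      ≡⟨ trans (∑-+ matchings (λ W → 2 ^ suc t * (common W ∸ B) ^ t) (λ _ → 2 * H ^ t))
           (cong₂ _+_ (∑-*ˡ matchings (2 ^ suc t) (λ W → (common W ∸ B) ^ t)) (trans (∑-const matchings (2 * H ^ t)) (*-comm (length matchings) _))) ⟩
    2 ^ suc t * ∑ matchings (λ W → (common W ∸ B) ^ t) + 2 * H ^ t * length matchings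
      ≤⟨ +-monoˡ-≤ (2 * H ^ t * length matchings) (*-monoʳ-≤ (2 ^ suc t) cubes≥) ⟩
    2 ^ suc t * length cubes + 2 * H ^ t * length matchings ∎))
    where
    A = 2 ^ suc t * (2 * t * κ)
    S = ∑ matchings (λ W → common W ^ t′)
    few : length matchings ≤ E ^ t
    few = ≤-trans (List.length-filter apartTuple? (tuples C t)) (≤-reflexive (trans (length-tuples C t) (cong (_^ t) length-C)))
    lemma₁ : ∀ p κ u S h H l → p * (κ * (u * S)) + 2 * (H * h) * l ≡ p * (u * κ) * S + h * (2 * H * l)
    lemma₁ = solve-∀

-- Growth parameters and constants.

record Parameters (r t n γ k m₀ κ : ℕ) : Set where
  field
    nodes    : 2 * t * (2 * t + 2) * γ + (2 * t + k * (4 * t)) ≤ m₀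
    fibres   : m₀ * (2 * bound t) < κ
    short    : 3 * k ≤ r + 2
    deep     : n < γ ^ k

hexagons⇒target : ∀ {r n γ k m₀ κ} (G : Graph n) → BoundedCodegree G 1 → Parameters r 1 n γ k m₀ κ →
  (∀ (b : BoundedCodegree G 1) → n * n * (Hexagons.collisions G b + 4 * κ) < ∑ (pairs n) (Hexagons.paths G b)) → Target G r 1
hexagons⇒target {r} {n} {γ} {k} {m₀} {κ} G bounded params many =
  Search.target G 1 r m₀ γ k (s≤s z≤n) Good (expand m₀ fibres) (proj₁ startState) (proj₂ startState) nodes short deep
  where
  open Parameters params
  open Hexagons G bounded
  open Cleaning (Product.≡-dec _≟ᶜ_ _≟ᶜ_) (Product.≡-dec Bool._≟_ Bool._≟_) forget symmetries κ using (clean)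
  open Resampling κ hexagons
    (λ ω∈ → proj₂ (∈-filter⁻ hexagon? {xs = triples} ω∈))
    (clean hexagons values unique-hexagons forget∈values (many-hexagons κ (many bounded)))

cubes⇒target : ∀ {r t′ n γ k m₀ κ} (G : Graph n) (Δ : ℕ) (bounded : BoundedCodegree G (suc t′)) (degree≤Δ : ∀ x → degree G x ≤ Δ) →
  Parameters r (suc t′) n γ k m₀ κ →
  κ * length (CubeCount.values G t′ Δ bounded degree≤Δ) < length (CubeCount.cubes G t′ Δ bounded degree≤Δ) → Target G r (suc t′)
cubes⇒target {r} {t′} {n} {γ} {k} {m₀} {κ} G Δ bounded degree≤Δ params many =
  Search.target G (suc t′) r m₀ γ k (s≤s z≤n) Good (expand m₀ fibres) (proj₁ startState) (proj₂ startState) nodes short deep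
  where
  open Parameters params
  open SquareCount G Δ degree≤Δ using (C)
  open Cubes G t′ bounded
  open CubeCount G t′ Δ bounded degree≤Δ
  open Cleaning _≟ᵛ_ _≟ⁱ_ forget indices κ using (clean)
  open Resampling κ cubes
    (λ ω∈ → proj₂ (∈-filter⁻ cube? {xs = tuplePairs} ω∈))
    (clean cubes values unique-cubes forget∈values many)

/-upper : ∀ a b .{{_ : NonZero b}} → a < suc (a / b) * b
/-upper a b = begin-strict
  a  ≡⟨ m≡m%n+[m/n]*n a b ⟩
  a % b + a / b * b  <⟨ +-monoˡ-< (a / b * b) (m%n<n a b) ⟩
  b + a / b * b  ∎

2*[1+m]≤ : ∀ {m} → 1 ≤ m → suc m ≤ 2 * m
2*[1+m]≤ {m} 1≤m = ≤-trans (+-monoˡ-≤ m 1≤m) (≤-reflexive (cong (m +_) (sym (+-identityʳ m))))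

m≤m^k : ∀ m {k} → 1 ≤ k → m ≤ m ^ k
m≤m^k zero _ = z≤n
m≤m^k m@(suc _) {suc k} _ = ≤-trans (≤-reflexive (sym (*-identityʳ m))) (*-monoʳ-≤ m (m^n>0 m k))

-- The hypothesis encodes E ≥ β n^(p/q), and the conclusion follows for every exponent b/a ≤ p/q;
-- the roots are taken by comparing q-th powers.
rescale : ∀ {β n E} p q a b → 1 ≤ n → 1 ≤ q → b * q ≤ p * a → β ^ q * n ^ p ≤ E ^ q → β ^ a * n ^ b ≤ E ^ a
rescale {β} {n} {E} p q a b 1≤n 1≤q bq≤pa h = ^-cancel-≤ q 1≤q (begin
  (β ^ a * n ^ b) ^ q  ≡⟨ *-^-distrib (β ^ a) (n ^ b) q ⟩
  (β ^ a) ^ q * (n ^ b) ^ q  ≡⟨ cong₂ _*_ (flip-^ β a q) (^-*-assoc n b q) ⟩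
  (β ^ q) ^ a * n ^ (b * q)  ≤⟨ *-monoʳ-≤ ((β ^ q) ^ a) (^-monoʳ-≤ n {{>-nonZero 1≤n}} bq≤pa) ⟩
  (β ^ q) ^ a * n ^ (p * a)  ≡⟨ cong ((β ^ q) ^ a *_) (^-*-assoc n p a) ⟨
  (β ^ q) ^ a * (n ^ p) ^ a  ≡⟨ *-^-distrib (β ^ q) (n ^ p) a ⟨
  (β ^ q * n ^ p) ^ a  ≤⟨ ^-monoˡ-≤ a h ⟩
  (E ^ q) ^ a  ≡⟨ flip-^ E q a ⟩
  (E ^ a) ^ q  ∎)
  where
  flip-^ : ∀ x a q → (x ^ a) ^ q ≡ (x ^ q) ^ a
  flip-^ x a q = trans (^-*-assoc x a q) (trans (cong (x ^_) (*-comm a q)) (sym (^-*-assoc x q a)))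

-- r/3 rounded up.
depth : ℕ → ℕ
depth r = (r + 2) / 3

3*depth≤ : ∀ r → 3 * depth r ≤ r + 2
3*depth≤ r = ≤-trans (≤-reflexive (*-comm 3 (depth r))) (m/n*n≤m (r + 2) 3)

≤3*depth : ∀ r → r ≤ 3 * depth r
≤3*depth r = +-cancelʳ-≤ 3 r (3 * depth r) (begin
  r + 3  ≡⟨ +-suc r 2 ⟩
  suc (r + 2)  ≤⟨ /-upper (r + 2) 3 ⟩
  suc (depth r) * 3  ≡⟨ lemma (depth r) ⟩
  3 * depth r + 3  ∎)
  where
  lemma : ∀ k → suc k * 3 ≡ 3 * k + 3
  lemma = solve-∀

-- The capacity required for blocked vertices and one history, with γ factored out; the history term
-- may be multiplied by γ because γ ≥ 1.
nodeFactor : ℕ → ℕ → ℕ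
nodeFactor r t = 2 * t * (2 * t + 2) + (2 * t + depth r * (4 * t))

fibreFactor : ℕ → ℕ → ℕ
fibreFactor r t = nodeFactor r t * (2 * bound t) + 1

module Scale (r t n β c E : ℕ) (1≤r : 1 ≤ r) (1≤t : 1 ≤ t) (1≤n : 1 ≤ n) (1≤c : 1 ≤ c) (2c≤β : 2 * c ≤ β)
  (dense : β ^ (r * (2 * t + 1)) * n ^ (4 * t * r + 2 * t + 1) ≤ E ^ (r * (2 * t + 1))) where

  q : ℕ
  q = 2 * t + 1

  1≤q : 1 ≤ q
  1≤q = m≤n+m 1 (2 * t)

  c≤β : c ≤ β
  c≤β = ≤-trans (m≤m+n c (c + 0)) 2c≤β

  1≤β : 1 ≤ β
  1≤β = ≤-trans 1≤c c≤β

  powers : β ^ q * n ^ (4 * t) ≤ E ^ q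
  powers = rescale (4 * t * r + 2 * t + 1) (r * q) q (4 * t) 1≤n (*-mono-≤ 1≤r 1≤q)
    (≤-trans (≤-reflexive (lemma r t)) (*-monoˡ-≤ q (≤-trans (m≤m+n (4 * t * r) (2 * t)) (m≤m+n _ 1)))) dense
    where
    lemma : ∀ r t → 4 * t * (r * (2 * t + 1)) ≡ 4 * t * r * (2 * t + 1)
    lemma = solve-∀

  instance
    d≢0 : NonZero (c * n ^ (4 * t))
    d≢0 = >-nonZero (*-mono-≤ 1≤c (m^n>0 n {{>-nonZero 1≤n}} (4 * t)))

  -- The constant `c` collects what the template counts lose. Rounding down costs at most a further
  -- factor 2, which is why β is at least 2c.
  γ : ℕ
  γ = E ^ q / (c * n ^ (4 * t))

  γ-lower : γ * (c * n ^ (4 * t)) ≤ E ^ q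
  γ-lower = m/n*n≤m (E ^ q) (c * n ^ (4 * t))

  1≤γ : 1 ≤ γ
  1≤γ = ≤-pred (*-cancelʳ-< (c * n ^ (4 * t)) 1 (suc γ) (begin-strict
    1 * (c * n ^ (4 * t))  ≡⟨ *-identityˡ _ ⟩
    c * n ^ (4 * t)  ≤⟨ *-monoˡ-≤ (n ^ (4 * t)) (≤-trans c≤β (m≤m^k β 1≤q)) ⟩
    β ^ q * n ^ (4 * t)  ≤⟨ powers ⟩
    E ^ q  <⟨ /-upper (E ^ q) (c * n ^ (4 * t)) ⟩
    suc γ * (c * n ^ (4 * t))  ∎))

  n^q<γ^r : n ^ q < γ ^ r
  n^q<γ^r = *-cancelˡ-< ((2 * c) ^ r * n ^ (4 * t * r)) (n ^ q) (γ ^ r) (begin-strict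
    (2 * c) ^ r * n ^ (4 * t * r) * n ^ q  ≡⟨ *-assoc ((2 * c) ^ r) _ _ ⟩
    (2 * c) ^ r * (n ^ (4 * t * r) * n ^ q)  ≡⟨ cong ((2 * c) ^ r *_) (trans (sym (^-distribˡ-+-* n (4 * t * r) q)) (cong (n ^_) (sym (+-assoc (4 * t * r) (2 * t) 1)))) ⟩
    (2 * c) ^ r * n ^ (4 * t * r + 2 * t + 1)  ≤⟨ *-monoˡ-≤ _ (≤-trans (^-monoˡ-≤ r 2c≤β) (^-monoʳ-≤ β {{>-nonZero 1≤β}} (m≤m*n r q {{>-nonZero 1≤q}}))) ⟩
    β ^ (r * q) * n ^ (4 * t * r + 2 * t + 1)  ≤⟨ dense ⟩
    E ^ (r * q)  ≡⟨ trans (cong (E ^_) (*-comm r q)) (sym (^-*-assoc E q r)) ⟩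
    (E ^ q) ^ r  <⟨ ^-monoˡ-< r {{>-nonZero 1≤r}} (/-upper (E ^ q) (c * n ^ (4 * t))) ⟩
    (suc γ * (c * n ^ (4 * t))) ^ r  ≤⟨ ^-monoˡ-≤ r (*-monoˡ-≤ (c * n ^ (4 * t)) (2*[1+m]≤ 1≤γ)) ⟩
    (2 * γ * (c * n ^ (4 * t))) ^ r  ≡⟨ cong (_^ r) (lemma γ c (n ^ (4 * t))) ⟩
    (2 * c * n ^ (4 * t) * γ) ^ r  ≡⟨ *-^-distrib (2 * c * n ^ (4 * t)) γ r ⟩
    (2 * c * n ^ (4 * t)) ^ r * γ ^ r  ≡⟨ cong (_* γ ^ r) (trans (*-^-distrib (2 * c) (n ^ (4 * t)) r) (cong ((2 * c) ^ r *_) (^-*-assoc n (4 * t) r))) ⟩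
    (2 * c) ^ r * n ^ (4 * t * r) * γ ^ r  ∎)
    where
    lemma : ∀ γ c p → 2 * γ * (c * p) ≡ 2 * c * p * γ
    lemma = solve-∀

  -- Otherwise n^(2t+1) < γ^r ≤ γ^(3k) ≤ n³ with k = `depth r`, against 2t+1 ≥ 3.
  n<γ^k : n < γ ^ depth r
  n<γ^k = ≰⇒> (λ γᵏ≤n → contradiction (begin-strict
    n ^ q  <⟨ n^q<γ^r ⟩
    γ ^ r  ≤⟨ ^-monoʳ-≤ γ {{>-nonZero 1≤γ}} (≤3*depth r) ⟩
    γ ^ (3 * depth r)  ≡⟨ trans (cong (γ ^_) (*-comm 3 (depth r))) (sym (^-*-assoc γ (depth r) 3)) ⟩
    (γ ^ depth r) ^ 3  ≤⟨ ^-monoˡ-≤ 3 γᵏ≤n ⟩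
    n ^ 3  ≤⟨ ^-monoʳ-≤ n {{>-nonZero 1≤n}} (+-monoˡ-≤ 1 (*-monoʳ-≤ 2 1≤t)) ⟩
    n ^ q  ∎) (<-irrefl refl))

  parameters : Parameters r t n γ (depth r) (nodeFactor r t * γ) (fibreFactor r t * γ)
  parameters = record
    { nodes = ≤-trans (+-monoʳ-≤ (2 * t * (2 * t + 2) * γ) (m≤m*n (2 * t + depth r * (4 * t)) γ {{>-nonZero 1≤γ}}))
                (≤-reflexive (sym (*-distribʳ-+ γ (2 * t * (2 * t + 2)) (2 * t + depth r * (4 * t)))))
    ; fibres = begin-strict
        nodeFactor r t * γ * (2 * bound t)  <⟨ m<m+n (nodeFactor r t * γ * (2 * bound t)) 1≤γ ⟩
        nodeFactor r t * γ * (2 * bound t) + γ  ≡⟨ lemma (nodeFactor r t) γ (2 * bound t) ⟩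
        fibreFactor r t * γ  ∎
    ; short = 3*depth≤ r
    ; deep = n<γ^k }
    where
    lemma : ∀ c γ b → c * γ * b + γ ≡ (c * b + 1) * γ
    lemma = solve-∀

2*edges≤n² : ∀ {n} (G : Graph n) → 2 * edges G ≤ n * n
2*edges≤n² {n} G = begin
  2 * edges G  ≡⟨ ∑-degree G ⟨
  ∑ (allFin n) (degree G)  ≤⟨ ∑≤length* (allFin n) (λ x _ → ∑≤length* (allFin n) (λ y _ → 𝟙≤1 (does (x ~? y)))) ⟩
  length (allFin n) * (length (allFin n) * 1)  ≡⟨ cong₂ _*_ (length-allFin n) (trans (*-identityʳ _) (length-allFin n)) ⟩
  n * n  ∎
  where
  open Density G
  𝟙≤1 : ∀ b → 𝟙 b ≤ 1
  𝟙≤1 true = ≤-refl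
  𝟙≤1 false = z≤n

-- For r = 1 the required number of edges exceeds n².
2≤r : ∀ {r t n β e} → 1 ≤ r → 1 ≤ t → 1 ≤ n → 2 ≤ β → e ≤ n * n →
  β ^ (r * (2 * t + 1)) * n ^ (4 * t * r + 2 * t + 1) ≤ e ^ (r * (2 * t + 1)) → 2 ≤ r
2≤r {suc (suc r)} _ _ _ _ _ _ = s≤s (s≤s z≤n)
2≤r {suc zero} {t} {n} {β} {e} _ 1≤t 1≤n 2≤β e≤ dense = contradiction (begin-strict
  n ^ (2 * q)  <⟨ m<m*n (n ^ (2 * q)) (β ^ q) {{m^n≢0 n (2 * q)}} 1<β^q ⟩
  n ^ (2 * q) * β ^ q  ≤⟨ *-monoˡ-≤ (β ^ q) (^-monoʳ-≤ n exponent) ⟩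
  n ^ (4 * t * 1 + 2 * t + 1) * β ^ q  ≡⟨ *-comm _ (β ^ q) ⟩
  β ^ q * n ^ (4 * t * 1 + 2 * t + 1)  ≡⟨ cong (λ d → β ^ d * n ^ (4 * t * 1 + 2 * t + 1)) (*-identityˡ q) ⟨
  β ^ (1 * q) * n ^ (4 * t * 1 + 2 * t + 1) ≤⟨ dense ⟩
  e ^ (1 * q)  ≡⟨ cong (e ^_) (*-identityˡ q) ⟩
  e ^ q  ≤⟨ ^-monoˡ-≤ q e≤ ⟩
  (n * n) ^ q  ≡⟨ cong (λ d → (n * d) ^ q) (*-identityʳ n) ⟨
  (n ^ 2) ^ q  ≡⟨ ^-*-assoc n 2 q ⟩
  n ^ (2 * q)  ∎) (<-irrefl refl)
  where
  q = 2 * t + 1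
  instance
    n≢0 : NonZero n
    n≢0 = >-nonZero 1≤n
  1<β^q : 1 < β ^ q
  1<β^q = ≤-trans 2≤β (m≤m^k β (m≤n+m 1 (2 * t)))
  exponent : 2 * q ≤ 4 * t * 1 + 2 * t + 1
  exponent = begin
    2 * q  ≡⟨ lemma₁ t ⟩
    4 * t + (1 + 0) + 1  ≤⟨ +-monoˡ-≤ 1 (+-monoʳ-≤ (4 * t) (≤-trans 1≤t (m≤m+n t (t + 0)))) ⟩
    4 * t + 2 * t + 1  ≡⟨ cong (λ d → d + 2 * t + 1) (*-identityʳ (4 * t)) ⟨
    4 * t * 1 + 2 * t + 1  ∎
    where
    lemma₁ : ∀ t → 2 * (2 * t + 1) ≡ 4 * t + (1 + 0) + 1
    lemma₁ = solve-∀

-- `ε` is an eighth of the average degree, rounded down. With N = 8n one has E ≤ 2εN, so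
-- `many-paths` turns into E³ ≤ 8N²P; this is the origin of the factor 8(8n)².
many-hexagon-paths : ∀ {n} (G : Graph n) (b : BoundedCodegree G 1) c γ κ → 1 ≤ n → 16 * n ≤ 2 * edges G →
  (8 * ((8 * n) * (8 * n))) * (n * n * (c * γ)) ≤ 2 * edges G * (2 * edges G * (2 * edges G)) →
  Hexagons.collisions G b + 4 * κ < c * γ → n * n * (Hexagons.collisions G b + 4 * κ) < ∑ (pairs n) (Hexagons.paths G b)
many-hexagon-paths {n} G b c γ κ 1≤n E-large cubic room = ≤-trans
  (*-monoʳ-< (n * n) {{>-nonZero (*-mono-≤ 1≤n 1≤n)}} room)
  (*-cancelˡ-≤ (8 * (N * N)) {{>-nonZero (*-mono-≤ {1} {8} (s≤s z≤n) (*-mono-≤ 1≤N 1≤N))}} (begin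
    8 * (N * N) * (n * n * (c * γ))  ≤⟨ cubic ⟩
    E * (E * E)  ≤⟨ *-monoʳ-≤ E (*-mono-≤ E≤2εN E≤2εN) ⟩
    E * ((2 * (ε * N)) * (2 * (ε * N)))  ≡⟨ lemma₁ E ε N ⟩
    4 * (N * N) * (E * (ε * ε))  ≤⟨ *-monoʳ-≤ (4 * (N * N)) (Paths.many-paths G b ε fits) ⟩
    4 * (N * N) * (2 * P)  ≡⟨ lemma₂ N P ⟩
    8 * (N * N) * P  ∎))
  where
  E = 2 * edges G
  P = ∑ (pairs n) (Hexagons.paths G b)
  N = 8 * n
  1≤N : 1 ≤ N
  1≤N = *-mono-≤ {1} {8} (s≤s z≤n) 1≤n
  instance
    N≢0 : NonZero N
    N≢0 = >-nonZero 1≤N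
  ε : ℕ
  ε = E / N
  lemma₁ : ∀ E ε N → E * ((2 * (ε * N)) * (2 * (ε * N))) ≡ 4 * (N * N) * (E * (ε * ε))
  lemma₁ = solve-∀
  lemma₂ : ∀ N P → 4 * (N * N) * (2 * P) ≡ 8 * (N * N) * P
  lemma₂ = solve-∀
  2N≤E : 2 * N ≤ E
  2N≤E = ≤-trans (≤-reflexive (sym (*-assoc 2 8 n))) E-large
  1≤ε : 1 ≤ ε
  1≤ε = ≤-pred (*-cancelʳ-< N 1 (suc ε) (begin-strict
    1 * N  ≤⟨ *-monoˡ-≤ N {1} {2} (s≤s z≤n) ⟩
    2 * N  ≤⟨ 2N≤E ⟩
    E  <⟨ /-upper E N ⟩
    suc ε * N  ∎))
  E≤2εN : E ≤ 2 * (ε * N)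
  E≤2εN = ≤-trans (<⇒≤ (/-upper E N)) (≤-trans (*-monoˡ-≤ N (2*[1+m]≤ 1≤ε)) (≤-reflexive (*-assoc 2 ε N)))
  fits : 4 * (n * (ε + 2)) ≤ E
  fits = *-cancelˡ-≤ 2 (begin
    2 * (4 * (n * (ε + 2)))  ≡⟨ lemma₃ n ε ⟩
    ε * N + 2 * N  ≤⟨ +-mono-≤ (m/n*n≤m E N) 2N≤E ⟩
    E + E  ≡⟨ cong (E +_) (+-identityʳ E) ⟨
    2 * E  ∎)
    where
    lemma₃ : ∀ n ε → 2 * (4 * (n * (ε + 2))) ≡ ε * (8 * n) + 2 * (8 * n)
    lemma₃ = solve-∀

-- This is 8(4t+4): the factor 4t+4 comes from `many-common`, and 8 = 2³ because pruning may halve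
-- E, which enters cubed.
prunedBound : ℕ → ℕ
prunedBound t = 32 * suc t

module DegreeCap {n : ℕ} (G : Graph n) (t β : ℕ) (2≤t : 2 ≤ t) (1≤n : 1 ≤ n) (1≤β : 1 ≤ β)
  (powers : β ^ (2 * t + 1) * n ^ (4 * t) ≤ (2 * edges G) ^ (2 * t + 1))
  (large₁ : prunedBound t * (2 * suc t) ≤ β) (large₂ : 2 * prunedBound t ≤ β) (large₃ : 4 * (2 ^ suc t * bound t) ≤ β)
  (bounded : BoundedCodegree G t) where

  E : ℕ
  E = 2 * edges G

  c₄ : ℕ
  c₄ = prunedBound t

  n⁴ : ℕ
  n⁴ = n ^ 4

  instance
    n≢0 : NonZero n
    n≢0 = >-nonZero 1≤n
    n⁴≢0 : NonZero n⁴
    n⁴≢0 = m^n≢0 n 4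
    β≢0 : NonZero β
    β≢0 = >-nonZero 1≤β
    c₄n⁴≢0 : NonZero (c₄ * n⁴)
    c₄n⁴≢0 = m*n≢0 c₄ n⁴

  -- Of the order E³/n⁴, a small fraction of the average number of closed 4-walks per edge. The cap
  -- is thus low enough for degenerate squares and conflicts to be affordable.
  Δ : ℕ
  Δ = E ^ 3 / (c₄ * n⁴)

  Δ-lower : Δ * (c₄ * n⁴) ≤ E ^ 3
  Δ-lower = m/n*n≤m (E ^ 3) (c₄ * n⁴)

  cubic : β ^ 3 * n⁴ ≤ E ^ 3
  cubic = rescale (4 * t) (2 * t + 1) 3 4 1≤n (m≤n+m 1 (2 * t)) (begin
    4 * (2 * t + 1)  ≡⟨ lemma t ⟩
    8 * t + 4  ≤⟨ +-monoʳ-≤ (8 * t) (*-monoʳ-≤ 4 (≤-trans (s≤s z≤n) 2≤t)) ⟩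
    8 * t + 4 * t  ≡⟨ lemma′ t ⟩
    4 * t * 3  ∎) powers
    where
    lemma : ∀ t → 4 * (2 * t + 1) ≡ 8 * t + 4
    lemma = solve-∀
    lemma′ : ∀ t → 8 * t + 4 * t ≡ 4 * t * 3
    lemma′ = solve-∀

  Δ-large : 2 * suc t ≤ Δ
  Δ-large = ≤-pred (*-cancelʳ-< (c₄ * n⁴) (2 * suc t) (suc Δ) (begin-strict
    2 * suc t * (c₄ * n⁴)  ≡⟨ lemma (2 * suc t) c₄ n⁴ ⟩
    c₄ * (2 * suc t) * n⁴  ≤⟨ *-monoˡ-≤ n⁴ (≤-trans large₁ (m≤m^k β {3} (s≤s z≤n))) ⟩
    β ^ 3 * n⁴  ≤⟨ cubic ⟩
    E ^ 3  <⟨ /-upper (E ^ 3) (c₄ * n⁴) ⟩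
    suc Δ * (c₄ * n⁴)  ∎))
    where
    lemma : ∀ a c m → a * (c * m) ≡ c * a * m
    lemma = solve-∀

  1≤Δ : 1 ≤ Δ
  1≤Δ = ≤-trans (s≤s z≤n) Δ-large

  Δ-upper : E ^ 3 ≤ 2 * c₄ * n⁴ * Δ
  Δ-upper = begin
    E ^ 3  ≤⟨ <⇒≤ (/-upper (E ^ 3) (c₄ * n⁴)) ⟩
    suc Δ * (c₄ * n⁴)  ≤⟨ *-monoˡ-≤ (c₄ * n⁴) (2*[1+m]≤ 1≤Δ) ⟩
    2 * Δ * (c₄ * n⁴)  ≡⟨ lemma Δ c₄ n⁴ ⟩
    2 * c₄ * n⁴ * Δ  ∎
    where
    lemma : ∀ d c m → 2 * d * (c * m) ≡ 2 * c * m * d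
    lemma = solve-∀

  Δ^t-upper : E ^ (3 * t) ≤ (2 * c₄) ^ t * n ^ (4 * t) * Δ ^ t
  Δ^t-upper = begin
    E ^ (3 * t)  ≡⟨ ^-*-assoc E 3 t ⟨
    (E ^ 3) ^ t  ≤⟨ ^-monoˡ-≤ t Δ-upper ⟩
    (2 * c₄ * n⁴ * Δ) ^ t  ≡⟨ *-^-distrib (2 * c₄ * n⁴) Δ t ⟩
    (2 * c₄ * n⁴) ^ t * Δ ^ t  ≡⟨ cong (_* Δ ^ t) (trans (*-^-distrib (2 * c₄) n⁴ t) (cong ((2 * c₄) ^ t *_) (^-*-assoc n 4 t))) ⟩
    (2 * c₄) ^ t * n ^ (4 * t) * Δ ^ t  ∎

  instance
    scale≢0 : NonZero ((2 * c₄) ^ t * n ^ (4 * t))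
    scale≢0 = m*n≢0 ((2 * c₄) ^ t) (n ^ (4 * t)) {{m^n≢0 (2 * c₄) t}} {{m^n≢0 n (4 * t)}}

  -- Inserting the size of Δ reduces the claim to E^(3t+1) against n^(5t+1). Here (5t+1)(2t+1) ≤
  -- 4t(3t+1) is required, which holds from t = 2 on; at t = 1 it reads 18 ≤ 16.
  few-high-factor : 4 * (2 ^ suc t * (n ^ suc t * bound t)) ≤ Δ ^ t * E
  few-high-factor = *-cancelˡ-≤ ((2 * c₄) ^ t * n ^ (4 * t)) (begin
    (2 * c₄) ^ t * n ^ (4 * t) * (4 * (2 ^ suc t * (n ^ suc t * bound t)))
      ≡⟨ lemma₁ ((2 * c₄) ^ t) (n ^ (4 * t)) (2 ^ suc t) (n ^ suc t) (bound t) ⟩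
    (2 * c₄) ^ t * (4 * (2 ^ suc t * bound t)) * (n ^ (4 * t) * n ^ suc t)
      ≤⟨ *-mono-≤ (*-mono-≤ (^-monoˡ-≤ t large₂) (≤-trans large₃ (m≤m^k β (m≤n+m 1 (2 * t)))))
           (≤-reflexive (trans (sym (^-distribˡ-+-* n (4 * t) (suc t))) (cong (n ^_) (exponent₁ t)))) ⟩
    β ^ t * β ^ (2 * t + 1) * n ^ (5 * t + 1)
      ≡⟨ cong (_* n ^ (5 * t + 1)) (trans (sym (^-distribˡ-+-* β t (2 * t + 1))) (cong (β ^_) (exponent₂ t))) ⟩
    β ^ (3 * t + 1) * n ^ (5 * t + 1)
      ≤⟨ rescale (4 * t) (2 * t + 1) (3 * t + 1) (5 * t + 1) 1≤n (m≤n+m 1 (2 * t)) (exponent₃ 2≤t) powers ⟩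
    E ^ (3 * t + 1)
      ≡⟨ trans (^-distribˡ-+-* E (3 * t) 1) (cong (E ^ (3 * t) *_) (*-identityʳ E)) ⟩
    E ^ (3 * t) * E
      ≤⟨ *-monoˡ-≤ E Δ^t-upper ⟩
    (2 * c₄) ^ t * n ^ (4 * t) * Δ ^ t * E
      ≡⟨ *-assoc ((2 * c₄) ^ t * n ^ (4 * t)) (Δ ^ t) E ⟩
    (2 * c₄) ^ t * n ^ (4 * t) * (Δ ^ t * E) ∎)
    where
    lemma₁ : ∀ a m p q b → a * m * (4 * (p * (q * b))) ≡ a * (4 * (p * b)) * (m * q)
    lemma₁ = solve-∀
    exponent₁ : ∀ t → 4 * t + suc t ≡ 5 * t + 1
    exponent₁ = solve-∀
    exponent₂ : ∀ t → t + (2 * t + 1) ≡ 3 * t + 1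
    exponent₂ = solve-∀
    exponent₃ : ∀ {t} → 2 ≤ t → (5 * t + 1) * (2 * t + 1) ≤ 4 * t * (3 * t + 1)
    exponent₃ {suc (suc s)} _ = ≤-trans (m≤m+n _ (2 * s * s + 5 * s + 1)) (≤-reflexive (lemma₂ s))
      where
      lemma₂ : ∀ s → (5 * suc (suc s) + 1) * (2 * suc (suc s) + 1) + (2 * s * s + 5 * s + 1) ≡ 4 * suc (suc s) * (3 * suc (suc s) + 1)
      lemma₂ = solve-∀
    exponent₃ {suc zero} (s≤s ())

  open HighDegree G t Δ bounded Δ-large

  E′ : ℕ
  E′ = 2 * edges pruned

  few-high : 4 * highSum ≤ E
  few-high = *-cancelʳ-≤ (4 * highSum) E (Δ ^ t) {{m^n≢0 Δ t {{>-nonZero 1≤Δ}}}} (begin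
    4 * highSum * Δ ^ t  ≡⟨ *-assoc 4 highSum (Δ ^ t) ⟩
    4 * (highSum * Δ ^ t)  ≤⟨ *-monoʳ-≤ 4 highSum-bound ⟩
    4 * (2 ^ suc t * (n ^ suc t * bound t))  ≤⟨ few-high-factor ⟩
    Δ ^ t * E  ≡⟨ *-comm (Δ ^ t) E ⟩
    E * Δ ^ t  ∎)

  half-kept : E ≤ 2 * E′
  half-kept = +-cancelʳ-≤ E E (2 * E′) (begin
    E + E  ≡⟨ cong (E +_) (+-identityʳ E) ⟨
    2 * E  ≤⟨ *-monoʳ-≤ 2 pruned-edges ⟩
    2 * (E′ + 2 * highSum)  ≡⟨ lemma E′ highSum ⟩
    2 * E′ + 4 * highSum  ≤⟨ +-monoʳ-≤ (2 * E′) few-high ⟩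
    2 * E′ + E  ∎)
    where
    lemma : ∀ e h → 2 * (e + 2 * h) ≡ 2 * e + 4 * h
    lemma = solve-∀

  E′≤E : E′ ≤ E
  E′≤E = begin
    E′  ≡⟨ ∑-degree pruned ⟨
    ∑ (allFin n) (degree pruned)  ≤⟨ ∑-mono (allFin n) (λ x → #-mono (Density._~?_ pruned x) (Density._~?_ G x) (allFin n) (pruned⊆ x)) ⟩
    ∑ (allFin n) (degree G)  ≡⟨ ∑-degree G ⟩
    E  ∎

  pruned-walks : (n * n) * ((n * n) * (E′ * ((4 * t + 4) * Δ))) ≤ (E′ * E′) * (E′ * E′)
  pruned-walks = *-cancelˡ-≤ 8 (begin
    8 * ((n * n) * ((n * n) * (E′ * ((4 * t + 4) * Δ))))  ≡⟨ lemma₁ n E′ t Δ ⟩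
    E′ * (Δ * (32 * suc t * (n * (n * (n * (n * 1))))))  ≤⟨ *-monoʳ-≤ E′ Δ-lower ⟩
    E′ * E ^ 3  ≤⟨ *-monoʳ-≤ E′ (^-monoˡ-≤ 3 half-kept) ⟩
    E′ * (2 * E′) ^ 3  ≡⟨ lemma₂ E′ ⟩
    8 * ((E′ * E′) * (E′ * E′))  ∎)
    where
    lemma₁ : ∀ n e t d → 8 * ((n * n) * ((n * n) * (e * ((4 * t + 4) * d)))) ≡ e * (d * (32 * suc t * (n * (n * (n * (n * 1))))))
    lemma₁ = solve-∀
    lemma₂ : ∀ e → e * ((2 * e) * ((2 * e) * ((2 * e) * 1))) ≡ 8 * ((e * e) * (e * e))
    lemma₂ = solve-∀

-- The sum of the lower bounds that `many-cubes` places on H, with the factor γ of κ taken out.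
cubeThreshold : ℕ → ℕ → ℕ
cubeThreshold r t = 2 * (t * (2 * bound t + 2 * bound t)) + 2 ^ suc t * (2 * t * fibreFactor r t) + 1

-- The first factor is lost in passing from E^(3t) to Δ^t; the second makes the average of `common`
-- exceed twice the cut, with 1 added for strictness.
squareFactor : ℕ → ℕ → ℕ
squareFactor r t = (2 * prunedBound t) ^ t * (2 * cubeThreshold r t + 1)

module CubeCase {n : ℕ} (G : Graph n) (r t″ β γ : ℕ) (1≤n : 1 ≤ n) (1≤β : 1 ≤ β) (1≤γ : 1 ≤ γ) where

  t′ t : ℕ
  t′ = suc t″
  t = suc t′

  cube-target : β ^ (2 * t + 1) * n ^ (4 * t) ≤ (2 * edges G) ^ (2 * t + 1) →
    prunedBound t * (2 * suc t) ≤ β → 2 * prunedBound t ≤ β → 4 * (2 ^ suc t * bound t) ≤ β →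
    γ * (squareFactor r t * n ^ (4 * t)) ≤ (2 * edges G) ^ (2 * t + 1) →
    Parameters r t n γ (depth r) (nodeFactor r t * γ) (fibreFactor r t * γ) →
    BoundedCodegree G t → Target G r t
  cube-target powers large₁ large₂ large₃ γ-lower params bounded =
    target-⊆ {r = r} {t = t} pruned⊆ (cubes⇒target pruned Δ pruned-bounded pruned-degree params
      (many-cubes (fibreFactor r t * γ) cut B≤cut A≤cut 1≤cut enough))
    where
    open DegreeCap G t β (s≤s (s≤s z≤n)) 1≤n 1≤β powers large₁ large₂ large₃ bounded
    open HighDegree G t Δ bounded Δ-large using (pruned; pruned⊆; pruned-bounded; pruned-degree)
    open CubeCount pruned t′ Δ pruned-bounded pruned-degree using (many-cubes; many-common; matchings; common; B)
    cut₀ cut : ℕ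
    cut₀ = cubeThreshold r t
    cut = cut₀ * γ
    B≤cut : 2 * B ≤ cut
    B≤cut = ≤-trans (≤-trans (m≤m+n (2 * B) _) (m≤m+n _ 1)) (m≤m*n cut₀ γ {{>-nonZero 1≤γ}})
    A≤cut : 2 ^ suc t * (2 * t * (fibreFactor r t * γ)) ≤ cut
    A≤cut = ≤-trans (≤-reflexive (lemma (2 ^ suc t) (2 * t) (fibreFactor r t) γ))
      (*-monoˡ-≤ γ (≤-trans (m≤n+m _ (2 * B)) (m≤m+n _ 1)))
      where
      lemma : ∀ a b c d → a * (b * (c * d)) ≡ a * (b * c) * d
      lemma = solve-∀
    1≤cut : 1 ≤ cut
    1≤cut = *-mono-≤ (m≤n+m 1 (2 * B + 2 ^ suc t * (2 * t * fibreFactor r t))) 1≤γ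
    1≤E : 1 ≤ E
    1≤E = ≰⇒> (λ E≤0 → contradiction (≤-trans (*-mono-≤ (m^n>0 β (2 * t + 1)) (m^n>0 n (4 * t)))
      (≤-trans powers (≤-trans (^-monoˡ-≤ (2 * t + 1) E≤0) (≤-reflexive (cong (0 ^_) (+-comm (2 * t) 1)))))) (λ ()))
    1≤E′ : 1 ≤ E′
    1≤E′ = *-cancelˡ-≤ 2 (≤-trans (even E 1≤E (edges G) refl) half-kept)
      where
      even : ∀ e → 1 ≤ e → ∀ k → e ≡ 2 * k → 2 * 1 ≤ e
      even e 1≤e zero refl = contradiction 1≤e (λ ())
      even e 1≤e (suc k) refl = *-monoʳ-≤ 2 (s≤s z≤n)
    -- Among at most E^t matchings the average of `common` is about Δ^t/E^(t-1), that is
    -- E^(2t+1)/n^(4t) up to constants, the order of γ. The exponents meet in (2t+1) + (t-1) = 3t.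
    capacity : 2 * cut * E ^ t′ < Δ ^ t
    capacity = *-cancelˡ-< ((2 * c₄) ^ t * n ^ (4 * t)) _ _ (begin-strict
      (2 * c₄) ^ t * n ^ (4 * t) * (2 * cut * E ^ t′)
        <⟨ *-monoʳ-< ((2 * c₄) ^ t * n ^ (4 * t)) (*-monoˡ-< (E ^ t′) {{m^n≢0 E t′ {{>-nonZero 1≤E}}}} (m<m+n (2 * cut) 1≤γ)) ⟩
      (2 * c₄) ^ t * n ^ (4 * t) * ((2 * cut + γ) * E ^ t′)
        ≡⟨ lemma ((2 * c₄) ^ t) (n ^ (4 * t)) cut₀ γ (E ^ t′) ⟩
      γ * ((2 * c₄) ^ t * (2 * cut₀ + 1) * n ^ (4 * t)) * E ^ t′
        ≤⟨ *-monoˡ-≤ (E ^ t′) γ-lower ⟩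
      E ^ (2 * t + 1) * E ^ t′
        ≡⟨ trans (sym (^-distribˡ-+-* E (2 * t + 1) t′)) (cong (E ^_) (exponent t′)) ⟩
      E ^ (3 * t)
        ≤⟨ Δ^t-upper ⟩
      (2 * c₄) ^ t * n ^ (4 * t) * Δ ^ t ∎)
      where
      lemma : ∀ a m h g e → a * m * ((2 * (h * g) + g) * e) ≡ g * (a * (2 * h + 1) * m) * e
      lemma = solve-∀
      exponent : ∀ s → 2 * suc s + 1 + s ≡ 3 * suc s
      exponent = solve-∀
    enough : 2 * cut * SquareCount.E pruned Δ pruned-degree ^ t < ∑ matchings common
    enough = begin-strict
      2 * cut * ∑ (allFin n) (degree pruned) ^ t  ≡⟨ cong (λ e → 2 * cut * e ^ t) (∑-degree pruned) ⟩
      2 * cut * (E′ * E′ ^ t′)  ≤⟨ *-monoʳ-≤ (2 * cut) (*-monoʳ-≤ E′ (^-monoˡ-≤ t′ E′≤E)) ⟩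
      2 * cut * (E′ * E ^ t′)  ≡⟨ lemma (2 * cut) E′ (E ^ t′) ⟩
      2 * cut * E ^ t′ * E′  <⟨ *-monoˡ-< E′ {{>-nonZero 1≤E′}} capacity ⟩
      Δ ^ t * E′  ≡⟨ cong (Δ ^ t *_) (∑-degree pruned) ⟨
      Δ ^ t * ∑ (allFin n) (degree pruned)
        ≤⟨ many-common 1≤n (subst (λ e → (n * n) * ((n * n) * (e * ((4 * t + 4) * Δ))) ≤ (e * e) * (e * e)) (sym (∑-degree pruned)) pruned-walks) ⟩
      ∑ matchings common  ∎
      where
      lemma : ∀ h e f → h * (e * f) ≡ h * f * e
      lemma = solve-∀

-- The two cases and the choice of β.

hexagonFactor : ℕ → ℕ
hexagonFactor r = 2 * (2 * bound 1) + 4 * fibreFactor r 1 + 1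

-- Sums in place of maxima, so that every lower bound on β is a summand. For t = 1, 512 = 8 · 8²
-- comes from the count of paths and 16 ensures E ≥ 16n. The value at t = 0 is a default outside the
-- range of the theorem.
constant : ℕ → ℕ → ℕ
constant r zero = 0
constant r (suc zero) = 2 * (512 * hexagonFactor r) + 16
constant r t@(suc (suc _)) = 2 * squareFactor r t +
  (prunedBound t * (2 * suc t) + (2 * prunedBound t + (4 * (2 ^ suc t * bound t) + 2)))

doubled : ∀ {a e} k → a ≤ e ^ k → a ≤ (2 * e) ^ k
doubled {e = e} k h = ≤-trans h (^-monoˡ-≤ k (m≤m+n e (e + 0)))

hexagon-case : ∀ {r n β c h} (G : Graph n) → 1 ≤ r → 2 ≤ r → 1 ≤ n → 1 ≤ c → 2 * c ≤ β → 16 ≤ β → 512 * h ≤ c →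
  2 * (2 * bound 1) + 4 * fibreFactor r 1 + 1 ≤ h → EdgeCondition r 1 β n G → Target G r 1
hexagon-case {r} {n} {β} {c} {h} G 1≤r 2≤r 1≤n 1≤c 2c≤β 16≤β 512h≤c h-large dense with boundedCodegree G 1 r (s≤s z≤n) 2≤r
... | inj₁ found = found
... | inj₂ bounded = hexagons⇒target G bounded parameters (λ b → many-hexagon-paths G b h γ (fibreFactor r 1 * γ)
        1≤n E-large cubic (room (2 * (2 * bound 1)) (fibreFactor r 1) h-large))
  where
  E = 2 * edges G
  open Scale r 1 n β c E 1≤r (s≤s z≤n) 1≤n 1≤c 2c≤β (doubled (r * 3) dense)
  E-large : 16 * n ≤ E
  E-large = ^-cancel-≤ 3 (s≤s z≤n) (begin
    (16 * n) ^ 3  ≡⟨ *-^-distrib 16 n 3 ⟩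
    16 ^ 3 * n ^ 3  ≤⟨ *-mono-≤ (^-monoˡ-≤ 3 16≤β) (^-monoʳ-≤ n {{>-nonZero 1≤n}} (n≤1+n 3)) ⟩
    β ^ 3 * n ^ 4  ≤⟨ powers ⟩
    E ^ 3  ∎)
  cubic : (8 * ((8 * n) * (8 * n))) * (n * n * (h * γ)) ≤ E * (E * E)
  cubic = begin
    (8 * ((8 * n) * (8 * n))) * (n * n * (h * γ))  ≡⟨ lemma n h γ ⟩
    γ * (512 * h * n ^ 4)  ≤⟨ *-monoʳ-≤ γ (*-monoˡ-≤ (n ^ 4) 512h≤c) ⟩
    γ * (c * n ^ 4)  ≤⟨ γ-lower ⟩
    E ^ 3  ≡⟨ cong (λ e → E * (E * e)) (*-identityʳ E) ⟩
    E * (E * E)  ∎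
    where
    lemma : ∀ n h g → (8 * ((8 * n) * (8 * n))) * (n * n * (h * g)) ≡ g * (512 * h * (n * (n * (n * (n * 1)))))
    lemma = solve-∀
  room : ∀ a f → a + 4 * f + 1 ≤ h → a + 4 * (f * γ) < h * γ
  room a f large = begin-strict
    a + 4 * (f * γ)  ≤⟨ +-monoˡ-≤ (4 * (f * γ)) (m≤m*n a γ {{>-nonZero 1≤γ}}) ⟩
    a * γ + 4 * (f * γ)  <⟨ m<m+n _ 1≤γ ⟩
    a * γ + 4 * (f * γ) + γ  ≡⟨ lemma a f γ ⟩
    (a + 4 * f + 1) * γ  ≤⟨ *-monoˡ-≤ γ large ⟩
    h * γ  ∎
    where
    lemma : ∀ a f g → a * g + 4 * (f * g) + g ≡ (a + 4 * f + 1) * g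
    lemma = solve-∀

cube-case : ∀ {r t″ n} (G : Graph n) → let t = suc (suc t″) in
  1 ≤ r → 2 ≤ r → 1 ≤ n → EdgeCondition r t (constant r t) n G → Target G r t
cube-case {r} {t″} {n} G 1≤r 2≤r 1≤n dense with boundedCodegree G (suc (suc t″)) r (s≤s z≤n) 2≤r
... | inj₁ found = found
... | inj₂ bounded = CubeCase.cube-target G r t″ β γ 1≤n 1≤β 1≤γ powers
        (≤-trans (m≤m+n a (b + (d + 2))) (m≤n+m (a + (b + (d + 2))) (2 * c)))
        (≤-trans (≤-trans (m≤m+n b (d + 2)) (m≤n+m (b + (d + 2)) a)) (m≤n+m (a + (b + (d + 2))) (2 * c)))
        (≤-trans (≤-trans (≤-trans (m≤m+n d 2) (m≤n+m (d + 2) b)) (m≤n+m (b + (d + 2)) a)) (m≤n+m (a + (b + (d + 2))) (2 * c)))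
        γ-lower parameters bounded
  where
  t = suc (suc t″)
  β = constant r t
  c = squareFactor r t
  a = prunedBound t * (2 * suc t)
  b = 2 * prunedBound t
  d = 4 * (2 ^ suc t * bound t)
  1≤c : 1 ≤ c
  1≤c = *-mono-≤ (m^n>0 (2 * prunedBound t) t) (m≤n+m 1 (2 * cubeThreshold r t))
  open Scale r t n β c (2 * edges G) 1≤r (s≤s z≤n) 1≤n 1≤c (m≤m+n (2 * c) (a + (b + (d + 2)))) (doubled (r * (2 * t + 1)) dense)

theorem5p9 : (r t : ℕ) → 1 ≤ r → 1 ≤ t →
    Σ ℕ λ β →
    (n : ℕ) (G : Graph n) →
    EdgeCondition r t β n G →
    LogCondition r t n →
    t ! < n →
    Σ (Subgraph G) λ S →
    (1 ≤ m S) ×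
    ((2 * t + 1) * m S ≤ 2 * edges (H S)) ×
    RadiusAtMost (H S) (r + 1) ×
    (m S ≤ r * (4 * t * t + 2 * t))
theorem5p9 r (suc zero) 1≤r 1≤t = β , λ n G dense _ 1<n →
  hexagon-case {r} {n} {β} {c} {hexagonFactor r} G 1≤r
    (2≤r {r} {1} {n} {β} {edges G} 1≤r 1≤t (<⇒≤ 1<n)
      (≤-trans (s≤s (s≤s z≤n)) (m≤n+m 16 (2 * c)))
      (≤-trans (m≤m+n (edges G) (edges G + 0)) (2*edges≤n² G)) dense)
    (<⇒≤ 1<n) (*-mono-≤ {1} {512} {1} {hexagonFactor r} (s≤s z≤n) (m≤n+m 1 (2 * (2 * bound 1) + 4 * fibreFactor r 1))) (m≤m+n (2 * c) 16) (m≤n+m 16 (2 * c)) ≤-refl ≤-refl dense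
  where
  c = 512 * hexagonFactor r
  β = constant r 1
theorem5p9 r t@(suc (suc t″)) 1≤r 1≤t = constant r t , λ n G dense _ t!<n →
  cube-case G 1≤r
    (2≤r {r} {t} {n} {constant r t} {edges G} 1≤r 1≤t (≤-trans (s≤s z≤n) t!<n)
      (≤-trans (m≤n+m 2 (2 * squareFactor r t + (a + (b + d)))) (≤-reflexive (regroup (2 * squareFactor r t) a b d)))
      (≤-trans (m≤m+n (edges G) (edges G + 0)) (2*edges≤n² G)) dense)
    (≤-trans (s≤s z≤n) t!<n) dense
  where
  a = prunedBound t * (2 * suc t)
  b = 2 * prunedBound t
  d = 4 * (2 ^ suc t * bound t)
  regroup : ∀ c a b d → c + (a + (b + d)) + 2 ≡ c + (a + (b + (d + 2)))
  regroup = solve-∀
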